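{- Let $v$ be a positive integer divisible by $4$ and let $p_1^{m_1} p_2^{m_2} \cdots p_k^{m_k}$ be the prime factorization of $\frac{v}{4}$. Let $\alpha(v)$ be the number of equivalence classes of trihexes with $v$ vertices, and let $\beta(v)$ be the number of graph isomorphism classes of trihexes with $v$ vertices. Then $$\frac{1}{3} \prod_{i = 1}^k \frac{p_i^{m_i + 1} - 1}{p_i - 1} \leq \alpha(v) \leq \prod_{i = 1}^k \frac{p_i^{m_i + 1} - 1}{p_i - 1}$$ and $$\frac{1}{6} \prod_{i = 1}^k \frac{p_i^{m_i + 1} - 1}{p_i - 1} \leq \beta(v) \leq \prod_{i = 1}^k \frac{p_i^{m_i + 1} - 1}{p_i - 1}.$$
   Context: A trihex is a finite, connected, 3-regular planar graph, drawn in the plane regarded as part of the oriented sphere $S^2=\mathbb{R}^2\cup\{\infty\}$, whose faces (including the unbounded one) all have three or six sides. Two trihexes are equivalent if there is an orientation-preserving homeomorphism of the sphere taking one graph to the other (so a trihex and its mirror image need not be equivalent). For $v=4$ the product is empty and equals $1$. -}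

module Defs where

open import Data.Fin using (Fin; _≟_)
open import Data.Fin.Permutation as Perm using (Permutation; Permutation′; _⟨$⟩ʳ_; _⟨$⟩ˡ_)
open import Data.Integer using (+_)
open import Data.List using (length; filter; allFin)
open import Data.Nat using (ℕ; _+_; _*_; _∸_; _^_; _/_; NonZero; _≥_; >-nonZero; nonTrivial⇒n>1)
open import Data.Nat.GeneralisedArithmetic using (iterate)
open import Data.Nat.Primality using (Prime; prime⇒nonTrivial)
open import Data.Nat.Properties using (m<n⇒0<n∸m)
open import Data.Product using (∃; Σ; _×_; _,_)
open import Data.Rational as ℚ using (ℚ)
open import Data.Sum using (_⊎_)
open import Data.Vec.Functional using (foldr)
open import Function.Bundles using (_⇔_; Bijection)
open import Function.Definitions using (Injective; Surjective)
open import Level using (0ℓ)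
open import Relation.Binary.Bundles using (Setoid)
open import Relation.Binary.Construct.Closure.ReflexiveTransitive using (Star)
open import Relation.Binary.PropositionalEquality

fibreSize : ∀ {m n} → (Fin m → Fin n) → Fin n → ℕ
fibreSize {m} f c = length (filter (λ x → f x ≟ c) (allFin m))

-- For a permutation of a finite set, forward iteration already reaches the
-- whole cycle, so this relation is symmetric in all uses below.
SameCycle : ∀ {n} → (Fin n → Fin n) → Fin n → Fin n → Set
SameCycle π x y = ∃ λ k → iterate π x k ≡ y

-- A finite graph on the vertex set Fin v, loops and parallel edges allowed.
-- Every edge is a pair {x , rev x} of opposite darts (oriented edges), the
-- dart x running from src x to src (rev x).
record Graph (v : ℕ) : Set where
  field
    darts          : ℕ
    src            : Fin darts → Fin v
    rev            : Fin darts → Fin darts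
    rev-involutive : ∀ x → rev (rev x) ≡ x
    rev-noFixpoint : ∀ x → rev x ≢ x

  edges : ℕ
  edges = darts / 2

  -- A loop contributes two darts, hence 2, to the degree.
  degree : Fin v → ℕ
  degree = fibreSize src

  Adjacent : Fin v → Fin v → Set
  Adjacent u w = ∃ λ x → src x ≡ u × src (rev x) ≡ w

  Connected : Set
  Connected = ∀ u w → Star Adjacent u w

  Regular : ℕ → Set
  Regular k = ∀ u → degree u ≡ k

-- A cellular drawing of a graph on an oriented closed surface, up to
-- orientation-preserving homeomorphism: rotation sends a dart to the next
-- dart counterclockwise around its source.  Walking along x and then leaving
-- by the dart following rev x keeps a fixed face on one side, so the cycles
-- of faceStep are the boundary walks of the faces; face x is the face whose
-- boundary walk contains x.
record Drawing {v : ℕ} (G : Graph v) : Set where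
  open Graph G
  field
    rotation        : Permutation′ darts
    rotation-cycles : ∀ x y → src x ≡ src y ⇔ SameCycle (rotation ⟨$⟩ʳ_) x y

  faceStep : Fin darts → Fin darts
  faceStep x = rotation ⟨$⟩ʳ rev x

  field
    faces           : ℕ
    face            : Fin darts → Fin faces
    face-surjective : Surjective _≡_ _≡_ face
    face-cycles     : ∀ x y → face x ≡ face y ⇔ SameCycle faceStep x y

  -- An edge having the same face on both of its sides is counted twice.
  sides : Fin faces → ℕ
  sides = fibreSize face

  -- Euler's formula: for a connected graph with at least one edge, this says
  -- that the surface is the sphere.
  Spherical : Set
  Spherical = v + faces ≡ edges + 2

record Trihex (v : ℕ) : Set where
  field
    graph   : Graph v
    drawing : Drawing graph
  open Graph graph public
  open Drawing drawing public
  field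
    connected : Connected
    cubic     : Regular 3
    spherical : Spherical
    triOrHex  : ∀ f → sides f ≡ 3 ⊎ sides f ≡ 6

record _≅_ {v : ℕ} (G H : Graph v) : Set where
  private
    module G = Graph G
    module H = Graph H
  field
    onVertices : Permutation′ v
    onDarts    : Permutation G.darts H.darts
    src-comm   : ∀ x → H.src (onDarts ⟨$⟩ʳ x) ≡ onVertices ⟨$⟩ʳ G.src x
    rev-comm   : ∀ x → H.rev (onDarts ⟨$⟩ʳ x) ≡ onDarts ⟨$⟩ʳ G.rev x

open _≅_ public

-- The isomorphism preserves the counterclockwise order around each vertex,
-- i.e. it extends to an orientation-preserving homeomorphism of the sphere.
PreservesRotation : ∀ {v} (S T : Trihex v) → Trihex.graph S ≅ Trihex.graph T → Set
PreservesRotation S T i =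
  ∀ x → Trihex.rotation T ⟨$⟩ʳ (onDarts i ⟨$⟩ʳ x) ≡ onDarts i ⟨$⟩ʳ (Trihex.rotation S ⟨$⟩ʳ x)

Isomorphic : ∀ {v} → Trihex v → Trihex v → Set
Isomorphic S T = Trihex.graph S ≅ Trihex.graph T

Equivalent : ∀ {v} → Trihex v → Trihex v → Set
Equivalent S T = Σ (Isomorphic S T) (PreservesRotation S T)

private
  ≅-refl : ∀ {v} {G : Graph v} → G ≅ G
  ≅-refl = record { onVertices = Perm.id ; onDarts = Perm.id
                  ; src-comm = λ _ → refl ; rev-comm = λ _ → refl }

  flip-comm : ∀ {m n m′ n′} (π : Permutation m n) (ρ : Permutation m′ n′)
              {f : Fin m → Fin m′} {g : Fin n → Fin n′} →
              (∀ x → g (π ⟨$⟩ʳ x) ≡ ρ ⟨$⟩ʳ f x) →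
              ∀ y → f (Perm.flip π ⟨$⟩ʳ y) ≡ Perm.flip ρ ⟨$⟩ʳ g y
  flip-comm π ρ {f} {g} h y = begin
    f (π ⟨$⟩ˡ y)                       ≡⟨ Perm.inverseˡ ρ ⟨
    ρ ⟨$⟩ˡ (ρ ⟨$⟩ʳ f (π ⟨$⟩ˡ y))       ≡⟨ cong (ρ ⟨$⟩ˡ_) (h (π ⟨$⟩ˡ y)) ⟨
    ρ ⟨$⟩ˡ g (π ⟨$⟩ʳ (π ⟨$⟩ˡ y))       ≡⟨ cong (λ z → ρ ⟨$⟩ˡ g z) (Perm.inverseʳ π) ⟩
    ρ ⟨$⟩ˡ g y                         ∎
    where open ≡-Reasoning

  ≅-sym : ∀ {v} {G H : Graph v} → G ≅ H → H ≅ G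
  ≅-sym {G = G} {H} i = record
    { onVertices = Perm.flip (onVertices i)
    ; onDarts    = Perm.flip (onDarts i)
    ; src-comm   = flip-comm (onDarts i) (onVertices i) {G.src} {H.src} (src-comm i)
    ; rev-comm   = flip-comm (onDarts i) (onDarts i) {G.rev} {H.rev} (rev-comm i)
    }
    where
    module G = Graph G
    module H = Graph H

  ≅-trans : ∀ {v} {G H K : Graph v} → G ≅ H → H ≅ K → G ≅ K
  ≅-trans i j = record
    { onVertices = onVertices i Perm.∘ₚ onVertices j
    ; onDarts    = onDarts i Perm.∘ₚ onDarts j
    ; src-comm   = λ x → trans (src-comm j _) (cong (onVertices j ⟨$⟩ʳ_) (src-comm i x))
    ; rev-comm   = λ x → trans (rev-comm j _) (cong (onDarts j ⟨$⟩ʳ_) (rev-comm i x))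
    }

trihexesUpToEquivalence : ℕ → Setoid 0ℓ 0ℓ
trihexesUpToEquivalence v = record
  { Carrier = Trihex v
  ; _≈_ = Equivalent
  ; isEquivalence = record
    { refl  = ≅-refl , λ _ → refl
    ; sym   = λ { (i , p) → ≅-sym i , flip-comm (onDarts i) (onDarts i) p }
    ; trans = λ { (i , p) (j , q) →
        ≅-trans i j , λ x → trans (q _) (cong (onDarts j ⟨$⟩ʳ_) (p x)) }
    }
  }

trihexesUpToIsomorphism : ℕ → Setoid 0ℓ 0ℓ
trihexesUpToIsomorphism v = record
  { Carrier = Trihex v
  ; _≈_ = Isomorphic
  ; isEquivalence = record { refl = ≅-refl ; sym = ≅-sym ; trans = ≅-trans }
  }

-- S has exactly n equivalence classes.
HasClasses : Setoid 0ℓ 0ℓ → ℕ → Set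
HasClasses S n = Bijection (setoid (Fin n)) S

-- n = p₁^m₁ ⋯ pₖ^mₖ with distinct primes pᵢ and positive exponents mᵢ.
record PrimePowerFactorisation (n : ℕ) : Set where
  field
    k          : ℕ
    p          : Fin k → ℕ
    m          : Fin k → ℕ
    p-prime    : ∀ i → Prime (p i)
    p-distinct : Injective _≡_ _≡_ p
    m-positive : ∀ i → m i ≥ 1
    product    : foldr _*_ 1 (λ i → p i ^ m i) ≡ n

pred-nonZero : ∀ {p} → Prime p → NonZero (p ∸ 1)
pred-nonZero {p} pr = >-nonZero (m<n⇒0<n∸m (nonTrivial⇒n>1 p {{prime⇒nonTrivial pr}}))

-- ∏ᵢ (pᵢ^(mᵢ+1) − 1) / (pᵢ − 1); the truncated subtractions are exact, as
-- pᵢ ≥ 2.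
divisorProduct : ∀ {n} → PrimePowerFactorisation n → ℚ
divisorProduct F = foldr ℚ._*_ ℚ.1ℚ factor
  where
  open PrimePowerFactorisation F
  factor : Fin k → ℚ
  factor i = ℚ._/_ (+ (p i ^ (m i + 1) ∸ 1)) (p i ∸ 1) {{pred-nonZero (p-prime i)}}

fromℕ : ℕ → ℚ
fromℕ n = + n ℚ./ 1

-- The faces of a trihex have 3 or 6 sides, so it is a quotient of the hexagonal tiling, whose hexagon centres form the
-- lattice ℤ[ω] of Eisenstein integers.  By Euler's formula some face is a triangle; put its centre at the origin.  The
-- deck group then contains the half-turn about 0.  It contains no rotation fixing a vertex or the midpoint of an edge
-- and no rotation of order 3, so it is 2Λ ⋊ {±1} for a sublattice Λ, of index v / 4.  Conversely every Λ yields a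
-- trihex: its vertices are the classes of ℤ[ω] modulo 2Λ, and its triangles are centred at the points of Λ / 2Λ.
-- In Hermite normal form, the number of sublattices of index n is the sum of the divisors of n, which is the product.
--
-- An equivalence of trihexes multiplies Λ by a power of ω; as - 1 acts trivially, each class contains at most
-- three lattices.  A graph isomorphism preserves or reverses the rotation at each vertex.  If it does not do the same
-- at all vertices, then some face of the target pulls back to a closed walk of length 6 turning both left and right.
-- Inspection of all such walks shows that one closes up in the quotient only if Λ contains a unit.  Hence, if Λ has no
-- unit, an isomorphism multiplies Λ, or its complex conjugate, by a power of ω; and the lattices of a given index
-- which contain a unit are multiples of one another anyway.  So each isomorphism class contains at most six lattices.

module Submission where

open import Defs
open import Data.Bool as Bool using (Bool; true; false)
open import Data.Empty using (⊥; ⊥-elim)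
open import Data.Fin as Fin using (Fin; zero; suc; toℕ; fromℕ<; combine; remQuot)
open import Data.Fin.Patterns using (0F; 1F; 2F; 3F; 4F; 5F)
open import Data.Fin.Permutation as Perm using (permutation; _⟨$⟩ʳ_; _⟨$⟩ˡ_)
import Data.Fin.Properties as Finₚ
open import Data.Integer as ℤ using (ℤ; +_; -[1+_])
import Data.Integer.DivMod as ℤ
import Data.Integer.Properties as ℤₚ
import Data.Integer.Tactic.RingSolver as ℤ
open import Data.List using (List; []; _∷_; _++_; map; filter; allFin; lookup)
open import Data.List.Membership.Propositional using (_∈_)
open import Data.List.Membership.Propositional.Properties using (∈-filter⁺; ∈-allFin; ∈-lookup; ∈-map⁺; ∈-map⁻; ∈-++⁺ˡ; ∈-++⁺ʳ; ∈-++⁻)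
import Data.List.Relation.Unary.All as All
import Data.List.Relation.Unary.All.Properties as All
open import Data.List.Relation.Unary.AllPairs using ([]; _∷_)
open import Data.List.Relation.Unary.Any as Any using (here; there)
import Data.List.Relation.Unary.Any.Properties as Any
open import Data.List.Relation.Unary.Unique.Propositional using (Unique)
import Data.List.Relation.Unary.Unique.Propositional.Properties as Unique
open import Data.Nat using (ℕ; zero; suc; _+_; _*_; _∸_; _^_; _/_; _%_; _≤_; _<_; _>_; s≤s; z<s; s<s; NonZero; >-nonZero; ≢-nonZero⁻¹)
open import Data.Nat.Coprimality using (Coprime; coprime-divisor)
open import Data.Nat.Divisibility hiding (quotient)
open import Data.Nat.DivMod using (m%n<n; m≡m%n+[m/n]*n; m*n/n≡m; m/n*n≡m)
open import Data.Nat.GeneralisedArithmetic using (iterate)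
open import Data.Nat.ListAction using (sum)
open import Data.Nat.ListAction.Properties using (sum-++)
open import Data.Nat.Primality using (Prime; prime⇒irreducible; prime⇒nonZero; prime⇒nonTrivial; euclidsLemma)
import Data.Nat.Properties as ℕₚ
import Data.Nat.Tactic.RingSolver as ℕ
open import Data.Product using (∃; ∃₂; Σ; _×_; _,_; proj₁; proj₂)
open import Data.Product.Properties using (≡-dec)
open import Data.Rational as ℚ using (ℚ)
import Data.Rational.Properties as ℚₚ
open import Data.Rational.Unnormalised as ℚᵘ using (mkℚᵘ; *≡*)
import Data.Rational.Unnormalised.Properties as ℚᵘₚ
open import Data.Sum as Sum using (_⊎_; inj₁; inj₂; [_,_]′)
open import Data.Unit using (⊤; tt)
open import Data.Vec as Vec using (Vec; []; _∷_)
open import Data.Vec.Functional using (foldr)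
import Data.Vec.Properties as Vec
open import Function using (_∘_; case_of_)
open import Function.Bundles using (_⇔_; mk⇔; Equivalence)
open import Level using (0ℓ)
open import Relation.Binary.Bundles using (Setoid)
open import Relation.Binary.Construct.Closure.ReflexiveTransitive as Star using (Star; ε; _◅_; _◅◅_)
open import Relation.Binary.Definitions using (tri<; tri≈; tri>)
open import Relation.Binary.PropositionalEquality
open import Relation.Nullary using (¬_; Dec; yes; no; contradiction)
open import Relation.Nullary.Decidable using (map′; ¬?; _×-dec_; _⊎-dec_; toWitness)

-- Finite sets and permutations

-- No covering space is built. With φ the face step and ι the reversal of darts, the degrees and the
-- numbers of sides give φ⁶ = ι² = (φ ι)³ = 1. These relations present the rotation group of the
-- hexagonal tiling, so this group acts on the finite set of darts. Its translations are words in φ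
-- and ι, the covering map is the orbit map of a dart x₀ on a triangle, and 2 Λ is the stabiliser of
-- x₀ among the translations. The price is that such words see a translation in the frame of the
-- dart they act on: in direction k, the word for t translates by ωᵏ t. Hence a lattice can be read
-- off a trihex only up to a power of ω, depending on the dart chosen. `HasClasses` demands an
-- explicit bijection, so both relations between trihexes must be decidable; this is achieved by
-- searching all tables of maps. The lower bounds then hold because a representative of a class,
-- together with one of three or six symmetries, determines a lattice.

lookup-injective : ∀ {a} {A : Set a} {xs : List A} → Unique xs →
                   ∀ {i j} → lookup xs i ≡ lookup xs j → i ≡ j
lookup-injective (_ ∷ _)  {zero}  {zero}  _  = refl
lookup-injective (x∉ ∷ _) {zero}  {suc j} eq = contradiction eq (All.lookup x∉ (∈-lookup j))
lookup-injective (x∉ ∷ _) {suc i} {zero}  eq = contradiction (sym eq) (All.lookup x∉ (∈-lookup i))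
lookup-injective (_ ∷ u)  {suc i} {suc j} eq = cong suc (lookup-injective u eq)

-- An enumeration without repetitions determines `fibreSize` by `fibreSize-≡`, which spares later
-- arguments any filtered list.
record Fibre {m n} (f : Fin m → Fin n) (c : Fin n) (k : ℕ) : Set where
  field
    elem      : Fin k → Fin m
    injective : ∀ {i j} → elem i ≡ elem j → i ≡ j
    sound     : ∀ i → f (elem i) ≡ c
    complete  : ∀ x → f x ≡ c → ∃ λ i → elem i ≡ x

fibre : ∀ {m n} (f : Fin m → Fin n) c → Fibre f c (fibreSize f c)
fibre {m} f c = record
  { elem      = lookup xs
  ; injective = lookup-injective (Unique.filter⁺ P? (Unique.allFin⁺ m))
  ; sound     = λ i → All.lookup (All.all-filter P? (allFin m)) (∈-lookup i)
  ; complete  = λ x fx≡c → let x∈xs = ∈-filter⁺ P? (∈-allFin x) fx≡c in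
      Any.index x∈xs , sym (Any.lookup-index x∈xs)
  }
  where
  P? = λ x → f x Fin.≟ c
  xs = filter P? (allFin m)

fibre-≤ : ∀ {m n} {f : Fin m → Fin n} {c k l} → Fibre f c k → Fibre f c l → k ≤ l
fibre-≤ F G = Finₚ.injective⇒≤ {f = λ i → proj₁ (index i)} λ {i} {j} eq →
  F.injective (trans (sym (proj₂ (index i))) (trans (cong G.elem eq) (proj₂ (index j))))
  where
  module F = Fibre F
  module G = Fibre G
  index = λ i → G.complete (F.elem i) (F.sound i)

fibreSize-≡ : ∀ {m n} {f : Fin m → Fin n} {c k} → Fibre f c k → fibreSize f c ≡ k
fibreSize-≡ F = ℕₚ.≤-antisym (fibre-≤ (fibre _ _) F) (fibre-≤ F (fibre _ _))

-- Double counting. It serves for `src` and, if all faces are hexagons, for `face`.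
fibres-total : ∀ {m n} (f : Fin m → Fin n) k → (∀ c → fibreSize f c ≡ k) → m ≡ n * k
fibres-total {m} {n} f k size = ℕₚ.≤-antisym
  (Finₚ.injective⇒≤ {f = λ x → combine (f x) (proj₁ (index x))} λ {x} {y} eq →
    let fx≡fy , i≡j = Finₚ.combine-injective (f x) _ (f y) _ eq in to-inj x y fx≡fy i≡j)
  (Finₚ.injective⇒≤ {f = from} λ {i} {j} eq →
    trans (sym (Finₚ.combine-remQuot {n} k i))
      (trans (cong (λ (c , l) → combine c l) (from-inj _ _ _ _ eq)) (Finₚ.combine-remQuot {n} k j)))
  where
  fib : ∀ c → Fibre f c k
  fib c = subst (Fibre f c) (size c) (fibre f c)
  module fib c = Fibre (fib c)
  index : ∀ x → ∃ λ i → fib.elem (f x) i ≡ x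
  index x = fib.complete (f x) x refl
  from : Fin (n * k) → Fin m
  from i = fib.elem (proj₁ (remQuot {n} k i)) (proj₂ (remQuot {n} k i))
  to-inj : ∀ x y → f x ≡ f y → proj₁ (index x) ≡ proj₁ (index y) → x ≡ y
  to-inj x y fx≡fy i≡j =
    trans (sym (proj₂ (index x))) (trans (cong₂ fib.elem fx≡fy i≡j) (proj₂ (index y)))
  from-inj : ∀ c d i j → fib.elem c i ≡ fib.elem d j → (c , i) ≡ (d , j)
  from-inj c d i j eq with refl ← trans (sym (fib.sound c i)) (trans (cong f eq) (fib.sound d j)) =
    cong (c ,_) (fib.injective c eq)

least : ∀ {P : ℕ → Set} → (∀ n → Dec (P n)) → ∀ n → P n →
        ∃ λ k → P k × (∀ i → i < k → ¬ P i)
least P? n p with P? 0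
... | yes p₀ = 0 , p₀ , λ _ ()
least P? zero    p | no ¬p₀ = contradiction p ¬p₀
least P? (suc n) p | no ¬p₀ with k , pₖ , min ← least (P? ∘ suc) n p =
  suc k , pₖ , λ { zero _ → ¬p₀ ; (suc i) (s≤s i<k) → min i i<k }

iterate-+ : ∀ {a} {A : Set a} (f : A → A) x m n → iterate f x (m + n) ≡ iterate f (iterate f x m) n
iterate-+ f x zero    n = refl
iterate-+ f x (suc m) n = iterate-+ f (f x) m n

iterate-comm : ∀ {a} {A : Set a} (f : A → A) x n → iterate f (f x) n ≡ f (iterate f x n)
iterate-comm f x zero    = refl
iterate-comm f x (suc n) = iterate-comm f (f x) n

iterate-injective : ∀ {a} {A : Set a} {f : A → A} → (∀ {x y} → f x ≡ f y → x ≡ y) →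
                    ∀ n {x y} → iterate f x n ≡ iterate f y n → x ≡ y
iterate-injective inj zero    eq = eq
iterate-injective inj (suc n) eq = inj (iterate-injective inj n eq)

iterate-cancel : ∀ {a} {A : Set a} {f : A → A} → (∀ {x y} → f x ≡ f y → x ≡ y) → ∀ x m n → m ≤ n →
                 iterate f x m ≡ iterate f x n → iterate f x (n ∸ m) ≡ x
iterate-cancel {f = f} inj x m n m≤n eq = iterate-injective inj m (sym (begin
  iterate f x m                       ≡⟨ eq ⟩
  iterate f x n                       ≡⟨ cong (iterate f x) (ℕₚ.m∸n+n≡m m≤n) ⟨
  iterate f x (n ∸ m + m)             ≡⟨ iterate-+ f x (n ∸ m) m ⟩
  iterate f (iterate f x (n ∸ m)) m   ∎))
  where open ≡-Reasoning

iterate-multiple : ∀ {a} {A : Set a} (f : A → A) x k → iterate f x k ≡ x → ∀ q → iterate f x (q * k) ≡ x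
iterate-multiple f x k eq zero    = refl
iterate-multiple f x k eq (suc q) =
  trans (iterate-+ f x k (q * k)) (trans (cong (λ y → iterate f y (q * k)) eq) (iterate-multiple f x k eq q))

record Period {A : Set} (π : A → A) (x : A) (k : ℕ) : Set where
  field
    positive : 0 < k
    returns  : iterate π x k ≡ x
    minimal  : ∀ i → 0 < i → i < k → iterate π x i ≢ x

module _ {m n} {f : Fin m → Fin n} {π : Fin m → Fin m}
         (π-injective : ∀ {x y} → π x ≡ π y → x ≡ y)
         (cycles : ∀ x y → f x ≡ f y ⇔ SameCycle π x y) where

  -- Exponents below the period give distinct iterates, since cancellation would otherwise produce
  -- an earlier return; and every exponent may be reduced modulo the period.
  cycle-fibre : ∀ {x k} → Period π x k → Fibre f (f x) k
  cycle-fibre {x} {k} P = record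
    { elem      = λ i → iterate π x (toℕ i)
    ; injective = λ {i} {j} eq → inj i j eq
    ; sound     = λ i → sym (Equivalence.from (cycles x _) (toℕ i , refl))
    ; complete  = complete
    }
    where
    open Period P
    instance _ = >-nonZero positive
    no-return : ∀ (i j : Fin k) → toℕ i < toℕ j → iterate π x (toℕ i) ≢ iterate π x (toℕ j)
    no-return i j i<j eq = minimal (toℕ j ∸ toℕ i) (ℕₚ.m<n⇒0<n∸m i<j)
      (ℕₚ.≤-<-trans (ℕₚ.m∸n≤m (toℕ j) (toℕ i)) (Finₚ.toℕ<n j))
      (iterate-cancel π-injective x (toℕ i) (toℕ j) (ℕₚ.<⇒≤ i<j) eq)
    inj : ∀ i j → iterate π x (toℕ i) ≡ iterate π x (toℕ j) → i ≡ j
    inj i j eq with ℕₚ.<-cmp (toℕ i) (toℕ j)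
    ... | tri< i<j _ _ = contradiction eq (no-return i j i<j)
    ... | tri≈ _ i≡j _ = Finₚ.toℕ-injective i≡j
    ... | tri> _ _ j<i = contradiction (sym eq) (no-return j i j<i)
    complete : ∀ y → f y ≡ f x → ∃ λ (i : Fin k) → iterate π x (toℕ i) ≡ y
    complete y fy≡fx with l , eq ← Equivalence.to (cycles x y) (sym fy≡fx) =
      fromℕ< (m%n<n l k) , (begin
        iterate π x (toℕ (fromℕ< (m%n<n l k)))         ≡⟨ cong (iterate π x) (Finₚ.toℕ-fromℕ< (m%n<n l k)) ⟩
        iterate π x (l % k)                            ≡⟨ cong (λ z → iterate π z (l % k)) (iterate-multiple π x k returns (l / k)) ⟨
        iterate π (iterate π x (l / k * k)) (l % k)    ≡⟨ iterate-+ π x (l / k * k) (l % k) ⟨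
        iterate π x (l / k * k + l % k)                ≡⟨ cong (iterate π x) (trans (ℕₚ.+-comm (l / k * k) _) (sym (m≡m%n+[m/n]*n l k))) ⟩
        iterate π x l                                  ≡⟨ eq ⟩
        y                                              ∎)
      where open ≡-Reasoning

returns-eventually : ∀ {m} {π : Fin m → Fin m} → (∀ {x y} → π x ≡ π y → x ≡ y) → ∀ x →
                     ∃ λ k → iterate π x (suc k) ≡ x
returns-eventually {m} {π} inj x
  with i , j , i<j , eq ← Finₚ.pigeonhole {m} {suc m} ℕₚ.≤-refl (iterate π x ∘ toℕ)
  with toℕ j ∸ toℕ i in d | ℕₚ.m<n⇒0<n∸m i<j | iterate-cancel inj x (toℕ i) (toℕ j) (ℕₚ.<⇒≤ i<j) eq
... | suc k | _ | eq′ = k , eq′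

period-exists : ∀ {m} {π : Fin m → Fin m} → (∀ {x y} → π x ≡ π y → x ≡ y) → ∀ x → ∃ (Period π x)
period-exists {m} {π} inj x with n , eq ← returns-eventually inj x
  with k , returns , min ← least (λ k → iterate π x (suc k) Fin.≟ x) n eq =
  suc k , record { positive = z<s ; returns = returns ; minimal = λ { (suc i) _ (s<s i<k) → min i i<k } }

-- Degrees and numbers of sides thereby become exact orders of the rotation and of the face step at
-- a dart, from which the group relations are obtained.
period-fibreSize : ∀ {m n} {f : Fin m → Fin n} {π : Fin m → Fin m} → (∀ {x y} → π x ≡ π y → x ≡ y) →
                   (∀ x y → f x ≡ f y ⇔ SameCycle π x y) → ∀ x → Period π x (fibreSize f (f x))
period-fibreSize {π = π} inj cycles x with k , P ← period-exists inj x =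
  subst (Period π x) (sym (fibreSize-≡ (cycle-fibre inj cycles P))) P

-- Quotients of finite sets and counting of classes

record Quotient {N : ℕ} (R : Fin N → Fin N → Set) : Set where
  field
    classes  : ℕ
    cls      : Fin N → Fin classes
    rep      : Fin classes → Fin N
    cls-rep  : ∀ c → cls (rep c) ≡ c
    sound    : ∀ x → R (rep (cls x)) x
    respects : ∀ {x y} → R x y → cls x ≡ cls y

-- Induction on `N`: the element `zero` joins the class of an old representative related to it, or
-- else opens a class of its own.
quotient : ∀ {N} {R : Fin N → Fin N → Set} → (∀ x y → Dec (R x y)) → (∀ x → R x x) →
           (∀ {x y} → R x y → R y x) → (∀ {x y z} → R x y → R y z → R x z) → Quotient R
quotient {zero}      R? refl′ sym′ trans′ = record
  { classes = 0 ; cls = λ () ; rep = λ () ; cls-rep = λ () ; sound = λ () ; respects = λ {} }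
quotient {suc N} {R} R? refl′ sym′ trans′
  with Q ← quotient {N} {λ x y → R (suc x) (suc y)} (λ x y → R? (suc x) (suc y))
             (λ x → refl′ (suc x)) sym′ trans′
  with Finₚ.any? (λ c → R? (suc (Quotient.rep Q c)) zero)
... | yes (c₀ , r₀) = record
  { classes = Q.classes ; cls = cls ; rep = suc ∘ Q.rep ; cls-rep = Q.cls-rep
  ; sound = λ { zero → r₀ ; (suc x) → Q.sound x } ; respects = λ {x} {y} → respects x y }
  where
  module Q = Quotient Q
  cls : Fin (suc N) → Fin Q.classes
  cls zero    = c₀
  cls (suc x) = Q.cls x
  respects : ∀ x y → R x y → cls x ≡ cls y
  respects zero    zero    _ = refl
  respects zero    (suc y) r = trans (sym (Q.cls-rep c₀)) (Q.respects (trans′ r₀ r))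
  respects (suc x) zero    r = trans (Q.respects (trans′ r (sym′ r₀))) (Q.cls-rep c₀)
  respects (suc x) (suc y) r = Q.respects r
... | no ¬r₀ = record
  { classes = suc Q.classes ; cls = cls ; rep = rep
  ; cls-rep = λ { zero → refl ; (suc c) → cong suc (Q.cls-rep c) }
  ; sound = λ { zero → refl′ zero ; (suc x) → Q.sound x } ; respects = λ {x} {y} → respects x y }
  where
  module Q = Quotient Q
  cls : Fin (suc N) → Fin (suc Q.classes)
  cls zero    = zero
  cls (suc x) = suc (Q.cls x)
  rep : Fin (suc Q.classes) → Fin (suc N)
  rep zero    = zero
  rep (suc c) = suc (Q.rep c)
  respects : ∀ x y → R x y → cls x ≡ cls y
  respects zero    zero    _ = refl
  respects zero    (suc y) r = contradiction (Q.cls y , trans′ (Q.sound y) (sym′ r)) ¬r₀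
  respects (suc x) zero    r = contradiction (Q.cls x , trans′ (Q.sound x) r) ¬r₀
  respects (suc x) (suc y) r = cong suc (Q.respects r)

anyVec? : ∀ {A : Set} {n} → (∀ {P : A → Set} → (∀ x → Dec (P x)) → Dec (∃ P)) →
          {P : Vec A n → Set} → (∀ xs → Dec (P xs)) → Dec (∃ P)
anyVec? {n = zero}  any? P? = map′ (λ p → [] , p) (λ { ([] , p) → p }) (P? [])
anyVec? {n = suc n} any? P? = map′ (λ (x , xs , p) → x ∷ xs , p) (λ { (x ∷ xs , p) → x , xs , p })
  (any? λ x → anyVec? any? λ xs → P? (x ∷ xs))

-- An index i is encoded by its class and by a label s relating the representative of that class to
-- i. As `Rel s` is functional, the code determines i, so a class contains at most `k` indices.
hasClasses : ∀ (S : Setoid 0ℓ 0ℓ) → let open Setoid S in ∀ {σ k} (t : Fin σ → Carrier) →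
             (∀ i j → Dec (t i ≈ t j)) → (∀ s → ∃ λ i → t i ≈ s) →
             (Rel : Fin k → Fin σ → Fin σ → Set) → (∀ i j → t i ≈ t j → ∃ λ s → Rel s i j) →
             (∀ {s i j j′} → Rel s i j → Rel s i j′ → j ≡ j′) →
             ∃ λ α → HasClasses S α × α ≤ σ × σ ≤ α * k
hasClasses S {σ} {k} t ≈? covers Rel related functional = classes , bijection ,
  Finₚ.injective⇒≤ {f = rep} (λ {c} {d} eq → trans (sym (cls-rep c)) (trans (cong cls eq) (cls-rep d))) ,
  Finₚ.injective⇒≤ {f = λ i → combine (cls i) (key i)} λ {i} {j} eq →
    let c≡d , s≡s′ = Finₚ.combine-injective (cls i) (key i) (cls j) (key j) eq in
    functional (proj₂ (label i)) (subst₂ (λ s c → Rel s (rep c) j) (sym s≡s′) (sym c≡d) (proj₂ (label j)))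
  where
  open Setoid S renaming (refl to ≈-refl; sym to ≈-sym; trans to ≈-trans)
  open Quotient (quotient {R = λ i j → t i ≈ t j} ≈? (λ _ → ≈-refl) ≈-sym ≈-trans)
  label : ∀ i → ∃ λ s → Rel s (rep (cls i)) i
  label i = related _ _ (sound i)
  key : Fin σ → Fin k
  key i = proj₁ (label i)
  bijection : HasClasses S classes
  bijection = record
    { to        = t ∘ rep
    ; cong      = λ { refl → ≈-refl }
    ; bijective =
        (λ {c} {d} eq → trans (sym (cls-rep c)) (trans (respects eq) (cls-rep d))) ,
        λ s → let i , eq = covers s in cls i , λ { refl → ≈-trans (sound i) eq }
    }

-- Isomorphisms of graphs and their decidability

module _ {v} {G H : Graph v} where
  private
    module G = Graph G
    module H = Graph H

  -- Every vertex is the source of some dart, so a bijection of darts that respects equality of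
  -- sources in both directions induces the bijection of vertices.
  isomorphism : (f : Fin G.darts → Fin H.darts) (f⁻¹ : Fin H.darts → Fin G.darts) →
                (∀ y → f (f⁻¹ y) ≡ y) → (∀ x → f⁻¹ (f x) ≡ x) →
                (∀ u → ∃ λ x → G.src x ≡ u) → (∀ u → ∃ λ x → H.src x ≡ u) →
                (∀ x y → G.src x ≡ G.src y → H.src (f x) ≡ H.src (f y)) →
                (∀ x y → H.src x ≡ H.src y → G.src (f⁻¹ x) ≡ G.src (f⁻¹ y)) →
                (∀ x → H.rev (f x) ≡ f (G.rev x)) →
                Σ (G ≅ H) λ i → ∀ x → onDarts i ⟨$⟩ʳ x ≡ f x
  isomorphism f f⁻¹ f∘f⁻¹ f⁻¹∘f dartG dartH f-src f⁻¹-src f-rev = record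
    { onVertices = permutation
        (λ u → H.src (f (proj₁ (dartG u)))) (λ u → G.src (f⁻¹ (proj₁ (dartH u))))
        (λ u → trans (f-src _ _ (proj₂ (dartG _))) (trans (cong H.src (f∘f⁻¹ _)) (proj₂ (dartH u))))
        (λ u → trans (f⁻¹-src _ _ (proj₂ (dartH _))) (trans (cong G.src (f⁻¹∘f _)) (proj₂ (dartG u))))
    ; onDarts    = permutation f f⁻¹ f∘f⁻¹ f⁻¹∘f
    ; src-comm   = λ x → f-src _ _ (sym (proj₂ (dartG (G.src x))))
    ; rev-comm   = f-rev
    } , λ _ → refl

  module _ (C : (Fin G.darts → Fin H.darts) → Set) (C? : ∀ f → Dec (C f))
           (C-resp : ∀ {f g} → (∀ x → f x ≡ g x) → C f → C g) where
    private
      Encodes : Vec (Fin H.darts) G.darts → Vec (Fin G.darts) H.darts → Vec (Fin v) v → Vec (Fin v) v → Set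
      Encodes fs fs⁻¹ gs gs⁻¹ =
        (∀ y → f (f⁻¹ y) ≡ y) × (∀ x → f⁻¹ (f x) ≡ x) × (∀ w → g (g⁻¹ w) ≡ w) × (∀ u → g⁻¹ (g u) ≡ u) ×
        (∀ x → H.src (f x) ≡ g (G.src x)) × (∀ x → H.rev (f x) ≡ f (G.rev x)) × C f
        where
        f   = Vec.lookup fs
        f⁻¹ = Vec.lookup fs⁻¹
        g   = Vec.lookup gs
        g⁻¹ = Vec.lookup gs⁻¹

      Encodes? : ∀ fs fs⁻¹ gs gs⁻¹ → Dec (Encodes fs fs⁻¹ gs gs⁻¹)
      Encodes? fs fs⁻¹ gs gs⁻¹ =
        Finₚ.all? (λ _ → _ Fin.≟ _) ×-dec Finₚ.all? (λ _ → _ Fin.≟ _) ×-dec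
        Finₚ.all? (λ _ → _ Fin.≟ _) ×-dec Finₚ.all? (λ _ → _ Fin.≟ _) ×-dec
        Finₚ.all? (λ _ → _ Fin.≟ _) ×-dec Finₚ.all? (λ _ → _ Fin.≟ _) ×-dec C? _

      decode : (∃ λ fs → ∃ λ fs⁻¹ → ∃ λ gs → ∃ λ gs⁻¹ → Encodes fs fs⁻¹ gs gs⁻¹) →
               Σ (G ≅ H) λ i → C (onDarts i ⟨$⟩ʳ_)
      decode (fs , fs⁻¹ , gs , gs⁻¹ , ff⁻¹ , f⁻¹f , gg⁻¹ , g⁻¹g , srcs , revs , c) = record
        { onVertices = permutation (Vec.lookup gs) (Vec.lookup gs⁻¹) gg⁻¹ g⁻¹g
        ; onDarts    = permutation (Vec.lookup fs) (Vec.lookup fs⁻¹) ff⁻¹ f⁻¹f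
        ; src-comm   = srcs
        ; rev-comm   = revs
        } , c

      table : ∀ {A : Set} {n} (h : Fin n → A) x → Vec.lookup (Vec.tabulate h) x ≡ h x
      table h x = Vec.lookup∘tabulate h x

      table₂ : ∀ {A : Set} {m n} (h : Fin m → A) (h′ : Fin n → Fin m) x →
               Vec.lookup (Vec.tabulate h) (Vec.lookup (Vec.tabulate h′) x) ≡ h (h′ x)
      table₂ h h′ x = trans (table h _) (cong h (table h′ x))

      encode : (Σ (G ≅ H) λ i → C (onDarts i ⟨$⟩ʳ_)) →
               ∃ λ fs → ∃ λ fs⁻¹ → ∃ λ gs → ∃ λ gs⁻¹ → Encodes fs fs⁻¹ gs gs⁻¹
      encode (i , c) =
        Vec.tabulate f , Vec.tabulate f⁻¹ , Vec.tabulate g , Vec.tabulate g⁻¹ ,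
        (λ y → trans (table₂ f f⁻¹ y) (Perm.inverseʳ (onDarts i))) ,
        (λ x → trans (table₂ f⁻¹ f x) (Perm.inverseˡ (onDarts i))) ,
        (λ w → trans (table₂ g g⁻¹ w) (Perm.inverseʳ (onVertices i))) ,
        (λ u → trans (table₂ g⁻¹ g u) (Perm.inverseˡ (onVertices i))) ,
        (λ x → trans (cong H.src (table f x)) (trans (src-comm i x) (sym (table g _)))) ,
        (λ x → trans (cong H.rev (table f x)) (trans (rev-comm i x) (sym (table f _)))) ,
        C-resp (λ x → sym (table f x)) c
        where
        f   = onDarts i ⟨$⟩ʳ_
        f⁻¹ = onDarts i ⟨$⟩ˡ_
        g   = onVertices i ⟨$⟩ʳ_
        g⁻¹ = onVertices i ⟨$⟩ˡ_

    -- Functions cannot be searched, but their tables of values can. A decoded table agrees with the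
    -- original map only pointwise, which is why `C` must respect pointwise equality.
    isomorphism? : Dec (Σ (G ≅ H) λ i → C (onDarts i ⟨$⟩ʳ_))
    isomorphism? = map′ decode encode
      (anyVec? Finₚ.any? λ fs → anyVec? Finₚ.any? λ fs⁻¹ →
       anyVec? Finₚ.any? λ gs → anyVec? Finₚ.any? λ gs⁻¹ → Encodes? fs fs⁻¹ gs gs⁻¹)

isomorphic? : ∀ {v} (S T : Trihex v) → Dec (Isomorphic S T)
isomorphic? S T = map′ proj₁ (_, tt) (isomorphism? (λ _ → ⊤) (λ _ → yes tt) (λ _ _ → tt))

equivalent? : ∀ {v} (S T : Trihex v) → Dec (Equivalent S T)
equivalent? S T = isomorphism?
  (λ f → ∀ x → rotate T (f x) ≡ f (rotate S x))
  (λ f → Finₚ.all? λ x → rotate T (f x) Fin.≟ f (rotate S x))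
  (λ f≗g c x → trans (cong (rotate T) (sym (f≗g x))) (trans (c x) (f≗g _)))
  where
  rotate = λ T → Trihex.rotation T ⟨$⟩ʳ_

-- Sublattices of ℤ²

E : Set
E = ℤ × ℤ

infixl 6 _⊕_ _⊖_

_⊕_ _⊖_ : E → E → E
(x , y) ⊕ (x′ , y′) = x ℤ.+ x′ , y ℤ.+ y′
(x , y) ⊖ (x′ , y′) = x ℤ.- x′ , y ℤ.- y′

neg : E → E
neg (x , y) = ℤ.- x , ℤ.- y

0ᴱ : E
0ᴱ = + 0 , + 0

Even : E → Set
Even z = ∃ λ u → z ≡ u ⊕ u

-- The lattice spanned by (A , 0) and (B , C), of index A * C when both factors are positive. The
-- bound B < A is imposed only where the triple has to be unique.
InLattice : ℕ → ℕ → ℕ → E → Set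
InLattice A B C (x , y) = ∃₂ λ a b → x ≡ a ℤ.* + A ℤ.+ b ℤ.* + B × y ≡ b ℤ.* + C

record IsSubgroup (L : E → Set) : Set where
  field
    zero-∈ : L 0ᴱ
    ⊖-∈    : ∀ {z w} → L z → L w → L (z ⊖ w)

  neg-∈ : ∀ {z} → L z → L (neg z)
  neg-∈ {x , y} l = subst L (cong₂ _,_ (ℤₚ.+-identityˡ _) (ℤₚ.+-identityˡ _)) (⊖-∈ zero-∈ l)

  ⊕-∈ : ∀ {z w} → L z → L w → L (z ⊕ w)
  ⊕-∈ {x , y} {x′ , y′} l l′ = subst L (cong₂ _,_ (double-neg x x′) (double-neg y y′)) (⊖-∈ l (neg-∈ l′))
    where
    double-neg : ∀ x y → x ℤ.- (ℤ.- y) ≡ x ℤ.+ y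
    double-neg = ℤ.solve-∀

  multiple-∈ : ∀ {x y} → L (x , y) → ∀ a → L (a ℤ.* x , a ℤ.* y)
  multiple-∈ {x} {y} l (+ n) = nonNeg n
    where
    step : ∀ a x → x ℤ.+ a ℤ.* x ≡ (+ 1 ℤ.+ a) ℤ.* x
    step = ℤ.solve-∀
    nonNeg : ∀ n → L (+ n ℤ.* x , + n ℤ.* y)
    nonNeg zero    = zero-∈
    nonNeg (suc n) = subst L (cong₂ _,_ (step (+ n) x) (step (+ n) y)) (⊕-∈ l (nonNeg n))
  multiple-∈ {x} {y} l -[1+ n ] = subst L
    (cong₂ _,_ (ℤₚ.neg-distribˡ-* (+ suc n) x) (ℤₚ.neg-distribˡ-* (+ suc n) y))
    (neg-∈ (multiple-∈ l (+ suc n)))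

inLattice-subgroup : ∀ A B C → IsSubgroup (InLattice A B C)
inLattice-subgroup A B C = record
  { zero-∈ = + 0 , + 0 , refl , refl
  ; ⊖-∈    = λ { (a , b , refl , refl) (a′ , b′ , refl , refl) →
      a ℤ.- a′ , b ℤ.- b′ , x-eq a a′ b b′ (+ A) (+ B) , y-eq b b′ (+ C) }
  }
  where
  x-eq : ∀ a a′ b b′ A B → (a ℤ.* A ℤ.+ b ℤ.* B) ℤ.- (a′ ℤ.* A ℤ.+ b′ ℤ.* B) ≡
         (a ℤ.- a′) ℤ.* A ℤ.+ (b ℤ.- b′) ℤ.* B
  x-eq = ℤ.solve-∀
  y-eq : ∀ b b′ C → b ℤ.* C ℤ.- b′ ℤ.* C ≡ (b ℤ.- b′) ℤ.* C
  y-eq = ℤ.solve-∀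

x-generator : ∀ A B C → InLattice A B C (+ A , + 0)
x-generator A B C = + 1 , + 0 , sym (trans (ℤₚ.+-identityʳ _) (ℤₚ.*-identityˡ (+ A))) , refl

y-generator : ∀ A B C → InLattice A B C (+ B , + C)
y-generator A B C = + 0 , + 1 , sym (trans (ℤₚ.+-identityˡ _) (ℤₚ.*-identityˡ (+ B))) , sym (ℤₚ.*-identityˡ (+ C))

remainder-unique : ∀ {r s d} b → r < d → s < d → + r ≡ b ℤ.* + d ℤ.+ + s → r ≡ s
remainder-unique {r} {s} {d} (+ 0) r<d s<d eq = ℤₚ.+-injective eq
remainder-unique {r} {s} {d} (+ suc n) r<d s<d eq = contradiction r<d (ℕₚ.≤⇒≯ (begin
  d                ≤⟨ ℕₚ.m≤m+n d (n * d + s) ⟩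
  d + (n * d + s)  ≡⟨ ℕₚ.+-assoc d (n * d) s ⟨
  suc n * d + s    ≡⟨ ℤₚ.+-injective (trans eq (cong (ℤ._+ + s) (sym (ℤₚ.pos-* (suc n) d)))) ⟨
  r                ∎))
  where open ℕₚ.≤-Reasoning
remainder-unique {r} {s} {d} -[1+ n ] r<d s<d eq =
  sym (remainder-unique (+ suc n) s<d r<d (trans (move (+ suc n) (+ d) (+ s)) (cong (λ i → + suc n ℤ.* + d ℤ.+ i) (sym eq))))
  where
  move : ∀ b d s → s ≡ b ℤ.* d ℤ.+ ((ℤ.- b) ℤ.* d ℤ.+ s)
  move = ℤ.solve-∀

-- Representatives with nonnegative coordinates allow every coset to be reached from that of 0 by
-- forward steps alone, as the proof of connectedness does.
record CosetNumbering (L : E → Set) (N : ℕ) : Set where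
  field
    π        : E → Fin N
    sec      : Fin N → E
    sec-≥0   : ∀ i → ∃₂ λ m n → sec i ≡ (+ m , + n)
    π-sec    : ∀ i → π (sec i) ≡ i
    π-≡      : ∀ {z w} → L (z ⊖ w) → π z ≡ π w
    π-≡⁻¹    : ∀ {z w} → π z ≡ π w → L (z ⊖ w)

⊖-cancel : ∀ z w s → (z ⊖ s) ⊖ (w ⊖ s) ≡ z ⊖ w
⊖-cancel (x , y) (x′ , y′) (a , b) = cong₂ _,_ (lemma x x′ a) (lemma y y′ b)
  where
  lemma : ∀ x y a → (x ℤ.- a) ℤ.- (y ℤ.- a) ≡ x ℤ.- y
  lemma = ℤ.solve-∀

module _ (A B C : ℕ) .{{_ : NonZero A}} .{{_ : NonZero C}} where
  private
    open IsSubgroup (inLattice-subgroup A B C)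
    L = InLattice A B C

    reduce : E → Fin A × Fin C
    -- The second coordinate is reduced first, by (B , C); then (A , 0) reduces the first without
    -- disturbing it.
    reduce (x , y) = fromℕ< (ℤ.n%ℕd<d (x ℤ.- (y ℤ./ℕ C) ℤ.* + B) A) , fromℕ< (ℤ.n%ℕd<d y C)

    embed : Fin A × Fin C → E
    embed (i , j) = + toℕ i , + toℕ j

    reduce-∈ : ∀ z → L (z ⊖ embed (reduce z))
    reduce-∈ (x , y) = p , q ,
      trans (cong (λ i → x ℤ.- + i) (Finₚ.toℕ-fromℕ< _))
        (trans (cong (ℤ._- + r) (split x (q ℤ.* + B)))
          (trans (cong (λ i → i ℤ.+ q ℤ.* + B ℤ.- + r) (ℤ.a≡a%ℕn+[a/ℕn]*n x′ A)) (collect (+ r) (p ℤ.* + A) (q ℤ.* + B)))) ,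
      trans (cong (λ i → y ℤ.- + i) (Finₚ.toℕ-fromℕ< _))
        (trans (cong (ℤ._- + (y ℤ.%ℕ C)) (ℤ.a≡a%ℕn+[a/ℕn]*n y C)) (drop (+ (y ℤ.%ℕ C)) (q ℤ.* + C)))
      where
      q  = y ℤ./ℕ C
      x′ = x ℤ.- q ℤ.* + B
      p  = x′ ℤ./ℕ A
      r  = x′ ℤ.%ℕ A
      split : ∀ x t → x ≡ x ℤ.- t ℤ.+ t
      split = ℤ.solve-∀
      collect : ∀ r s t → r ℤ.+ s ℤ.+ t ℤ.- r ≡ s ℤ.+ t
      collect = ℤ.solve-∀
      drop : ∀ r s → r ℤ.+ s ℤ.- r ≡ s
      drop = ℤ.solve-∀

    isolate : ∀ r s t → r ℤ.- s ≡ t → r ≡ t ℤ.+ s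
    isolate r s t refl = lemma r s
      where
      lemma : ∀ r s → r ≡ r ℤ.- s ℤ.+ s
      lemma = ℤ.solve-∀

    embed-unique : ∀ i j → L (embed i ⊖ embed j) → i ≡ j
    embed-unique (i , k) (j , l) (a , b , x-eq , y-eq)
      with refl ← Finₚ.toℕ-injective (remainder-unique b (Finₚ.toℕ<n k) (Finₚ.toℕ<n l) (isolate _ (+ toℕ l) _ y-eq))
      with ℤₚ.i*j≡0⇒i≡0∨j≡0 b (trans (sym y-eq) (ℤₚ.+-inverseʳ (+ toℕ k)))
    ... | inj₁ refl = cong (_, k) (Finₚ.toℕ-injective
          (remainder-unique a (Finₚ.toℕ<n i) (Finₚ.toℕ<n j) (isolate (+ toℕ i) (+ toℕ j) (a ℤ.* + A) (trans x-eq (ℤₚ.+-identityʳ (a ℤ.* + A))))))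
    ... | inj₂ C≡0 = contradiction (ℤₚ.+-injective C≡0) (≢-nonZero⁻¹ C)

    combine′ : Fin A × Fin C → Fin (A * C)
    combine′ (i , j) = combine i j

  abstract
    cosetNumbering : CosetNumbering L (A * C)
    cosetNumbering = record
      { π     = combine′ ∘ reduce
      ; sec   = embed ∘ remQuot {A} C
      ; sec-≥0 = λ _ → _ , _ , refl
      ; π-sec = λ i → trans (cong combine′ (sym (embed-unique (remQuot {A} C i) _ (reduce-∈ (embed (remQuot {A} C i))))))
                            (Finₚ.combine-remQuot {A} C i)
      ; π-≡   = λ {z} {w} l → cong combine′ (embed-unique _ _
          (subst L (swap z w (embed (reduce z)) (embed (reduce w)))
            (⊖-∈ (⊖-∈ l (reduce-∈ z)) (neg-∈ (reduce-∈ w)))))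
      ; π-≡⁻¹ = λ {z} {w} eq → let eq₁ , eq₂ = Finₚ.combine-injective _ _ _ _ eq in
          subst L (⊖-cancel z w (embed (reduce z)))
            (⊖-∈ (reduce-∈ z) (subst (λ s → L (w ⊖ embed s)) (sym (cong₂ _,_ eq₁ eq₂)) (reduce-∈ w)))
      }
      where
      swap : ∀ z w s t → ((z ⊖ w) ⊖ (z ⊖ s)) ⊖ neg (w ⊖ t) ≡ s ⊖ t
      swap (x , y) (x′ , y′) (a , b) (c , d) = cong₂ _,_ (lemma x x′ a c) (lemma y y′ b d)
        where
        lemma : ∀ x x′ a c → ((x ℤ.- x′) ℤ.- (x ℤ.- a)) ℤ.- (ℤ.- (x′ ℤ.- c)) ≡ a ℤ.- c
        lemma = ℤ.solve-∀

record HermiteForm (L : E → Set) : Set where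
  field
    A B C : ℕ
    A>0   : 0 < A
    B<A   : B < A
    C>0   : 0 < C
    ∈-⇒   : ∀ z → L z → InLattice A B C z
    ∈-⇐   : ∀ z → InLattice A B C z → L z

-- `A` is the first positive abscissa of a point of `L` on the x-axis, and `C` the lowest positive
-- height at which `L` has a point with abscissa in [0 , A); the two given points bound the
-- searches. Division by these generators leaves a remainder in `L` below both minima, hence zero.
hermiteForm : ∀ {L : E → Set} → IsSubgroup L → (∀ z → Dec (L z)) →
              (∃ λ a → L (+ suc a , + 0)) → (∃ λ c → L (+ 0 , + suc c)) → HermiteForm L
hermiteForm {L} subgroup L? (a₀ , la₀) (c₀ , lc₀) = result
  where
  open IsSubgroup subgroup
  leastA : ∃ λ a → L (+ suc a , + 0) × (∀ i → i < a → ¬ L (+ suc i , + 0))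
  leastA = least (λ a → L? (+ suc a , + 0)) a₀ la₀
  A = suc (proj₁ leastA)
  P : ℕ → Set
  P c = ∃ λ (b : Fin A) → L (+ toℕ b , + suc c)
  leastC : ∃ λ c → P c × (∀ i → i < c → ¬ P i)
  leastC = least (λ c → Finₚ.any? λ b → L? (+ toℕ b , + suc c)) c₀ (zero , lc₀)
  C = suc (proj₁ leastC)
  B = toℕ (proj₁ (proj₁ (proj₂ leastC)))
  x-∈ : L (+ A , + 0)
  x-∈ = proj₁ (proj₂ leastA)
  y-∈ : L (+ B , + C)
  y-∈ = proj₂ (proj₁ (proj₂ leastC))
  ⇐ : ∀ z → InLattice A B C z → L z
  ⇐ _ (a , b , refl , refl) = subst L (cong₂ _,_ refl (lemma a b (+ C)))
    (⊕-∈ (multiple-∈ x-∈ a) (multiple-∈ y-∈ b))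
    where
    lemma : ∀ a b C → a ℤ.* + 0 ℤ.+ b ℤ.* C ≡ b ℤ.* C
    lemma = ℤ.solve-∀
  small-0 : ∀ r s → r < A → s < C → L (+ r , + s) → r ≡ 0 × s ≡ 0
  small-0 zero    zero    _         _         _ = refl , refl
  small-0 (suc r) zero    (s≤s r<A) _         l = contradiction l (proj₂ (proj₂ leastA) r r<A)
  small-0 r       (suc s) r<A       (s≤s s<C) l =
    contradiction (fromℕ< r<A , subst (λ i → L (+ i , + suc s)) (sym (Finₚ.toℕ-fromℕ< r<A)) l) (proj₂ (proj₂ leastC) s s<C)
  ⇒ : ∀ z → L z → InLattice A B C z
  ⇒ (x , y) l = p , q ,
    trans (split x (q ℤ.* + B)) (cong (ℤ._+ q ℤ.* + B)
      (trans x′≡ (trans (cong (λ i → + i ℤ.+ p ℤ.* + A) (proj₁ zeros)) (ℤₚ.+-identityˡ (p ℤ.* + A))))) ,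
    trans y≡ (trans (cong (λ i → + i ℤ.+ q ℤ.* + C) (proj₂ zeros)) (ℤₚ.+-identityˡ (q ℤ.* + C)))
    where
    q  = y ℤ./ℕ C
    x′ = x ℤ.- q ℤ.* + B
    p  = x′ ℤ./ℕ A
    y≡ : y ≡ + (y ℤ.%ℕ C) ℤ.+ q ℤ.* + C
    y≡ = ℤ.a≡a%ℕn+[a/ℕn]*n y C
    x′≡ : x′ ≡ + (x′ ℤ.%ℕ A) ℤ.+ p ℤ.* + A
    x′≡ = ℤ.a≡a%ℕn+[a/ℕn]*n x′ A
    split : ∀ x t → x ≡ x ℤ.- t ℤ.+ t
    split = ℤ.solve-∀
    isolate : ∀ x r t u → x ℤ.- t ≡ r ℤ.+ u → x ℤ.- (u ℤ.+ t) ≡ r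
    isolate x r t u eq = trans (lemma₁ x t u) (trans (cong (ℤ._- u) eq) (lemma₂ r u))
      where
      lemma₁ : ∀ x t u → x ℤ.- (u ℤ.+ t) ≡ x ℤ.- t ℤ.- u
      lemma₁ = ℤ.solve-∀
      lemma₂ : ∀ r u → r ℤ.+ u ℤ.- u ≡ r
      lemma₂ = ℤ.solve-∀
    rest : L (+ (x′ ℤ.%ℕ A) , + (y ℤ.%ℕ C))
    rest = subst L (cong₂ _,_ (isolate x _ (q ℤ.* + B) (p ℤ.* + A) x′≡)
      (trans (cong (ℤ._- q ℤ.* + C) y≡) (lemma (+ (y ℤ.%ℕ C)) (q ℤ.* + C))))
      (⊖-∈ l (⇐ _ (p , q , refl , refl)))
      where
      lemma : ∀ r u → r ℤ.+ u ℤ.- u ≡ r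
      lemma = ℤ.solve-∀
    zeros = small-0 _ _ (ℤ.n%ℕd<d x′ A) (ℤ.n%ℕd<d y C) rest
  result : HermiteForm L
  result = record { A = A ; B = B ; C = C ; A>0 = z<s ; B<A = Finₚ.toℕ<n _ ; C>0 = z<s ; ∈-⇒ = ⇒ ; ∈-⇐ = ⇐ }

multiple⇒∣ : ∀ {m d} a → + m ≡ a ℤ.* + d → d ∣ m
multiple⇒∣ {m} {d} a eq = divides ℤ.∣ a ∣ (trans (cong ℤ.∣_∣ eq) (ℤₚ.abs-* a (+ d)))

-- `A` generates the intersection of `L` with the x-axis and `C` its projection to the y-axis, so
-- each divides its counterpart. Then `B` is determined modulo `A`.
hermiteForm-unique : ∀ {L} (H H′ : HermiteForm L) → let open HermiteForm in A H ≡ A H′ × B H ≡ B H′ × C H ≡ C H′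
hermiteForm-unique {L} H H′ = A≡ , B≡ , C≡
  where
  open HermiteForm
  A-∣ : ∀ (H H′ : HermiteForm L) → A H′ ∣ A H
  A-∣ H H′ with ∈-⇒ H′ _ (∈-⇐ H _ (x-generator (A H) (B H) (C H)))
  ... | a , b , x-eq , y-eq with ℤₚ.i*j≡0⇒i≡0∨j≡0 b (sym y-eq)
  ...   | inj₁ refl = multiple⇒∣ a (trans x-eq (ℤₚ.+-identityʳ _))
  ...   | inj₂ C≡0  = contradiction (sym (ℤₚ.+-injective C≡0)) (ℕₚ.<⇒≢ (C>0 H′))
  C-∣ : ∀ (H H′ : HermiteForm L) → C H′ ∣ C H
  C-∣ H H′ with ∈-⇒ H′ _ (∈-⇐ H _ (y-generator (A H) (B H) (C H)))
  ... | a , b , _ , y-eq = multiple⇒∣ b y-eq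
  A≡ = ∣-antisym (A-∣ H′ H) (A-∣ H H′)
  C≡ = ∣-antisym (C-∣ H′ H) (C-∣ H H′)
  B≡ : B H ≡ B H′
  B≡ with ∈-⇒ H′ _ (∈-⇐ H _ (y-generator (A H) (B H) (C H)))
  ... | a , b , x-eq , y-eq = remainder-unique a (subst (B H <_) A≡ (B<A H)) (B<A H′)
    (trans x-eq (cong (λ i → a ℤ.* + A H′ ℤ.+ i) (trans (cong (ℤ._* + B H′) b≡1) (ℤₚ.*-identityˡ _))))
    where
    instance _ = ℤ.≢-nonZero {+ C H′} λ eq → ℕₚ.<⇒≢ (C>0 H′) (sym (ℤₚ.+-injective eq))
    b≡1 : b ≡ + 1
    b≡1 = ℤₚ.*-cancelʳ-≡ b (+ 1) (+ C H′)
      (trans (sym y-eq) (trans (cong +_ C≡) (sym (ℤₚ.*-identityˡ (+ C H′)))))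

-- Doubled lattices and orbits of involutions

double-injective : ∀ {x y} → x ℤ.+ x ≡ y ℤ.+ y → x ≡ y
double-injective {x} {y} eq = ℤₚ.*-cancelˡ-≡ (+ 2) x y (trans (two x) (trans eq (sym (two y))))
  where
  two : ∀ x → + 2 ℤ.* x ≡ x ℤ.+ x
  two = ℤ.solve-∀

double-≢1 : ∀ x → x ℤ.+ x ≢ + 1
double-≢1 (+ 0) ()
double-≢1 (+ suc n) eq with () ← trans (sym (ℕₚ.+-suc n n)) (ℕₚ.suc-injective (ℤₚ.+-injective eq))
double-≢1 -[1+ n ] ()

double-≢-1 : ∀ x → x ℤ.+ x ≢ -[1+ 0 ]
double-≢-1 x eq = double-≢1 (ℤ.- x) (trans (sym (ℤₚ.neg-distrib-+ x x)) (cong ℤ.-_ eq))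

⊕-double-injective : ∀ {z w} → z ⊕ z ≡ w ⊕ w → z ≡ w
⊕-double-injective eq = cong₂ _,_ (double-injective (cong proj₁ eq)) (double-injective (cong proj₂ eq))

DoubledLattice : ℕ → ℕ → ℕ → E → Set
DoubledLattice A B C = InLattice (A + A) (B + B) (C + C)

double-∈ : ∀ {A B C} z → InLattice A B C z → DoubledLattice A B C (z ⊕ z)
double-∈ {A} {B} {C} _ (a , b , refl , refl) = a , b , x-eq a b (+ A) (+ B) , y-eq b (+ C)
  where
  x-eq : ∀ a b A B → (a ℤ.* A ℤ.+ b ℤ.* B) ℤ.+ (a ℤ.* A ℤ.+ b ℤ.* B) ≡ a ℤ.* (A ℤ.+ A) ℤ.+ b ℤ.* (B ℤ.+ B)
  x-eq = ℤ.solve-∀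
  y-eq : ∀ b C → b ℤ.* C ℤ.+ b ℤ.* C ≡ b ℤ.* (C ℤ.+ C)
  y-eq = ℤ.solve-∀

halve-∈ : ∀ {A B C} z → DoubledLattice A B C z → ∃ λ u → z ≡ u ⊕ u × InLattice A B C u
halve-∈ {A} {B} {C} _ (a , b , refl , refl) =
  (a ℤ.* + A ℤ.+ b ℤ.* + B , b ℤ.* + C) , cong₂ _,_ (x-eq a b (+ A) (+ B)) (y-eq b (+ C)) , a , b , refl , refl
  where
  x-eq : ∀ a b A B → a ℤ.* (A ℤ.+ A) ℤ.+ b ℤ.* (B ℤ.+ B) ≡ (a ℤ.* A ℤ.+ b ℤ.* B) ℤ.+ (a ℤ.* A ℤ.+ b ℤ.* B)
  x-eq = ℤ.solve-∀
  y-eq : ∀ b C → b ℤ.* (C ℤ.+ C) ≡ b ℤ.* C ℤ.+ b ℤ.* C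
  y-eq = ℤ.solve-∀

double-∈⁻¹ : ∀ {A B C} z → DoubledLattice A B C (z ⊕ z) → InLattice A B C z
double-∈⁻¹ {A} {B} {C} z m with u , eq , l ← halve-∈ _ m =
  subst (InLattice A B C) (sym (⊕-double-injective {z} {u} eq)) l

⊎-injective⇒≤ : ∀ {a b c d} (h : Fin a ⊎ Fin b → Fin c ⊎ Fin d) → (∀ {x y} → h x ≡ h y → x ≡ y) → a + b ≤ c + d
⊎-injective⇒≤ {a} {b} {c} {d} h h-injective =
  Finₚ.injective⇒≤ {f = λ i → Fin.join c d (h (Fin.splitAt a i))} λ {i} {j} eq →
    trans (sym (Finₚ.join-splitAt a b i)) (trans (cong (Fin.join a b) (h-injective (join-injective eq))) (Finₚ.join-splitAt a b j))
  where
  join-injective : ∀ {x y} → Fin.join c d x ≡ Fin.join c d y → x ≡ y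
  join-injective {x} {y} eq =
    trans (sym (Finₚ.splitAt-join c d x)) (trans (cong (Fin.splitAt c) eq) (Finₚ.splitAt-join c d y))

module Involution {N} (flip : Fin N → Fin N) (flip-flip : ∀ z → flip (flip z) ≡ z) where
  Related : Fin N → Fin N → Set
  Related z w = w ≡ z ⊎ w ≡ flip z

  related-sym : ∀ {z w} → Related z w → Related w z
  related-sym (inj₁ refl) = inj₁ refl
  related-sym (inj₂ refl) = inj₂ (sym (flip-flip _))

  related-trans : ∀ {z w u} → Related z w → Related w u → Related z u
  related-trans (inj₁ refl) r           = r
  related-trans (inj₂ refl) (inj₁ refl) = inj₂ refl
  related-trans (inj₂ refl) (inj₂ refl) = inj₁ (flip-flip _)

  orbits : Quotient Related
  orbits = quotient (λ z w → (w Fin.≟ z) ⊎-dec (w Fin.≟ flip z)) (λ _ → inj₁ refl) related-sym related-trans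

  open Quotient orbits public

  sameOrbit : ∀ {z w} → cls z ≡ cls w → Related z w
  sameOrbit {z} {w} eq =
    related-trans (related-sym (sound z)) (subst (λ c → Related (rep c) w) (sym eq) (sound w))

  module _ {k} (fix : Fin k → Fin N) (fix-injective : ∀ {i j} → fix i ≡ fix j → i ≡ j)
           (fixed : ∀ i → flip (fix i) ≡ fix i) (all-fixed : ∀ z → flip z ≡ z → ∃ λ i → fix i ≡ z) where
    private
      fixed-orbit : ∀ {z} i → cls z ≡ cls (fix i) → z ≡ fix i
      fixed-orbit i eq with sameOrbit (sym eq)
      ... | inj₁ p = p
      ... | inj₂ p = trans p (fixed i)

      rep-cls : ∀ z → z ≢ rep (cls z) → z ≡ flip (rep (cls z))
      rep-cls z z≢ with sound z
      ... | inj₁ p = contradiction p z≢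
      ... | inj₂ p = p

      rep-injective : ∀ {c d} → rep c ≡ rep d → c ≡ d
      rep-injective {c} {d} eq = trans (sym (cls-rep c)) (trans (cong cls eq) (cls-rep d))

      flip-rep : ∀ {c d} → rep c ≡ flip (rep d) → c ≡ d
      flip-rep {c} {d} eq = trans (sym (cls-rep c)) (trans (cong cls eq) (trans (sym (respects (inj₂ refl))) (cls-rep d)))

      Special : Fin N → Set
      Special z = Dec (z ≡ rep (cls z))

      place : ∀ z → Special z → Fin classes ⊎ Fin classes
      place z (yes _) = inj₁ (cls z)
      place z (no _)  = inj₂ (cls z)

      to : Fin N ⊎ Fin k → Fin classes ⊎ Fin classes
      to (inj₁ z) = place z (z Fin.≟ rep (cls z))
      to (inj₂ i) = inj₂ (cls (fix i))

      inj₁-injective : ∀ {A B : Set} {x y : A} → inj₁ {B = B} x ≡ inj₁ y → x ≡ y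
      inj₁-injective refl = refl

      inj₂-injective : ∀ {A B : Set} {x y : B} → inj₂ {A = A} x ≡ inj₂ y → x ≡ y
      inj₂-injective refl = refl

      not-fixed : ∀ {z} i → z ≢ rep (cls z) → cls z ≢ cls (fix i)
      not-fixed {z} i z≢ eq = z≢ (trans (fixed-orbit i eq) (sym (fixed-orbit i (trans (cls-rep _) eq))))

      to-injective : ∀ {x y} → to x ≡ to y → x ≡ y
      to-injective {inj₁ z} {inj₁ w} eq with z Fin.≟ rep (cls z) | w Fin.≟ rep (cls w)
      ... | yes p | yes q = cong inj₁ (trans p (trans (cong rep (inj₁-injective eq)) (sym q)))
      ... | yes _ | no _  with () ← eq
      ... | no _  | yes _ with () ← eq
      ... | no p  | no q  = cong inj₁ (trans (rep-cls z p) (trans (cong (flip ∘ rep) (inj₂-injective eq)) (sym (rep-cls w q))))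
      to-injective {inj₁ z} {inj₂ j} eq with z Fin.≟ rep (cls z)
      ... | yes _ with () ← eq
      ... | no p  = contradiction (inj₂-injective eq) (not-fixed j p)
      to-injective {inj₂ i} {inj₁ w} eq with w Fin.≟ rep (cls w)
      ... | yes _ with () ← eq
      ... | no q  = contradiction (sym (inj₂-injective eq)) (not-fixed i q)
      to-injective {inj₂ i} {inj₂ j} eq = cong inj₂ (fix-injective (fixed-orbit j (inj₂-injective eq)))

      second : ∀ c → Dec (flip (rep c) ≡ rep c) → Fin N ⊎ Fin k
      second c (yes p) = inj₂ (proj₁ (all-fixed (rep c) p))
      second c (no _)  = inj₁ (flip (rep c))

      from : Fin classes ⊎ Fin classes → Fin N ⊎ Fin k
      from (inj₁ c) = inj₁ (rep c)
      from (inj₂ c) = second c (flip (rep c) Fin.≟ rep c)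

      from-injective : ∀ {x y} → from x ≡ from y → x ≡ y
      from-injective {inj₁ c} {inj₁ d} eq = cong inj₁ (rep-injective (inj₁-injective eq))
      from-injective {inj₁ c} {inj₂ d} eq with flip (rep d) Fin.≟ rep d
      ... | yes _ with () ← eq
      ... | no p  = contradiction (trans (sym (inj₁-injective eq)) (cong rep (flip-rep (inj₁-injective eq)))) p
      from-injective {inj₂ c} {inj₁ d} eq with flip (rep c) Fin.≟ rep c
      ... | yes _ with () ← eq
      ... | no p  = contradiction (trans (inj₁-injective eq) (cong rep (flip-rep (sym (inj₁-injective eq))))) p
      from-injective {inj₂ c} {inj₂ d} eq with flip (rep c) Fin.≟ rep c | flip (rep d) Fin.≟ rep d
      ... | yes p | yes q = cong inj₂ (rep-injective (trans (sym (proj₂ (all-fixed (rep c) p)))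
              (trans (cong fix (inj₂-injective eq)) (proj₂ (all-fixed (rep d) q)))))
      ... | yes _ | no _  with () ← eq
      ... | no _  | yes _ with () ← eq
      ... | no _  | no _  = cong inj₂ (rep-injective
              (trans (sym (flip-flip _)) (trans (cong flip (inj₁-injective eq)) (flip-flip _))))

    -- Burnside's lemma for a group of order two. Each orbit is counted twice: once by its
    -- representative, and once by its other element or, if there is none, by the index of the fixed
    -- point.
    orbit-count : classes + classes ≡ N + k
    orbit-count = ℕₚ.≤-antisym (⊎-injective⇒≤ from from-injective) (⊎-injective⇒≤ to to-injective)

-- The trihex of a sublattice

next prev : Fin 3 → Fin 3
next 0F = 1F
next 1F = 2F
next 2F = 0F
prev 0F = 2F
prev 1F = 0F
prev 2F = 1F

prev-next : ∀ j → prev (next j) ≡ j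
prev-next 0F = refl
prev-next 1F = refl
prev-next 2F = refl

next-prev : ∀ j → next (prev j) ≡ j
next-prev 0F = refl
next-prev 1F = refl
next-prev 2F = refl

next³ : ∀ j → next (next (next j)) ≡ j
next³ 0F = refl
next³ 1F = refl
next³ 2F = refl

-- The centres of the hexagons of the tiling form the lattice ℤ[ω], and a dart of the tiling is a pair (z , k) of a
-- centre z and a direction k ∈ ℤ/6, in which the face across the dart has centre z + ωᵏ.  The half-turn about the
-- origin sends (z , k) to (- z , k + 3), so modulo half-turns each dart has the form (z , 4 j) with j ∈ ℤ/3.  It is
-- written (z , j) below, and w j = ω⁴ʲ.
w : Fin 3 → E
w 0F = + 1 , + 0
w 1F = + 0 , -[1+ 0 ]
w 2F = -[1+ 0 ] , + 1

-- ρ sends (z , j) to (z + w j , j + 1), so z - corner j is constant on the orbits of ρ.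
corner : Fin 3 → E
corner 0F = + 0 , + 0
corner 1F = + 1 , + 0
corner 2F = + 1 , -[1+ 0 ]

residue₂ : ∀ a → ∃₂ λ (r : Fin 2) q → a ≡ + toℕ r ℤ.+ (q ℤ.+ q)
residue₂ a = fromℕ< (ℤ.n%ℕd<d a 2) , a ℤ./ℕ 2 , trans (ℤ.a≡a%ℕn+[a/ℕn]*n a 2)
  (cong₂ (λ r q → + r ℤ.+ q) (sym (Finₚ.toℕ-fromℕ< (ℤ.n%ℕd<d a 2))) (two (a ℤ./ℕ 2)))
  where
  two : ∀ x → x ℤ.* + 2 ≡ x ℤ.+ x
  two = ℤ.solve-∀

residue₃ : ∀ a → ∃₂ λ (r : Fin 3) q → a ≡ + toℕ r ℤ.+ (q ℤ.+ q ℤ.+ q)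
residue₃ a = fromℕ< (ℤ.n%ℕd<d a 3) , a ℤ./ℕ 3 , trans (ℤ.a≡a%ℕn+[a/ℕn]*n a 3)
  (cong₂ (λ r q → + r ℤ.+ q) (sym (Finₚ.toℕ-fromℕ< (ℤ.n%ℕd<d a 3))) (three (a ℤ./ℕ 3)))
  where
  three : ∀ x → x ℤ.* + 3 ≡ x ℤ.+ x ℤ.+ x
  three = ℤ.solve-∀

module LatticeTrihex (A B C : ℕ) .{{A≢0 : NonZero A}} .{{C≢0 : NonZero C}} where
  N : ℕ
  N = (A + A) * (C + C)

  M : E → Set
  M = DoubledLattice A B C

  private
    double-nonZero : ∀ n → .{{NonZero n}} → NonZero (n + n)
    double-nonZero (suc n) = _

  open IsSubgroup (inLattice-subgroup (A + A) (B + B) (C + C)) public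
  open CosetNumbering
    (cosetNumbering (A + A) (B + B) (C + C) {{double-nonZero A}} {{double-nonZero C}}) public

  opaque
    shift : E → Fin N → Fin N
    shift t z = π (sec z ⊕ t)

    flip : Fin N → Fin N
    flip z = π (neg (sec z))

    shift-sec : ∀ t z → shift t z ≡ π (sec z ⊕ t)
    shift-sec t z = refl

    flip-sec : ∀ z → flip z ≡ π (neg (sec z))
    flip-sec z = refl

    shift-π : ∀ t z → shift t (π z) ≡ π (z ⊕ t)
    shift-π t z = π-≡ (subst M (cancel (sec (π z)) z t) (π-≡⁻¹ (π-sec (π z))))
      where
      cancel : ∀ s z t → s ⊖ z ≡ (s ⊕ t) ⊖ (z ⊕ t)
      cancel (s , s′) (z , z′) (t , t′) = cong₂ _,_ (lemma s z t) (lemma s′ z′ t′)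
        where
        lemma : ∀ s z t → s ℤ.- z ≡ (s ℤ.+ t) ℤ.- (z ℤ.+ t)
        lemma = ℤ.solve-∀

    flip-π : ∀ z → flip (π z) ≡ π (neg z)
    flip-π z = π-≡ (subst M (cancel (sec (π z)) z) (neg-∈ (π-≡⁻¹ (π-sec (π z)))))
      where
      cancel : ∀ s z → neg (s ⊖ z) ≡ neg s ⊖ neg z
      cancel (s , s′) (z , z′) = cong₂ _,_ (lemma s z) (lemma s′ z′)
        where
        lemma : ∀ s z → ℤ.- (s ℤ.- z) ≡ (ℤ.- s) ℤ.- (ℤ.- z)
        lemma = ℤ.solve-∀

    shift-shift : ∀ s t z → shift s (shift t z) ≡ shift (t ⊕ s) z
    shift-shift s t z = trans (shift-π s (sec z ⊕ t))
      (cong π (cong₂ _,_ (ℤₚ.+-assoc (proj₁ (sec z)) (proj₁ t) (proj₁ s)) (ℤₚ.+-assoc (proj₂ (sec z)) (proj₂ t) (proj₂ s))))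

    shift-0 : ∀ z → shift 0ᴱ z ≡ z
    shift-0 z = trans (cong π (cong₂ _,_ (ℤₚ.+-identityʳ _) (ℤₚ.+-identityʳ _))) (π-sec z)

    flip-flip : ∀ z → flip (flip z) ≡ z
    flip-flip z = trans (flip-π _)
      (trans (cong π (cong₂ _,_ (ℤₚ.neg-involutive _) (ℤₚ.neg-involutive _))) (π-sec z))

    flip-shift : ∀ t z → flip (shift t z) ≡ shift (neg t) (flip z)
    flip-shift t z = trans (flip-π _) (trans
      (cong π (cong₂ _,_ (ℤₚ.neg-distrib-+ (proj₁ (sec z)) (proj₁ t)) (ℤₚ.neg-distrib-+ (proj₂ (sec z)) (proj₂ t))))
      (sym (shift-π (neg t) (neg (sec z)))))

    shift-back : ∀ t z → shift (neg t) (shift t z) ≡ z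
    shift-back t z = trans (shift-shift (neg t) t z) (trans
      (cong (λ s → shift s z) (cong₂ _,_ (ℤₚ.+-inverseʳ (proj₁ t)) (ℤₚ.+-inverseʳ (proj₂ t)))) (shift-0 z))

    shift-forth : ∀ t z → shift t (shift (neg t) z) ≡ z
    shift-forth t z = trans (shift-shift t (neg t) z) (trans
      (cong (λ s → shift s z) (cong₂ _,_ (ℤₚ.+-inverseˡ (proj₁ t)) (ℤₚ.+-inverseˡ (proj₂ t)))) (shift-0 z))

  Dart : Set
  Dart = Fin N × Fin 3

  -- In the tiling, reversal is (z , k) ↦ (z + ωᵏ , k + 3) and the face step is (z , k) ↦ (z , k +
  -- 1). For k = 4 j, a half-turn about 0 brings the new direction back to a multiple of 4, namely 4
  -- j and 4 (j + 1). The rotation ρ is φ after ι.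
  ρ ρ⁻¹ ι φ : Dart → Dart
  ρ   (z , j) = shift (w j) z , next j
  ρ⁻¹ (z , j) = shift (neg (w (prev j))) z , prev j
  ι   (z , j) = shift (neg (w j)) (flip z) , j
  φ   (z , j) = flip z , next j

  source : Dart → Fin N
  source (z , j) = shift (neg (corner j)) z

  open Involution flip flip-flip using (orbits; cls; rep; cls-rep; respects; sameOrbit; orbit-count) renaming (classes to F)

  side : Dart → Fin F
  side (z , j) = cls z

  opaque
    ρ-ρ⁻¹ : ∀ x → ρ (ρ⁻¹ x) ≡ x
    ρ-ρ⁻¹ (z , j) = cong₂ _,_ (shift-forth (w (prev j)) z) (next-prev j)

    ρ⁻¹-ρ : ∀ x → ρ⁻¹ (ρ x) ≡ x
    ρ⁻¹-ρ (z , j) = cong₂ _,_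
      (trans (cong (λ i → shift (neg (w i)) (shift (w j) z)) (prev-next j)) (shift-back (w j) z)) (prev-next j)

    ι-ι : ∀ x → ι (ι x) ≡ x
    ι-ι (z , j) = cong (_, j) (trans (cong (shift (neg (w j))) (flip-shift (neg (w j)) (flip z)))
      (trans (shift-forth (neg (w j)) (flip (flip z))) (flip-flip z)))

    ρ-ι : ∀ x → ρ (ι x) ≡ φ x
    ρ-ι (z , j) = cong (_, next j) (shift-forth (w j) (flip z))

  M-even : ∀ {z} → M z → Even z
  M-even {z} m = let u , eq , _ = halve-∈ {A} {B} {C} z m in u , eq

  -- A fixed dart would put - 2 s - w j into 2 Λ, all of whose vectors are even; but every w j has
  -- an odd coordinate.
  ι-noFixpoint : ∀ x → ι x ≢ x
  ι-noFixpoint (z , j) eq = let (a , b) , even = M-even m in odd j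
    (a ℤ.+ proj₁ s) (b ℤ.+ proj₂ s)
    (solve (proj₁ s) (ℤ.- proj₁ (w j)) a (cong proj₁ even)) (solve (proj₂ s) (ℤ.- proj₂ (w j)) b (cong proj₂ even))
    where
    s = sec z
    m : M ((neg s ⊕ neg (w j)) ⊖ s)
    m = π-≡⁻¹ (trans (sym (shift-π (neg (w j)) (neg s)))
      (trans (cong (shift (neg (w j))) (sym (flip-sec z))) (trans (cong proj₁ eq) (sym (π-sec z)))))
    solve : ∀ s t a → (ℤ.- s ℤ.+ t) ℤ.- s ≡ a ℤ.+ a → (a ℤ.+ s) ℤ.+ (a ℤ.+ s) ≡ t
    solve s t a eq = trans (lemma₁ a s) (trans (cong (λ i → i ℤ.+ (s ℤ.+ s)) (sym eq)) (lemma₂ s t))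
      where
      lemma₁ : ∀ a s → (a ℤ.+ s) ℤ.+ (a ℤ.+ s) ≡ (a ℤ.+ a) ℤ.+ (s ℤ.+ s)
      lemma₁ = ℤ.solve-∀
      lemma₂ : ∀ s t → ((ℤ.- s ℤ.+ t) ℤ.- s) ℤ.+ (s ℤ.+ s) ≡ t
      lemma₂ = ℤ.solve-∀
    odd : ∀ j x y → x ℤ.+ x ≡ ℤ.- proj₁ (w j) → y ℤ.+ y ≡ ℤ.- proj₂ (w j) → ⊥
    odd 0F x y p q = double-≢-1 x p
    odd 1F x y p q = double-≢1 y q
    odd 2F x y p q = double-≢1 x p

  opaque
    ρ-iterates : ∀ n x → source (iterate ρ x n) ≡ source x
    ρ-iterates zero    x = refl
    ρ-iterates (suc n) x = trans (ρ-iterates n (ρ x)) (ρ-source x)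
      where
      ρ-source : ∀ x → source (ρ x) ≡ source x
      ρ-source (z , 0F) = shift-shift _ _ z
      ρ-source (z , 1F) = shift-shift _ _ z
      ρ-source (z , 2F) = shift-shift _ _ z

    -- Both darts are linked through the dart of colour `0F` at their common source.
    ρ-reaches : ∀ x y → source x ≡ source y → ∃ λ n → iterate ρ x n ≡ y
    ρ-reaches x y eq = descent x + ascent y , (begin
      iterate ρ x (descent x + ascent y)            ≡⟨ iterate-+ ρ x (descent x) (ascent y) ⟩
      iterate ρ (iterate ρ x (descent x)) (ascent y) ≡⟨ cong (λ p → iterate ρ p (ascent y)) (descends x) ⟩
      iterate ρ (source x , 0F) (ascent y)          ≡⟨ cong (λ u → iterate ρ (u , 0F) (ascent y)) eq ⟩
      iterate ρ (source y , 0F) (ascent y)          ≡⟨ ascends y ⟩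
      y                                             ∎)
      where
      open ≡-Reasoning
      descent ascent : Dart → ℕ
      descent (z , 0F) = 0
      descent (z , 1F) = 2
      descent (z , 2F) = 1
      ascent (z , j) = toℕ j
      descends : ∀ x → iterate ρ x (descent x) ≡ (source x , 0F)
      descends (z , 0F) = cong (_, 0F) (sym (shift-0 z))
      descends (z , 1F) = cong (_, 0F) (shift-shift _ _ z)
      descends (z , 2F) = refl
      ascends : ∀ x → iterate ρ (source x , 0F) (ascent x) ≡ x
      ascends (z , 0F) = cong (_, 0F) (shift-0 z)
      ascends (z , 1F) = cong (_, 1F) (shift-forth _ z)
      ascends (z , 2F) = cong (_, 2F) (trans (cong (shift (w 1F)) (shift-shift _ _ z)) (trans (shift-shift _ _ z) (shift-0 z)))

    φ-iterates : ∀ n x → side (iterate φ x n) ≡ side x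
    φ-iterates zero    x       = refl
    φ-iterates (suc n) (z , j) = trans (φ-iterates n (φ (z , j))) (sym (respects (inj₂ refl)))

    φ² : ∀ z i → iterate φ (z , i) 2 ≡ (z , prev i)
    φ² z 0F = cong (_, 2F) (flip-flip z)
    φ² z 1F = cong (_, 0F) (flip-flip z)
    φ² z 2F = cong (_, 1F) (flip-flip z)

    φ⁴ : ∀ z i → iterate φ (z , i) 4 ≡ (z , next i)
    φ⁴ z i = trans (iterate-+ φ (z , i) 2 2) (trans (cong (λ p → iterate φ p 2) (φ² z i))
      (trans (φ² z (prev i)) (cong (z ,_) (prev² i))))
      where
      prev² : ∀ i → prev (prev i) ≡ next i
      prev² 0F = refl
      prev² 1F = refl
      prev² 2F = refl

    -- Even powers of φ preserve the centre and run through all three colours; an odd step passes to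
    -- the opposite centre.
    recolour : ∀ z i j → ∃ λ n → iterate φ (z , i) n ≡ (z , j)
    recolour z 0F 0F = 0 , refl
    recolour z 0F 1F = 4 , φ⁴ z 0F
    recolour z 0F 2F = 2 , φ² z 0F
    recolour z 1F 0F = 2 , φ² z 1F
    recolour z 1F 1F = 0 , refl
    recolour z 1F 2F = 4 , φ⁴ z 1F
    recolour z 2F 0F = 4 , φ⁴ z 2F
    recolour z 2F 1F = 2 , φ² z 2F
    recolour z 2F 2F = 0 , refl

    φ-reaches : ∀ x y → side x ≡ side y → ∃ λ n → iterate φ x n ≡ y
    φ-reaches (z , i) (z′ , j) eq = go (sameOrbit eq)
      where
      go : z′ ≡ z ⊎ z′ ≡ flip z → ∃ λ n → iterate φ (z , i) n ≡ (z′ , j)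
      go (inj₁ refl) = recolour z i j
      go (inj₂ refl) = let n , eq = recolour (flip z) (next i) j in suc n , eq

  -- 2 z lies in 2 Λ precisely if z lies in Λ, so flip fixes the four elements of Λ / 2 Λ, the centres of the triangles.
  fixedPoint : Fin 2 × Fin 2 → E
  fixedPoint (a , b) = + toℕ a ℤ.* + A ℤ.+ + toℕ b ℤ.* + B , + toℕ b ℤ.* + C

  private
    Λ = InLattice A B C

    flip-fixed : ∀ i → flip (π (fixedPoint i)) ≡ π (fixedPoint i)
    flip-fixed i = trans (flip-π z) (π-≡ (subst M (cong₂ _,_ (ℤₚ.neg-distrib-+ (proj₁ z) _) (ℤₚ.neg-distrib-+ (proj₂ z) _))
      (neg-∈ (double-∈ {A} {B} {C} z (+ toℕ (proj₁ i) , + toℕ (proj₂ i) , refl , refl)))))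
      where z = fixedPoint i

    flip-fixed⇒∈ : ∀ z → flip z ≡ z → Λ (sec z)
    flip-fixed⇒∈ z eq = double-∈⁻¹ {A} {B} {C} s (subst M (negate s) (neg-∈ m))
      where
      s = sec z
      m : M (neg s ⊖ s)
      m = π-≡⁻¹ (trans (sym (flip-sec z)) (trans eq (sym (π-sec z))))
      negate : ∀ s → neg (neg s ⊖ s) ≡ s ⊕ s
      negate (x , y) = cong₂ _,_ (lemma x) (lemma y)
        where
        lemma : ∀ x → ℤ.- (ℤ.- x ℤ.- x) ≡ x ℤ.+ x
        lemma = ℤ.solve-∀

    all-flip-fixed : ∀ z → flip z ≡ z → ∃ λ i → π (fixedPoint i) ≡ z
    all-flip-fixed z eq =
      let a , b , x-eq , y-eq = flip-fixed⇒∈ z eq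
          i , p , a≡ = residue₂ a
          j , q , b≡ = residue₂ b
      in (i , j) , trans (π-≡ {w = sec z} (ℤ.- p , ℤ.- q ,
          trans (cong (λ x → proj₁ (fixedPoint (i , j)) ℤ.- x)
                  (trans x-eq (cong₂ (λ a b → a ℤ.* + A ℤ.+ b ℤ.* + B) a≡ b≡)))
                (x-lemma (+ toℕ i) (+ toℕ j) p q (+ A) (+ B)) ,
          trans (cong (λ y → proj₂ (fixedPoint (i , j)) ℤ.- y) (trans y-eq (cong (ℤ._* + C) b≡)))
                (y-lemma (+ toℕ j) q (+ C)))) (π-sec z)
      where
      x-lemma : ∀ r r′ p q A B → r ℤ.* A ℤ.+ r′ ℤ.* B ℤ.- ((r ℤ.+ (p ℤ.+ p)) ℤ.* A ℤ.+ (r′ ℤ.+ (q ℤ.+ q)) ℤ.* B) ≡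
                ℤ.- p ℤ.* (A ℤ.+ A) ℤ.+ ℤ.- q ℤ.* (B ℤ.+ B)
      x-lemma = ℤ.solve-∀
      y-lemma : ∀ r q C → r ℤ.* C ℤ.- (r ℤ.+ (q ℤ.+ q)) ℤ.* C ≡ ℤ.- q ℤ.* (C ℤ.+ C)
      y-lemma = ℤ.solve-∀

    fixedPoint-injective : ∀ i j → π (fixedPoint i) ≡ π (fixedPoint j) → i ≡ j
    fixedPoint-injective (i , k) (j , l) eq =
      let a , b , x-eq , y-eq = π-≡⁻¹ eq in go a b x-eq (cancel-factor (+ toℕ k) (+ toℕ l) b C y-eq)
      where
      cancel-factor : ∀ r s b n → .{{NonZero n}} → r ℤ.* + n ℤ.- s ℤ.* + n ≡ b ℤ.* (+ n ℤ.+ + n) →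
                      r ≡ b ℤ.* + 2 ℤ.+ s
      cancel-factor r s b (suc n) eq = trans (lemma₁ r s) (cong (ℤ._+ s)
        (ℤₚ.*-cancelʳ-≡ (r ℤ.- s) (b ℤ.* + 2) (+ suc n)
          (trans (lemma₂ r s (+ suc n)) (trans eq (lemma₃ b (+ suc n))))))
        where
        lemma₁ : ∀ r s → r ≡ r ℤ.- s ℤ.+ s
        lemma₁ = ℤ.solve-∀
        lemma₂ : ∀ r s C → (r ℤ.- s) ℤ.* C ≡ r ℤ.* C ℤ.- s ℤ.* C
        lemma₂ = ℤ.solve-∀
        lemma₃ : ∀ b C → b ℤ.* (C ℤ.+ C) ≡ b ℤ.* + 2 ℤ.* C
        lemma₃ = ℤ.solve-∀
      go : ∀ a b → proj₁ (fixedPoint (i , k)) ℤ.- proj₁ (fixedPoint (j , l)) ≡ a ℤ.* (+ A ℤ.+ + A) ℤ.+ b ℤ.* (+ B ℤ.+ + B) →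
           + toℕ k ≡ b ℤ.* + 2 ℤ.+ + toℕ l → (i , k) ≡ (j , l)
      go a b x-eq y-eq with refl ← Finₚ.toℕ-injective (remainder-unique b (Finₚ.toℕ<n k) (Finₚ.toℕ<n l) y-eq)
        with ℤₚ.i*j≡0⇒i≡0∨j≡0 b {+ 2} (cancel-right _ _ y-eq)
        where
        cancel-right : ∀ t s → s ≡ t ℤ.+ s → t ≡ + 0
        cancel-right t s eq = trans (lemma t s) (trans (cong (ℤ._- s) (sym eq)) (ℤₚ.+-inverseʳ s))
          where
          lemma : ∀ t s → t ≡ t ℤ.+ s ℤ.- s
          lemma = ℤ.solve-∀
      ... | inj₁ refl = cong (_, k) (Finₚ.toℕ-injective (remainder-unique a (Finₚ.toℕ<n i) (Finₚ.toℕ<n j)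
              (cancel-factor (+ toℕ i) (+ toℕ j) a A
                (trans (lemma (+ toℕ i ℤ.* + A) (+ toℕ j ℤ.* + A) (+ toℕ k ℤ.* + B)) (trans x-eq (ℤₚ.+-identityʳ _))))))
        where
        lemma : ∀ r s t → r ℤ.- s ≡ (r ℤ.+ t) ℤ.- (s ℤ.+ t)
        lemma = ℤ.solve-∀

  -- The faces are the orbits of the half-turn on centres, and the 4 counts its fixed points, the
  -- triangles.
  faces-count : F + F ≡ N + 4
  faces-count = orbit-count (λ i → π (fixedPoint (remQuot {2} 2 i)))
    (λ {i} {j} eq → trans (sym (Finₚ.combine-remQuot {2} 2 i)) (trans
      (cong (λ (a , b) → combine a b) (fixedPoint-injective (remQuot {2} 2 i) (remQuot {2} 2 j) eq))
      (Finₚ.combine-remQuot {2} 2 j)))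
    (λ i → flip-fixed (remQuot {2} 2 i))
    (λ z eq → let (a , b) , p = all-flip-fixed z eq in
      combine a b , trans (cong (π ∘ fixedPoint) (Finₚ.remQuot-combine a b)) p)

  enc : Dart → Fin (N * 3)
  enc (z , j) = combine z j

  dec : Fin (N * 3) → Dart
  dec = remQuot {N} 3

  dec-enc : ∀ x → dec (enc x) ≡ x
  dec-enc (z , j) = Finₚ.remQuot-combine z j

  enc-dec : ∀ x → enc (dec x) ≡ x
  enc-dec = Finₚ.combine-remQuot {N} 3

  lift : (Dart → Dart) → Fin (N * 3) → Fin (N * 3)
  lift h x = enc (h (dec x))

  opaque
    lift-∘ : ∀ (g h k : Dart → Dart) → (∀ x → g (h x) ≡ k x) → ∀ x → lift g (lift h x) ≡ lift k x
    lift-∘ g h k eq x = cong enc (trans (cong g (dec-enc _)) (eq (dec x)))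

    lift-id : ∀ (g h : Dart → Dart) → (∀ x → g (h x) ≡ x) → ∀ x → lift g (lift h x) ≡ x
    lift-id g h eq x = trans (lift-∘ g h (λ x → x) eq x) (enc-dec x)

  opaque
    lift-cycles : ∀ {m} {key : Dart → Fin m} {h : Dart → Dart} {π : Fin (N * 3) → Fin (N * 3)} →
                  (∀ x → π x ≡ lift h x) → (∀ n x → key (iterate h x n) ≡ key x) →
                  (∀ x y → key x ≡ key y → ∃ λ n → iterate h x n ≡ y) →
                  ∀ x y → key (dec x) ≡ key (dec y) ⇔ SameCycle π x y
    lift-cycles {key = key} {h} {π} π≡ invariant reaches x y = mk⇔
      (λ eq → let n , p = reaches (dec x) (dec y) eq in
        n , trans (cong (λ x → iterate π x n) (sym (enc-dec x))) (trans (iterates n (dec x)) (trans (cong enc p) (enc-dec y))))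
      (λ { (n , refl) → trans (sym (invariant n (dec x))) (cong key (trans (sym (dec-enc _))
        (cong dec (trans (sym (iterates n (dec x))) (cong (λ x → iterate π x n) (enc-dec x)))))) })
      where
      iterates : ∀ n x → iterate π (enc x) n ≡ enc (iterate h x n)
      iterates zero    x = refl
      iterates (suc n) x = trans (cong (λ y → iterate π y n)
        (trans (π≡ (enc x)) (cong (enc ∘ h) (dec-enc x)))) (iterates n (h x))

  graph : Graph N
  graph = record
    { darts          = N * 3
    ; src            = source ∘ dec
    ; rev            = lift ι
    ; rev-involutive = lift-id ι ι ι-ι
    ; rev-noFixpoint = λ x eq → ι-noFixpoint (dec x) (trans (sym (dec-enc _)) (cong dec eq))
    }

  drawing : Drawing graph
  drawing = record
    { rotation        = permutation (lift ρ) (lift ρ⁻¹) (lift-id ρ ρ⁻¹ ρ-ρ⁻¹) (lift-id ρ⁻¹ ρ ρ⁻¹-ρ)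
    ; rotation-cycles = lift-cycles {key = source} (λ _ → refl) ρ-iterates ρ-reaches
    ; faces           = F
    ; face            = side ∘ dec
    ; face-surjective = λ c → enc (rep c , 0F) ,
        λ { refl → trans (cong side (dec-enc _)) (cls-rep c) }
    ; face-cycles     = lift-cycles {key = side} (lift-∘ ρ ι φ ρ-ι) φ-iterates φ-reaches
    }

  open Graph graph using (Adjacent; Connected)

  cubic : Graph.Regular graph 3
  cubic u = fibreSize-≡ record
    { elem      = λ j → enc (shift (corner j) u , j)
    ; injective = λ {i} {j} eq → proj₂ (Finₚ.combine-injective (shift (corner i) u) i (shift (corner j) u) j eq)
    ; sound     = λ j → trans (cong source (dec-enc _)) (shift-back (corner j) u)
    ; complete  = λ x eq → proj₂ (dec x) ,
        trans (cong (λ z → enc (z , proj₂ (dec x))) (trans (cong (shift (corner _)) (sym eq)) (shift-forth _ _))) (enc-dec x)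
    }

  -- The darts of a face are the three colours at z and the three at - z; the two triples coincide
  -- precisely when the half-turn fixes z modulo 2 Λ.
  triOrHex : ∀ f → Drawing.sides drawing f ≡ 3 ⊎ Drawing.sides drawing f ≡ 6
  triOrHex f = go (flip z Fin.≟ z)
    where
    z = rep f
    orient : Fin 2 → Fin N
    orient 0F = z
    orient 1F = flip z
    orient-sound : ∀ b → cls (orient b) ≡ f
    orient-sound 0F = cls-rep f
    orient-sound 1F = trans (sym (respects (inj₂ refl))) (cls-rep f)
    orient-complete : ∀ {z′} → cls z′ ≡ f → ∃ λ b → orient b ≡ z′
    orient-complete eq with sameOrbit (trans (cls-rep f) (sym eq))
    ... | inj₁ p = 0F , sym p
    ... | inj₂ p = 1F , sym p
    orient-injective : flip z ≢ z → ∀ a b → orient a ≡ orient b → a ≡ b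
    orient-injective ≢z 0F 0F eq = refl
    orient-injective ≢z 0F 1F eq = contradiction (sym eq) ≢z
    orient-injective ≢z 1F 0F eq = contradiction eq ≢z
    orient-injective ≢z 1F 1F eq = refl
    go : Dec (flip z ≡ z) → Drawing.sides drawing f ≡ 3 ⊎ Drawing.sides drawing f ≡ 6
    go (yes p) = inj₁ (fibreSize-≡ record
      { elem      = λ j → enc (z , j)
      ; injective = λ {i} {j} eq → proj₂ (Finₚ.combine-injective z i z j eq)
      ; sound     = λ j → trans (cong side (dec-enc _)) (cls-rep f)
      ; complete  = λ x eq → proj₂ (dec x) ,
          trans (cong (λ z → enc (z , proj₂ (dec x))) (same (proj₁ (dec x)) eq)) (enc-dec x)
      })
      where
      same : ∀ z′ → cls z′ ≡ f → z ≡ z′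
      same z′ eq with orient-complete eq
      ... | 0F , q = q
      ... | 1F , q = trans (sym p) q
    go (no ¬p) = inj₂ (fibreSize-≡ record
      { elem      = λ i → let b , j = remQuot {2} 3 i in enc (orient b , j)
      ; injective = λ {i} {k} eq →
          let a , l = remQuot {2} 3 i
              b , m = remQuot {2} 3 k
              p , q = Finₚ.combine-injective (orient a) l (orient b) m eq in
          trans (sym (Finₚ.combine-remQuot {2} 3 i))
            (trans (cong₂ combine (orient-injective ¬p a b p) q) (Finₚ.combine-remQuot {2} 3 k))
      ; sound     = λ i → trans (cong side (dec-enc _)) (orient-sound (proj₁ (remQuot {2} 3 i)))
      ; complete  = λ x eq → let b , p = orient-complete eq in combine b (proj₂ (dec x)) ,
          trans (cong (λ (b , j) → enc (orient b , j)) (Finₚ.remQuot-combine b (proj₂ (dec x))))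
            (trans (cong (λ z → enc (z , proj₂ (dec x))) p) (enc-dec x))
      })

  -- Crossing an edge of colour j takes the vertex u to `offset j` - u, so two crossings translate
  -- by a difference of offsets. Suitable differences are the two basis vectors.
  connected : Connected
  connected u v = Star.reverse adjacent-sym (from-origin u) ◅◅ from-origin v
    where
    adjacent-sym : ∀ {u v} → Adjacent u v → Adjacent v u
    adjacent-sym (x , refl , refl) = Graph.rev graph x , refl , cong (source ∘ dec) (lift-id ι ι ι-ι x)
    neighbour : Fin 3 → Fin N → Fin N
    neighbour j u = source (ι (shift (corner j) u , j))
    toNeighbour : ∀ j u → Adjacent u (neighbour j u)
    toNeighbour j u = enc (shift (corner j) u , j) ,
      trans (cong source (dec-enc _)) (shift-back (corner j) u) ,
      trans (cong source (dec-enc _)) (cong (source ∘ ι) (dec-enc _))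
    offset : Fin 3 → E
    offset j = neg (corner j) ⊕ neg (w j) ⊕ neg (corner j)
    neighbour-≡ : ∀ j u → neighbour j u ≡ shift (offset j) (flip u)
    neighbour-≡ j u = trans (cong (source ∘ (λ z → shift (neg (w j)) z , j)) (flip-shift (corner j) u))
      (trans (cong (λ z → source (z , j)) (shift-shift (neg (w j)) (neg (corner j)) (flip u)))
        (shift-shift (neg (corner j)) (neg (corner j) ⊕ neg (w j)) (flip u)))
    twice : ∀ i j u → Star Adjacent u (shift (neg (offset j) ⊕ offset i) u)
    twice i j u = toNeighbour j u ◅ subst (Adjacent (neighbour j u))
      (trans (neighbour-≡ i (neighbour j u)) (trans (cong (shift (offset i) ∘ flip) (neighbour-≡ j u))
        (trans (cong (shift (offset i)) (trans (flip-shift (offset j) (flip u)) (cong (shift (neg (offset j))) (flip-flip u))))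
          (shift-shift (offset i) (neg (offset j)) u))))
      (toNeighbour i (neighbour j u)) ◅ ε
    repeat : ∀ t → (∀ u → Star Adjacent u (shift t u)) → ∀ n u →
             Star Adjacent u (shift (+ n ℤ.* proj₁ t , + n ℤ.* proj₂ t) u)
    repeat t step zero    u = subst (Star Adjacent u) (sym (shift-0 u)) ε
    repeat t step (suc n) u = repeat t step n u ◅◅ subst (Star Adjacent _)
      (trans (shift-shift t _ u) (cong (λ s → shift s u) (cong₂ _,_ (lemma (+ n) (proj₁ t)) (lemma (+ n) (proj₂ t)))))
      (step _)
      where
      lemma : ∀ n t → n ℤ.* t ℤ.+ t ≡ (+ 1 ℤ.+ n) ℤ.* t
      lemma = ℤ.solve-∀
    from-origin : ∀ v → Star Adjacent (π 0ᴱ) v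
    from-origin v = let m , n , eq = sec-≥0 v in
      subst (Star Adjacent (π 0ᴱ)) (trans (shift-shift _ _ _) (trans (shift-π _ 0ᴱ)
        (trans (cong π (trans (cong₂ _,_ (x-lemma (+ m) (+ n)) (y-lemma (+ m) (+ n))) (sym eq))) (π-sec v))))
        -- The offsets of the colours 0, 1, 2 are (- 1 , 0), (- 2 , 1), (- 1 , 1); subtracting the
        -- second or the first from the third leaves (1 , 0) or (0 , 1).
        (repeat (+ 1 , + 0) (twice 2F 1F) m (π 0ᴱ) ◅◅ repeat (+ 0 , + 1) (twice 2F 0F) n _)
      where
      x-lemma : ∀ m n → + 0 ℤ.+ (m ℤ.* + 1 ℤ.+ n ℤ.* + 0) ≡ m
      x-lemma = ℤ.solve-∀
      y-lemma : ∀ m n → + 0 ℤ.+ (m ℤ.* + 0 ℤ.+ n ℤ.* + 1) ≡ n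
      y-lemma = ℤ.solve-∀

  spherical : N + F ≡ (N * 3) / 2 + 2
  spherical = begin
    N + F              ≡⟨ cong₂ _+_ N≡ F≡ ⟩
    h + h + (h + 2)    ≡⟨ ℕₚ.+-assoc (h + h) h 2 ⟨
    h + h + h + 2      ≡⟨ cong (_+ 2) edges≡ ⟨
    (N * 3) / 2 + 2    ∎
    where
    open ≡-Reasoning
    h = A * (C + C)
    N≡ : N ≡ h + h
    N≡ = ℕₚ.*-distribʳ-+ (C + C) A A
    F≡ : F ≡ h + 2
    F≡ = ℕₚ.*-cancelˡ-≡ F (h + 2) 2 (trans (two F) (trans faces-count (trans (cong (_+ 4) N≡) (four h))))
      where
      two : ∀ n → 2 * n ≡ n + n
      two = ℕ.solve-∀
      four : ∀ h → h + h + 4 ≡ 2 * (h + 2)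
      four = ℕ.solve-∀
    edges≡ : (N * 3) / 2 ≡ h + h + h
    edges≡ = trans (cong (λ n → (n * 3) / 2) N≡) (trans (cong (_/ 2) (six h)) (m*n/n≡m (h + h + h) 2))
      where
      six : ∀ h → (h + h) * 3 ≡ (h + h + h) * 2
      six = ℕ.solve-∀

  trihex : Trihex N
  trihex = record
    { graph     = graph
    ; drawing   = drawing
    ; connected = connected
    ; cubic     = cubic
    ; spherical = spherical
    ; triOrHex  = triOrHex
    }

-- Actions of ℤ² and of the symmetries of the hexagonal tiling

record ℤ²Action (X : Set) : Set where
  field
    act   : E → X → X
    act-0 : ∀ x → act 0ᴱ x ≡ x
    act-⊕ : ∀ s t x → act (s ⊕ t) x ≡ act s (act t x)

  act-neg : ∀ t x → act (neg t) (act t x) ≡ x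
  act-neg t x = trans (sym (act-⊕ (neg t) t x)) (trans
    (cong (λ s → act s x) (cong₂ _,_ (ℤₚ.+-inverseˡ (proj₁ t)) (ℤₚ.+-inverseˡ (proj₂ t)))) (act-0 x))

  act-neg′ : ∀ t x → act t (act (neg t) x) ≡ x
  act-neg′ t x = trans (sym (act-⊕ t (neg t) x)) (trans
    (cong (λ s → act s x) (cong₂ _,_ (ℤₚ.+-inverseʳ (proj₁ t)) (ℤₚ.+-inverseʳ (proj₂ t)))) (act-0 x))

  act-⊖ : ∀ s t x → act (s ⊖ t) x ≡ act s (act (neg t) x)
  act-⊖ s t x = act-⊕ s (neg t) x

  Fixes : X → E → Set
  Fixes x t = act t x ≡ x

  fixes-subgroup : ∀ x → IsSubgroup (Fixes x)
  fixes-subgroup x = record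
    { zero-∈ = act-0 x
    ; ⊖-∈    = λ {s} {t} p q → trans (act-⊖ s t x)
        (trans (cong (act s) (trans (cong (act (neg t)) (sym q)) (act-neg t x))) p)
    }

  fixes-⊖ : ∀ s t {x} → act s x ≡ act t x → Fixes x (s ⊖ t)
  fixes-⊖ s t {x} eq = trans (trans (cong (λ u → act u x) (cong₂ _,_ (ℤₚ.+-comm (proj₁ s) _) (ℤₚ.+-comm (proj₂ s) _)))
    (act-⊕ (neg t) s x)) (trans (cong (act (neg t)) eq) (act-neg t x))

  fixes-⊖⁻¹ : ∀ s t {x} → Fixes x (s ⊖ t) → act s x ≡ act t x
  fixes-⊖⁻¹ s t {x} eq = trans (cong (λ u → act u x) (cong₂ _,_ (lemma (proj₁ s) (proj₁ t)) (lemma (proj₂ s) (proj₂ t))))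
    (trans (act-⊕ t (s ⊖ t) x) (cong (act t) eq))
    where
    lemma : ∀ s t → s ≡ t ℤ.+ (s ℤ.- t)
    lemma = ℤ.solve-∀

record Additive (f : E → E) : Set where
  field
    f-0 : f 0ᴱ ≡ 0ᴱ
    f-⊕ : ∀ s t → f (s ⊕ t) ≡ f s ⊕ f t

pullback : ∀ {X f} → Additive f → ℤ²Action X → ℤ²Action X
pullback {f = f} additive α = record
  { act   = λ t → act (f t)
  ; act-0 = λ x → trans (cong (λ z → act z x) f-0) (act-0 x)
  ; act-⊕ = λ s t x → trans (cong (λ z → act z x) (f-⊕ s t)) (act-⊕ (f s) (f t) x)
  }
  where
  open ℤ²Action α
  open Additive additive

module _ {X Y} (α : ℤ²Action X) (β : ℤ²Action Y) (h : X → Y) where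
  private
    module α = ℤ²Action α
    module β = ℤ²Action β

    Commutes : E → Set
    Commutes t = ∀ x → h (α.act t x) ≡ β.act t (h x)

    commutes-subgroup : IsSubgroup Commutes
    commutes-subgroup = record
      { zero-∈ = λ x → trans (cong h (α.act-0 x)) (sym (β.act-0 (h x)))
      ; ⊖-∈    = λ {s} {t} p q x → begin
          h (α.act (s ⊖ t) x)                                     ≡⟨ cong h (α.act-⊖ s t x) ⟩
          h (α.act s (α.act (neg t) x))                           ≡⟨ p _ ⟩
          β.act s (h (α.act (neg t) x))                           ≡⟨ cong (β.act s) (β.act-neg t _) ⟨
          β.act s (β.act (neg t) (β.act t (h (α.act (neg t) x)))) ≡⟨ cong (β.act s ∘ β.act (neg t)) (q _) ⟨
          β.act s (β.act (neg t) (h (α.act t (α.act (neg t) x)))) ≡⟨ cong (β.act s ∘ β.act (neg t) ∘ h) (α.act-neg′ t x) ⟩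
          β.act s (β.act (neg t) (h x))                           ≡⟨ β.act-⊖ s t (h x) ⟨
          β.act (s ⊖ t) (h x)                                     ∎
      }
      where open ≡-Reasoning

  -- The translations with which `h` is compatible form a subgroup of ℤ², so it is enough to treat
  -- two generators.
  intertwines : Commutes (+ 1 , + 0) → Commutes (+ 0 , + 1) → ∀ t x → h (α.act t x) ≡ β.act t (h x)
  intertwines p q (a , b) = subst Commutes (cong₂ _,_ (x-lemma a b) (y-lemma a b))
    (⊕-∈ {a ℤ.* + 1 , a ℤ.* + 0} {b ℤ.* + 0 , b ℤ.* + 1} (multiple-∈ {+ 1} {+ 0} p a) (multiple-∈ {+ 0} {+ 1} q b))
    where
    open IsSubgroup commutes-subgroup
    x-lemma : ∀ a b → a ℤ.* + 1 ℤ.+ b ℤ.* + 0 ≡ a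
    x-lemma = ℤ.solve-∀
    y-lemma : ∀ a b → a ℤ.* + 0 ℤ.+ b ℤ.* + 1 ≡ b
    y-lemma = ℤ.solve-∀

module Power {X : Set} (f f⁻¹ : X → X) (f∘f⁻¹ : ∀ x → f (f⁻¹ x) ≡ x) (f⁻¹∘f : ∀ x → f⁻¹ (f x) ≡ x) where
  pow : ℤ → X → X
  pow (+ zero)     x = x
  pow (+ suc n)    x = f (pow (+ n) x)
  pow -[1+ zero ]  x = f⁻¹ x
  pow -[1+ suc n ] x = f⁻¹ (pow -[1+ n ] x)

  pow-suc : ∀ i x → pow (+ 1 ℤ.+ i) x ≡ f (pow i x)
  pow-suc (+ n)        x = refl
  pow-suc -[1+ zero ]  x = sym (f∘f⁻¹ x)
  pow-suc -[1+ suc n ] x = sym (f∘f⁻¹ _)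

  pow-pred : ∀ i x → pow (-[1+ 0 ] ℤ.+ i) x ≡ f⁻¹ (pow i x)
  pow-pred (+ zero)  x = refl
  pow-pred (+ suc n) x = sym (f⁻¹∘f _)
  pow-pred -[1+ n ]  x = refl

  pow-+ : ∀ i j x → pow (i ℤ.+ j) x ≡ pow i (pow j x)
  pow-+ (+ zero)     j x = cong (λ i → pow i x) (ℤₚ.+-identityˡ j)
  pow-+ (+ suc n)    j x = trans (cong (λ i → pow i x) (ℤₚ.+-assoc (+ 1) (+ n) j))
    (trans (pow-suc (+ n ℤ.+ j) x) (cong f (pow-+ (+ n) j x)))
  pow-+ -[1+ zero ]  j x = pow-pred j x
  pow-+ -[1+ suc n ] j x = trans (cong (λ i → pow i x) (ℤₚ.+-assoc -[1+ 0 ] -[1+ n ] j))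
    (trans (pow-pred (-[1+ n ] ℤ.+ j) x) (cong f⁻¹ (pow-+ -[1+ n ] j x)))

  pow-iterate : ∀ n x → pow (+ n) x ≡ iterate f x n
  pow-iterate zero    x = refl
  pow-iterate (suc n) x = trans (cong f (pow-iterate n x)) (sym (iterate-comm f x n))

  pow-comm : ∀ (g : X → X) → (∀ x → g (f x) ≡ f (g x)) → ∀ i x → g (pow i x) ≡ pow i (g x)
  pow-comm g gf (+ zero)     x = refl
  pow-comm g gf (+ suc n)    x = trans (gf _) (cong f (pow-comm g gf (+ n) x))
  pow-comm g gf -[1+ zero ]  x = trans (sym (f⁻¹∘f _)) (cong f⁻¹ (trans (sym (gf _)) (cong g (f∘f⁻¹ x))))
  pow-comm g gf -[1+ suc n ] x = trans (sym (f⁻¹∘f _)) (cong f⁻¹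
    (trans (sym (gf _)) (trans (cong g (f∘f⁻¹ _)) (pow-comm g gf -[1+ n ] x))))

-- Multiplication by the primitive sixth root of unity, in the basis (1 , ω).
ω : E → E
ω (x , y) = ℤ.- y , x ℤ.+ y

ω-additive : Additive ω
ω-additive = record
  { f-0 = refl
  ; f-⊕ = λ (x , y) (x′ , y′) → cong₂ _,_ (ℤₚ.neg-distrib-+ y y′) (lemma x y x′ y′)
  }
  where
  lemma : ∀ x y x′ y′ → (x ℤ.+ x′) ℤ.+ (y ℤ.+ y′) ≡ (x ℤ.+ y) ℤ.+ (x′ ℤ.+ y′)
  lemma = ℤ.solve-∀

ω³ : ∀ t → ω (ω (ω t)) ≡ neg t
ω³ (x , y) = cong₂ _,_ (x-lemma x y) (y-lemma x y)
  where
  x-lemma : ∀ x y → ℤ.- (ℤ.- y ℤ.+ (x ℤ.+ y)) ≡ ℤ.- x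
  x-lemma = ℤ.solve-∀
  y-lemma : ∀ x y → ℤ.- (x ℤ.+ y) ℤ.+ (ℤ.- y ℤ.+ (x ℤ.+ y)) ≡ ℤ.- y
  y-lemma = ℤ.solve-∀

-- The three relations present the (2 , 3 , 6) triangle group: φ, φ ι and ι turn around a face, a
-- vertex and an edge of the hexagonal tiling.
module HexAction {X : Set} (φ ι : X → X) (φ⁶ : ∀ x → φ (φ (φ (φ (φ (φ x))))) ≡ x) (ι² : ∀ x → ι (ι x) ≡ x)
                 (φι³ : ∀ x → φ (ι (φ (ι (φ (ι x))))) ≡ x) where
  φ² φ³ φ⁴ φ⁵ : X → X
  φ² x = φ (φ x)
  φ³ x = φ (φ² x)
  φ⁴ x = φ (φ³ x)
  φ⁵ x = φ (φ⁴ x)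

  -- A rearrangement of (φ ι)³ = 1, with φ⁵ as the inverse of φ. It lets a word containing ι twice
  -- be shortened.
  ιφι : ∀ x → ι (φ (ι x)) ≡ φ⁵ (ι (φ⁵ x))
  ιφι x = begin
    ι (φ (ι x))                                  ≡⟨ φ⁶ _ ⟨
    φ⁵ (φ (ι (φ (ι x))))                         ≡⟨ cong (φ⁵ ∘ φ ∘ ι ∘ φ ∘ ι) (φ⁶ x) ⟨
    φ⁵ (φ (ι (φ (ι (φ (φ⁵ x))))))                ≡⟨ cong (φ⁵ ∘ φ ∘ ι ∘ φ ∘ ι ∘ φ) (ι² (φ⁵ x)) ⟨
    φ⁵ (φ (ι (φ (ι (φ (ι (ι (φ⁵ x))))))))        ≡⟨ cong φ⁵ (φι³ (ι (φ⁵ x))) ⟩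
    φ⁵ (ι (φ⁵ x))                                ∎
    where open ≡-Reasoning

  ιφ⁵ι : ∀ x → ι (φ⁵ (ι x)) ≡ φ (ι (φ x))
  ιφ⁵ι x = begin
    ι (φ⁵ (ι x))                          ≡⟨ cong (ι ∘ φ⁵ ∘ ι) (φ⁶ x) ⟨
    ι (φ⁵ (ι (φ⁵ (φ x))))                 ≡⟨ cong ι (ιφι (φ x)) ⟨
    ι (ι (φ (ι (φ x))))                   ≡⟨ ι² _ ⟩
    φ (ι (φ x))                           ∎
    where open ≡-Reasoning

  -- S₀ and S₁ move a dart to the parallel dart of a neighbouring face, that is, they translate by 1 and ω.
  S₀ S₀⁻¹ S₁ S₁⁻¹ : X → X
  S₀ x   = φ³ (ι x)
  S₀⁻¹ x = ι (φ³ x)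
  S₁ x   = φ² (ι (φ x))
  S₁⁻¹ x = φ⁵ (ι (φ⁴ x))

  S₀-S₁ : ∀ x → S₀ (S₁ x) ≡ S₁ (S₀ x)
  S₀-S₁ x = begin
    φ³ (ι (φ² (ι (φ x))))                    ≡⟨ cong (φ³ ∘ ι ∘ φ) (ι² _) ⟨
    φ³ (ι (φ (ι (ι (φ (ι (φ x)))))))         ≡⟨ cong φ³ (ιφι _) ⟩
    φ³ (φ⁵ (ι (φ⁵ (ι (φ (ι (φ x)))))))       ≡⟨ cong φ² (φ⁶ _) ⟩
    φ² (ι (φ⁵ (ι (φ (ι (φ x))))))            ≡⟨ cong (φ² ∘ ι ∘ φ⁵) (ιφι (φ x)) ⟩
    φ² (ι (φ⁵ (φ⁵ (ι (φ⁵ (φ x))))))          ≡⟨ cong (φ² ∘ ι ∘ φ⁴) (φ⁶ _) ⟩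
    φ² (ι (φ⁴ (ι (φ⁵ (φ x)))))               ≡⟨ cong (φ² ∘ ι ∘ φ⁴ ∘ ι) (φ⁶ x) ⟩
    φ² (ι (φ⁴ (ι x)))                        ∎
    where open ≡-Reasoning

  private
    module P₀ = Power S₀ S₀⁻¹ (λ x → trans (cong φ³ (ι² _)) (φ⁶ x)) (λ x → trans (cong ι (φ⁶ _)) (ι² x))
    module P₁ = Power S₁ S₁⁻¹ (λ x → trans (cong (φ² ∘ ι) (φ⁶ _)) (trans (cong φ² (ι² _)) (φ⁶ x)))
      (λ x → trans (cong (φ⁵ ∘ ι) (φ⁶ _)) (trans (cong φ⁵ (ι² _)) (φ⁶ x)))

  action : ℤ²Action X
  action = record
    { act   = λ (a , b) x → P₀.pow a (P₁.pow b x)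
    ; act-0 = λ _ → refl
    ; act-⊕ = λ (a , b) (a′ , b′) x → trans (P₀.pow-+ a a′ _) (cong (P₀.pow a)
        (trans (cong (P₀.pow a′) (P₁.pow-+ b b′ x))
          (P₁.pow-comm (P₀.pow a′) (λ y → sym (P₀.pow-comm S₁ (λ z → sym (S₀-S₁ z)) a′ y)) b (P₁.pow b′ x))))
    }

  open ℤ²Action action public

  act-S₀ : ∀ n x → act (+ n , + 0) x ≡ iterate S₀ x n
  act-S₀ = P₀.pow-iterate

  act-S₁ : ∀ n x → act (+ 0 , + n) x ≡ iterate S₁ x n
  act-S₁ = P₁.pow-iterate

  -- In the plane `act t` sends (z , k) to (z + ωᵏ t , k), so it measures t in the frame of the
  -- dart; the face step turns that frame by ω.
  act-φ : ∀ t x → act t (φ x) ≡ φ (act (ω t) x)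
  act-φ t x = sym (intertwines (pullback ω-additive action) action φ (λ _ → refl)
    (λ y → begin
      φ (ι (φ³ (φ² (ι (φ y)))))    ≡⟨ cong φ (ιφ⁵ι (φ y)) ⟩
      φ (φ (ι (φ (φ y))))          ∎)
    t x)
    where open ≡-Reasoning

-- The fixed-point conditions exclude half-turns about midpoints of edges and rotations of order 3
-- about vertices and faces. Only φ³ may fix a dart, as it does on a triangle.
module HexDevelop {X : Set} (φ ι : X → X) (φ⁶ : ∀ x → φ (φ (φ (φ (φ (φ x))))) ≡ x) (ι² : ∀ x → ι (ι x) ≡ x)
                  (φι³ : ∀ x → φ (ι (φ (ι (φ (ι x))))) ≡ x) (ι-noFixpoint : ∀ x → ι x ≢ x)
                  (φι-noFixpoint : ∀ x → φ (ι x) ≢ x) (φ⁴-noFixpoint : ∀ x → φ (φ (φ (φ x))) ≢ x) where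
  open HexAction φ ι φ⁶ ι² φι³ public

  act-φ³ : ∀ t x → act t (φ³ x) ≡ φ³ (act (neg t) x)
  act-φ³ t x = trans (act-φ t (φ² x)) (cong φ (trans (act-φ (ω t) (φ x)) (cong φ
    (trans (act-φ (ω (ω t)) x) (cong (λ s → φ (act s x)) (ω³ t))))))

  act-φ⁴ : ∀ t x → act t (φ⁴ x) ≡ φ⁴ (act (neg (ω t)) x)
  act-φ⁴ t x = trans (act-φ t (φ³ x)) (cong φ (act-φ³ (ω t) x))

  φ-injective : ∀ {x y} → φ x ≡ φ y → x ≡ y
  φ-injective eq = trans (sym (φ⁶ _)) (trans (cong φ⁵ eq) (φ⁶ _))

  φ³-injective : ∀ {x y} → φ³ x ≡ φ³ y → x ≡ y
  φ³-injective eq = trans (sym (φ⁶ _)) (trans (cong φ³ eq) (φ⁶ _))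

  -- In the plane, the equations below say that x is fixed by a rotation of order 3.  Its centre is a face or a vertex,
  -- and neither occurs in the deck group, as faceStep⁴ and rotation have no fixed points.
  no-order3 : ∀ x z z′ → φ⁴ (act z x) ≢ act z′ x
  no-order3 x z z′ eq = byRemainder (proj₁ split) (proj₁ (proj₂ split)) (proj₂ (proj₂ split))
    where
    d₁ = proj₁ z ℤ.- proj₁ z′
    d₂ = proj₂ z ℤ.- proj₂ z′
    -- Moving the base dart by a translation changes z - z′ by multiples of 1 + ω, which has norm 3;
    -- since ω is - 1 modulo 1 + ω, the residue of (x , y) is x - y modulo 3. Residue 0 puts the
    -- centre at a face, the other two at the two sorts of vertices.
    split : ∃₂ λ (r : Fin 3) q → d₁ ℤ.- d₂ ≡ + toℕ r ℤ.+ (q ℤ.+ q ℤ.+ q)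
    split = residue₃ (d₁ ℤ.- d₂)
    fixed : ∀ u s → (z ⊕ ω u ⊖ z′) ⊕ u ≡ s → ∃ λ y → act s (φ⁴ y) ≡ y
    fixed u s refl = act c x , (begin
      act ((c ⊖ z′) ⊕ u) (φ⁴ (act c x))                ≡⟨ act-⊕ (c ⊖ z′) u _ ⟩
      act (c ⊖ z′) (act u (φ⁴ (act c x)))              ≡⟨ cong (act (c ⊖ z′)) (act-φ⁴ u _) ⟩
      act (c ⊖ z′) (φ⁴ (act (neg (ω u)) (act c x)))    ≡⟨ cong (act (c ⊖ z′) ∘ φ⁴) (act-⊕ (neg (ω u)) c x) ⟨
      act (c ⊖ z′) (φ⁴ (act (neg (ω u) ⊕ c) x))        ≡⟨ cong (λ t → act (c ⊖ z′) (φ⁴ (act t x))) (cong₂ _,_ (cancel (proj₁ z) (proj₁ (ω u))) (cancel (proj₂ z) (proj₂ (ω u)))) ⟩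
      act (c ⊖ z′) (φ⁴ (act z x))                      ≡⟨ cong (act (c ⊖ z′)) eq ⟩
      act (c ⊖ z′) (act z′ x)                          ≡⟨ act-⊕ (c ⊖ z′) z′ x ⟨
      act (c ⊖ z′ ⊕ z′) x                              ≡⟨ cong (λ t → act t x) (cong₂ _,_ (restore (proj₁ c) (proj₁ z′)) (restore (proj₂ c) (proj₂ z′))) ⟩
      act c x                                          ∎)
      where
      open ≡-Reasoning
      c = z ⊕ ω u
      cancel : ∀ z t → ℤ.- t ℤ.+ (z ℤ.+ t) ≡ z
      cancel = ℤ.solve-∀
      restore : ∀ c z → c ℤ.- z ℤ.+ z ≡ c
      restore = ℤ.solve-∀
    shape : ∀ q s → d₁ ℤ.- d₂ ≡ s ℤ.+ (q ℤ.+ q ℤ.+ q) →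
            let u = ℤ.- (q ℤ.+ q) ℤ.- d₂ , q in (z ⊕ ω u ⊖ z′) ⊕ u ≡ (s , + 0)
    shape q s eq = cong₂ _,_
      (trans (x-lemma (proj₁ z) (proj₁ z′) d₂ q) (trans (cong (ℤ._- (q ℤ.+ q ℤ.+ q)) eq) (drop s (q ℤ.+ q ℤ.+ q))))
      (y-lemma (proj₂ z) (proj₂ z′) q)
      where
      x-lemma : ∀ x x′ d q → (x ℤ.+ ℤ.- q ℤ.- x′) ℤ.+ (ℤ.- (q ℤ.+ q) ℤ.- d) ≡ (x ℤ.- x′ ℤ.- d) ℤ.- (q ℤ.+ q ℤ.+ q)
      x-lemma = ℤ.solve-∀
      drop : ∀ s t → s ℤ.+ t ℤ.- t ≡ s
      drop = ℤ.solve-∀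
      y-lemma : ∀ y y′ q → (y ℤ.+ ((ℤ.- (q ℤ.+ q) ℤ.- (y ℤ.- y′)) ℤ.+ q) ℤ.- y′) ℤ.+ q ≡ + 0
      y-lemma = ℤ.solve-∀
    byRemainder : ∀ (r : Fin 3) q → d₁ ℤ.- d₂ ≡ + toℕ r ℤ.+ (q ℤ.+ q ℤ.+ q) → ⊥
    byRemainder 0F q eq = let y , p = fixed _ _ (shape q (+ 0) eq) in φ⁴-noFixpoint y p
    byRemainder 1F q eq = let y , p = fixed _ _ (shape q (+ 1) eq) in
      φι-noFixpoint (φ⁴ y) (trans (sym (φ⁶ _)) (cong φ⁴ p))
    -- The residue 2 is represented by - 1, so that the remaining translation is the single word
    -- `S₀⁻¹`.
    byRemainder 2F q eq = let y , p = fixed _ _ (shape (+ 1 ℤ.+ q) -[1+ 0 ] (trans eq (lemma q))) in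
      φι-noFixpoint (ι y) (trans (cong φ (ι² y)) (trans (sym (ι² _)) (cong ι (trans (cong ι (sym (φ⁶ (φ y)))) p))))
      where
      lemma : ∀ q → + 2 ℤ.+ (q ℤ.+ q ℤ.+ q) ≡ -[1+ 0 ] ℤ.+ ((+ 1 ℤ.+ q) ℤ.+ (+ 1 ℤ.+ q) ℤ.+ (+ 1 ℤ.+ q))
      lemma = ℤ.solve-∀

  -- φ to the power 4 j, with the exponent reduced modulo 6: the turn from direction 0 to the
  -- direction 4 j of colour j.
  rot : Fin 3 → X → X
  rot 0F x = x
  rot 1F x = φ⁴ x
  rot 2F x = φ² x

  rot-injective : ∀ j {x y} → rot j x ≡ rot j y → x ≡ y
  rot-injective 0F eq = eq
  rot-injective 1F eq = φ-injective (φ³-injective eq)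
  rot-injective 2F eq = φ-injective (φ-injective eq)

  module Develop (x₀ : X) (tri : φ³ x₀ ≡ x₀) where
    -- This is the deck half-turn about the centre of the triangle of `x₀`: the darts (z , 0) and (-
    -- z , 3) of the tiling have the same image.
    fold-act : ∀ z → act z x₀ ≡ φ³ (act (neg z) x₀)
    fold-act z = trans (cong (act z) (sym tri)) (act-φ³ z x₀)

    -- In the plane, a translation by t followed by the half-turn about x₀ is the half-turn about t / 2, which is the
    -- midpoint of an edge unless t is even; but rev has no fixed points.
    fixes-even : ∀ t → Fixes x₀ t → Even t
    fixes-even (a , b) fixes = let i , p , a≡ = residue₂ a ; j , q , b≡ = residue₂ b in byParity i j p q a≡ b≡
      where
      halfTurn : ∀ c s → (a , b) ≡ (c ⊕ s) ⊕ c → ∃ λ y → act s (φ³ y) ≡ y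
      halfTurn c s refl = y , (begin
        act s (φ³ y)                            ≡⟨ cong (act s) (sym (act-φ³ c x₀)) ⟩
        act s (act c (φ³ x₀))                   ≡⟨ cong (act s ∘ act c) tri ⟩
        act s (act c x₀)                        ≡⟨ act-neg c _ ⟨
        act (neg c) (act c (act s (act c x₀)))  ≡⟨ cong (act (neg c)) (trans (act-⊕ (c ⊕ s) c x₀) (act-⊕ c s _)) ⟨
        act (neg c) (act ((c ⊕ s) ⊕ c) x₀)      ≡⟨ cong (act (neg c)) fixes ⟩
        y                                       ∎)
        where
        open ≡-Reasoning
        y = act (neg c) x₀
      byParity : ∀ (i j : Fin 2) p q → a ≡ + toℕ i ℤ.+ (p ℤ.+ p) → b ≡ + toℕ j ℤ.+ (q ℤ.+ q) → Even (a , b)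
      byParity 0F 0F p q a≡ b≡ = (p , q) , cong₂ _,_ (trans a≡ (ℤₚ.+-identityˡ _)) (trans b≡ (ℤₚ.+-identityˡ _))
      byParity 1F 0F p q a≡ b≡ =
        let y , e = halfTurn (p , q) (+ 1 , + 0) (cong₂ _,_ (trans a≡ (odd p)) (trans b≡ (even q))) in
        ⊥-elim (ι-noFixpoint (φ³ y) (trans (sym (φ⁶ _)) (cong φ³ e)))
        where
        odd : ∀ p → + 1 ℤ.+ (p ℤ.+ p) ≡ p ℤ.+ + 1 ℤ.+ p
        odd = ℤ.solve-∀
        even : ∀ q → + 0 ℤ.+ (q ℤ.+ q) ≡ q ℤ.+ + 0 ℤ.+ q
        even = ℤ.solve-∀
      byParity 0F 1F p q a≡ b≡ =
        let y , e = halfTurn (p , q) (+ 0 , + 1) (cong₂ _,_ (trans a≡ (even p)) (trans b≡ (odd q))) in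
        ⊥-elim (ι-noFixpoint (φ⁴ y) (trans (sym (φ⁶ _)) (cong φ⁴ e)))
        where
        odd : ∀ p → + 1 ℤ.+ (p ℤ.+ p) ≡ p ℤ.+ + 1 ℤ.+ p
        odd = ℤ.solve-∀
        even : ∀ q → + 0 ℤ.+ (q ℤ.+ q) ≡ q ℤ.+ + 0 ℤ.+ q
        even = ℤ.solve-∀
      byParity 1F 1F p q a≡ b≡ =
        -- The vector (1 , 1) is no unit, but modulo 2 it agrees with ω² = (- 1 , 1); the centre of
        -- the half-turn is again the midpoint of an edge.
        let y , e = halfTurn (p ℤ.+ + 1 , q) (-[1+ 0 ] , + 1) (cong₂ _,_ (trans a≡ (odd′ p)) (trans b≡ (odd q))) in
        ⊥-elim (ι-noFixpoint (φ⁵ y) (trans (sym (φ⁶ _)) (cong φ⁵ (trans (sym (ιφ⁵ι (φ⁴ y))) e))))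
        where
        odd : ∀ p → + 1 ℤ.+ (p ℤ.+ p) ≡ p ℤ.+ + 1 ℤ.+ p
        odd = ℤ.solve-∀
        odd′ : ∀ p → + 1 ℤ.+ (p ℤ.+ p) ≡ p ℤ.+ + 1 ℤ.+ -[1+ 0 ] ℤ.+ (p ℤ.+ + 1)
        odd′ = ℤ.solve-∀

    -- The covering map on the darts (z , 4 j) of the tiling, with (0 , 0) placed over `x₀`.
    cover : E → Fin 3 → X
    cover z j = rot j (act z x₀)

    cover-φ : ∀ z j → φ (cover z j) ≡ cover (neg z) (next j)
    cover-φ z 0F = cong φ (fold-act z)
    cover-φ z 1F = trans (cong φ⁵ (fold-act z)) (φ⁶ _)
    cover-φ z 2F = trans (cong φ³ (fold-act z)) (φ⁶ _)

    -- Together with `cover-φ`, this reproduces the formulas for φ and ι in `LatticeTrihex`, so the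
    -- covering map will descend to an isomorphism from the lattice model.
    cover-ι : ∀ z j → ι (cover z j) ≡ cover (neg (w j ⊕ z)) j
    cover-ι z j = φ³-injective (begin
      φ³ (ι (rot j (act z x₀)))                   ≡⟨ act-rot j (act z x₀) ⟩
      rot j (act (w j) (act z x₀))                ≡⟨ cong (rot j) (trans (sym (act-⊕ (w j) z x₀)) (fold-act (w j ⊕ z))) ⟩
      rot j (φ³ (act (neg (w j ⊕ z)) x₀))         ≡⟨ rot-φ³ j _ ⟩
      φ³ (rot j (act (neg (w j ⊕ z)) x₀))         ∎)
      where
      open ≡-Reasoning
      act-rot : ∀ j y → φ³ (ι (rot j y)) ≡ rot j (act (w j) y)
      act-rot 0F y = refl
      act-rot 1F y = act-φ⁴ (+ 1 , + 0) y
      act-rot 2F y = trans (act-φ (+ 1 , + 0) (φ y)) (cong φ (act-φ (+ 0 , + 1) y))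
      rot-φ³ : ∀ j y → rot j (φ³ y) ≡ φ³ (rot j y)
      rot-φ³ 0F y = refl
      rot-φ³ 1F y = refl
      rot-φ³ 2F y = refl

    cover-≡ : ∀ z z′ j → Fixes x₀ (z ⊖ z′) → cover z j ≡ cover z′ j
    cover-≡ z z′ j fixes = cong (rot j) (fixes-⊖⁻¹ z z′ fixes)

    -- Darts of different colours with the same image would be related by a deck rotation of order
    -- 3; darts of the same colour differ by a deck translation.
    cover-injective : ∀ z z′ i j → cover z i ≡ cover z′ j → i ≡ j × Fixes x₀ (z ⊖ z′)
    cover-injective z z′ 0F 0F eq = refl , fixes-⊖ z z′ eq
    cover-injective z z′ 1F 1F eq = refl , fixes-⊖ z z′ (rot-injective 1F eq)
    cover-injective z z′ 2F 2F eq = refl , fixes-⊖ z z′ (rot-injective 2F eq)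
    cover-injective z z′ 0F 1F eq = ⊥-elim (no-order3 x₀ z′ z (sym eq))
    cover-injective z z′ 1F 0F eq = ⊥-elim (no-order3 x₀ z z′ eq)
    cover-injective z z′ 0F 2F eq = ⊥-elim (no-order3 x₀ z z′ (trans (cong φ⁴ eq) (φ⁶ _)))
    cover-injective z z′ 2F 0F eq = ⊥-elim (no-order3 x₀ z′ z (trans (cong φ⁴ (sym eq)) (φ⁶ _)))
    cover-injective z z′ 1F 2F eq = ⊥-elim (no-order3 x₀ z′ z (trans (cong φ² (sym eq)) (φ⁶ _)))
    cover-injective z z′ 2F 1F eq = ⊥-elim (no-order3 x₀ z z′ (trans (cong φ² eq) (φ⁶ _)))


-- The universal cover of a trihex

module TrihexAction {v} (T : Trihex v) where
  open Trihex T

  ρ ι φ : Fin darts → Fin darts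
  ρ = rotation ⟨$⟩ʳ_
  ι = rev
  φ = faceStep

  ρ-injective : ∀ {x y} → ρ x ≡ ρ y → x ≡ y
  ρ-injective eq = trans (sym (Perm.inverseˡ rotation)) (trans (cong (rotation ⟨$⟩ˡ_) eq) (Perm.inverseˡ rotation))

  ρ-period : ∀ x → Period ρ x 3
  ρ-period x = subst (Period ρ x) (cubic (src x)) (period-fibreSize {f = src} {π = ρ} ρ-injective rotation-cycles x)

  private
    faceStep-injective : ∀ {x y} → φ x ≡ φ y → x ≡ y
    faceStep-injective eq = trans (sym (rev-involutive _)) (trans (cong ι (ρ-injective eq)) (rev-involutive _))

    φ-sides : ∀ x → Period φ x (sides (face x))
    φ-sides = period-fibreSize {f = face} {π = φ} faceStep-injective face-cycles

    φ-period : ∀ x → Period φ x 3 ⊎ Period φ x 6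
    φ-period x = Sum.map (λ eq → subst (Period φ x) eq (φ-sides x)) (λ eq → subst (Period φ x) eq (φ-sides x)) (triOrHex (face x))

  ρ³ : ∀ x → ρ (ρ (ρ x)) ≡ x
  ρ³ x = Period.returns (ρ-period x)

  ρ-noFixpoint : ∀ x → ρ x ≢ x
  ρ-noFixpoint x = Period.minimal (ρ-period x) 1 z<s (s<s z<s)

  φ⁶ : ∀ x → φ (φ (φ (φ (φ (φ x))))) ≡ x
  φ⁶ x = [ (λ P → trans (cong φ³ (Period.returns P)) (Period.returns P)) , Period.returns ]′ (φ-period x)
      where
      φ³ : Fin darts → Fin darts
      φ³ y = φ (φ (φ y))

  φ-ι : ∀ x → φ (ι x) ≡ ρ x
  φ-ι x = cong ρ (rev-involutive x)

  φι³ : ∀ x → φ (ι (φ (ι (φ (ι x))))) ≡ x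
  φι³ x = begin
    φ (ι (φ (ι (φ (ι x)))))   ≡⟨ φ-ι (φ (ι (φ (ι x)))) ⟩
    ρ (φ (ι (φ (ι x))))       ≡⟨ cong ρ (φ-ι (φ (ι x))) ⟩
    ρ (ρ (φ (ι x)))           ≡⟨ cong (ρ ∘ ρ) (φ-ι x) ⟩
    ρ (ρ (ρ x))               ≡⟨ ρ³ x ⟩
    x                         ∎
    where open ≡-Reasoning

  φ⁴-noFixpoint : ∀ x → φ (φ (φ (φ x))) ≢ x
  φ⁴-noFixpoint x eq =
    [ (λ P → Period.minimal P 1 z<s (s<s z<s) (trans (sym (cong φ (Period.returns P))) eq))
    , (λ P → Period.minimal P 4 z<s (s<s (s<s (s<s (s<s z<s)))) eq)
    ]′ (φ-period x)

  open HexDevelop φ ι φ⁶ rev-involutive φι³ rev-noFixpoint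
    (λ x eq → ρ-noFixpoint x (trans (sym (φ-ι x)) eq)) φ⁴-noFixpoint
    public hiding (module Develop)
  module Develop = HexDevelop.Develop φ ι φ⁶ rev-involutive φι³ rev-noFixpoint
    (λ x eq → ρ-noFixpoint x (trans (sym (φ-ι x)) eq)) φ⁴-noFixpoint

  dartAt : ∀ u → ∃ λ x → src x ≡ u
  dartAt u = Fibre.elem F 0F , Fibre.sound F 0F
    where
    F : Fibre src u 3
    F = subst (Fibre src u) (cubic u) (fibre src u)

  darts≡ : darts ≡ v * 3
  darts≡ = fibres-total src 3 cubic

  -- If all faces were hexagons, then 6 · faces = darts = 3 · v, which contradicts Euler's formula.
  triangle : ∃ λ x → φ³ x ≡ x
  triangle with Finₚ.any? (λ x → φ³ x Fin.≟ x)
  ... | yes t = t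
  ... | no ¬t = contradiction euler no-solution
    where
    hexagonal : ∀ f → sides f ≡ 6
    hexagonal f with triOrHex f
    ... | inj₂ six = six
    ... | inj₁ three with x , fx≡f ← face-surjective f =
      contradiction (x , Period.returns (subst (Period φ x) (trans (cong sides (fx≡f refl)) three) (φ-sides x))) ¬t
    v≡ : v ≡ faces * 2
    v≡ = ℕₚ.*-cancelʳ-≡ v (faces * 2) 3 (trans (sym darts≡)
      (trans (fibres-total face 6 hexagonal) (sym (ℕₚ.*-assoc faces 2 3))))
    edges≡ : edges ≡ faces * 3
    edges≡ = trans (cong (_/ 2) (trans (fibres-total face 6 hexagonal) (sym (ℕₚ.*-assoc faces 3 2)))) (m*n/n≡m (faces * 3) 2)
    euler : faces * 3 + 0 ≡ faces * 3 + 2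
    euler = trans (lemma faces) (trans (cong (_+ faces) (sym v≡)) (trans spherical (cong (_+ 2) edges≡)))
      where
      lemma : ∀ f → f * 3 + 0 ≡ f * 2 + f
      lemma = ℕ.solve-∀
    no-solution : faces * 3 + 0 ≢ faces * 3 + 2
    no-solution eq with () ← ℕₚ.+-cancelˡ-≡ (faces * 3) 0 2 eq

  module Cover (x₀ : Fin darts) (tri : φ³ x₀ ≡ x₀) where
    open Develop x₀ tri public

    abstract
      -- The image is closed under φ and ι, hence under ρ: it contains every dart at a vertex once
      -- it contains one, and it spreads along edges.
      cover-surjective : ∀ y → ∃₂ λ z j → cover z j ≡ y
      cover-surjective y = along (connected (src x₀) (src y)) (around (0ᴱ , 0F , act-0 x₀)) y refl
        where
        Covered : Fin darts → Set
        Covered y = ∃₂ λ z j → cover z j ≡ y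
        covered-ι : ∀ {y} → Covered y → Covered (ι y)
        covered-ι (z , j , refl) = neg (w j ⊕ z) , j , sym (cover-ι z j)
        covered-φ : ∀ {y} → Covered y → Covered (φ y)
        covered-φ (z , j , refl) = neg z , next j , sym (cover-φ z j)
        covered-ρ : ∀ {y} → Covered y → Covered (ρ y)
        covered-ρ {y} c = subst Covered (φ-ι y) (covered-φ (covered-ι c))
        iterates : ∀ n {y} → Covered y → Covered (iterate ρ y n)
        iterates zero    c = c
        iterates (suc n) c = iterates n (covered-ρ c)
        around : ∀ {x} → Covered x → ∀ y → src y ≡ src x → Covered y
        around {x} c y eq = let n , p = Equivalence.to (rotation-cycles x y) (sym eq) in subst Covered p (iterates n c)
        along : ∀ {u u′} → Star (Graph.Adjacent graph) u u′ → (∀ y → src y ≡ u → Covered y) → ∀ y → src y ≡ u′ → Covered y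
        along ε                         c = c
        along ((x , x≡ , x′≡) ◅ path) c = along path λ y y≡ → around (covered-ι (c x x≡)) y (trans y≡ (sym x′≡))

      -- `S₀` and `S₁` are injective on a finite set, so some positive power of each fixes `x₀`;
      -- this supplies stabilising translations on both axes.
      fixes-hermite : HermiteForm (Fixes x₀)
      fixes-hermite = hermiteForm (fixes-subgroup x₀) (λ t → act t x₀ Fin.≟ x₀)
        (let n , p = returns-eventually S₀-injective x₀ in n , trans (act-S₀ (suc n) x₀) p)
        (let n , p = returns-eventually S₁-injective x₀ in n , trans (act-S₁ (suc n) x₀) p)
        where
        ι-injective : ∀ {x y} → ι x ≡ ι y → x ≡ y
        ι-injective eq = trans (sym (rev-involutive _)) (trans (cong ι eq) (rev-involutive _))
        S₀-injective : ∀ {x y} → S₀ x ≡ S₀ y → x ≡ y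
        S₀-injective eq = ι-injective (φ³-injective eq)
        S₁-injective : ∀ {x y} → S₁ x ≡ S₁ y → x ≡ y
        S₁-injective eq = φ-injective (ι-injective (φ-injective (φ-injective eq)))

-- Every trihex comes from a sublattice

-- The two vertex counts may differ as expressions, because the model of a lattice has `N` vertices
-- and `N` is only provably equal to `v`. Working with darts keeps transports out of the geometry.
record DartIsomorphism {v v′} (S : Trihex v) (T : Trihex v′) : Set where
  private
    module S = Trihex S
    module T = Trihex T
  field
    f    : Fin S.darts → Fin T.darts
    f⁻¹  : Fin T.darts → Fin S.darts
    f∘f⁻¹ : ∀ y → f (f⁻¹ y) ≡ y
    f⁻¹∘f : ∀ x → f⁻¹ (f x) ≡ x
    f-rev : ∀ x → f (S.rev x) ≡ T.rev (f x)
    f-src : ∀ x y → S.src x ≡ S.src y → T.src (f x) ≡ T.src (f y)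

  f-injective : ∀ {x y} → f x ≡ f y → x ≡ y
  f-injective eq = trans (sym (f⁻¹∘f _)) (trans (cong f⁻¹ eq) (f⁻¹∘f _))

  RotationPreserving : Set
  RotationPreserving = ∀ x → f (S.rotation ⟨$⟩ʳ x) ≡ T.rotation ⟨$⟩ʳ f x

-- Vertices are the cycles of the rotation, so a bijection of darts commuting with the rotation
-- respects sources in both directions.
rotationPreserving⇒equivalent : ∀ {v v′} (eq : v ≡ v′) {S : Trihex v} {T : Trihex v′}
  (f : Fin (Trihex.darts S) → Fin (Trihex.darts T)) (f⁻¹ : Fin (Trihex.darts T) → Fin (Trihex.darts S)) →
  (∀ y → f (f⁻¹ y) ≡ y) → (∀ x → f⁻¹ (f x) ≡ x) → (∀ x → f (Trihex.rev S x) ≡ Trihex.rev T (f x)) →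
  (∀ x → f (Trihex.rotation S ⟨$⟩ʳ x) ≡ Trihex.rotation T ⟨$⟩ʳ f x) →
  Equivalent (subst Trihex eq S) T
rotationPreserving⇒equivalent refl {S} {T} f f⁻¹ f∘f⁻¹ f⁻¹∘f f-rev f-rot =
  proj₁ iso , λ x → trans (cong (T.rotation ⟨$⟩ʳ_) (proj₂ iso x)) (trans (sym (f-rot x)) (sym (proj₂ iso _)))
  where
  module S = Trihex S
  module T = Trihex T
  f⁻¹-rot : ∀ y → f⁻¹ (T.rotation ⟨$⟩ʳ y) ≡ S.rotation ⟨$⟩ʳ f⁻¹ y
  f⁻¹-rot y = trans (cong (λ y → f⁻¹ (T.rotation ⟨$⟩ʳ y)) (sym (f∘f⁻¹ y)))
    (trans (cong f⁻¹ (sym (f-rot (f⁻¹ y)))) (f⁻¹∘f _))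
  iterates : ∀ {X Y : Set} {π : X → X} {π′ : Y → Y} (h : X → Y) → (∀ x → h (π x) ≡ π′ (h x)) →
             ∀ n x → h (iterate π x n) ≡ iterate π′ (h x) n
  iterates h hπ zero    x = refl
  iterates {π′ = π′} h hπ (suc n) x = trans (iterates h hπ n _) (cong (λ y → iterate π′ y n) (hπ x))
  f-src : ∀ x y → S.src x ≡ S.src y → T.src (f x) ≡ T.src (f y)
  f-src x y eq = let n , p = Equivalence.to (S.rotation-cycles x y) eq in
    Equivalence.from (T.rotation-cycles (f x) (f y)) (n , trans (sym (iterates f f-rot n x)) (cong f p))
  f⁻¹-src : ∀ x y → T.src x ≡ T.src y → S.src (f⁻¹ x) ≡ S.src (f⁻¹ y)
  f⁻¹-src x y eq = let n , p = Equivalence.to (T.rotation-cycles x y) eq in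
    Equivalence.from (S.rotation-cycles (f⁻¹ x) (f⁻¹ y)) (n , trans (sym (iterates f⁻¹ f⁻¹-rot n x)) (cong f⁻¹ p))
  iso : Σ (S.graph ≅ T.graph) λ i → ∀ x → onDarts i ⟨$⟩ʳ x ≡ f x
  iso = isomorphism f f⁻¹ f∘f⁻¹ f⁻¹∘f (TrihexAction.dartAt S) (TrihexAction.dartAt T) f-src f⁻¹-src (λ x → sym (f-rev x))

isomorphic⇒dartIsomorphism : ∀ {v v₁ v₂} (p : v₁ ≡ v) (q : v₂ ≡ v) {S : Trihex v₁} {T : Trihex v₂} →
                             Isomorphic (subst Trihex p S) (subst Trihex q T) → DartIsomorphism S T
isomorphic⇒dartIsomorphism refl refl {S} {T} i = record
  { f     = onDarts i ⟨$⟩ʳ_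
  ; f⁻¹   = onDarts i ⟨$⟩ˡ_
  ; f∘f⁻¹ = λ _ → Perm.inverseʳ (onDarts i)
  ; f⁻¹∘f = λ _ → Perm.inverseˡ (onDarts i)
  ; f-rev = λ x → sym (rev-comm i x)
  ; f-src = λ x y eq → trans (src-comm i x) (trans (cong (onVertices i ⟨$⟩ʳ_) eq) (sym (src-comm i y)))
  }

equivalent⇒rotationPreserving : ∀ {v v₁ v₂} (p : v₁ ≡ v) (q : v₂ ≡ v) {S : Trihex v₁} {T : Trihex v₂} →
  Equivalent (subst Trihex p S) (subst Trihex q T) → Σ (DartIsomorphism S T) DartIsomorphism.RotationPreserving
equivalent⇒rotationPreserving refl refl (i , preserves) =
  isomorphic⇒dartIsomorphism refl refl i , λ x → sym (preserves x)

-- The sublattices of index v / 4, each represented once by its reduced Hermite form.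
record LatticeData (v : ℕ) : Set where
  field
    A B C : ℕ
    A>0   : 0 < A
    B<A   : B < A
    C>0   : 0 < C
    size  : (A + A) * (C + C) ≡ v

  Λ : E → Set
  Λ = InLattice A B C

toTrihex : ∀ {v} → LatticeData v → Trihex v
toTrihex d = subst Trihex size (LatticeTrihex.trihex A B C {{>-nonZero A>0}} {{>-nonZero C>0}})
  where open LatticeData d

halve : ∀ m x → + m ≡ x ℤ.+ x → ∃ λ k → m ≡ k + k
halve m (+ k)    eq = k , ℤₚ.+-injective eq
halve m -[1+ k ] ()

module Classify {v} (T : Trihex v) (x₀ : Fin (Trihex.darts T))
                (tri : Trihex.faceStep T (Trihex.faceStep T (Trihex.faceStep T x₀)) ≡ x₀) where
  open TrihexAction T
  open Cover x₀ tri
  open Trihex T using (darts)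

  module _ (A B C : ℕ) (A>0 : 0 < A) (C>0 : 0 < C)
           (∈-⇒ : ∀ z → Fixes x₀ z → DoubledLattice A B C z) (∈-⇐ : ∀ z → DoubledLattice A B C z → Fixes x₀ z) where
    private
      module L = LatticeTrihex A B C {{>-nonZero A>0}} {{>-nonZero C>0}}

      f̂ : L.Dart → Fin darts
      f̂ (i , j) = cover (L.sec i) j

      f̂-π : ∀ z j → f̂ (L.π z , j) ≡ cover z j
      f̂-π z j = cover-≡ (L.sec (L.π z)) z j (∈-⇐ _ (L.π-≡⁻¹ (L.π-sec (L.π z))))

      f̂-φ : ∀ x → f̂ (L.φ x) ≡ φ (f̂ x)
      f̂-φ (i , j) = trans (cong (λ z → f̂ (z , next j)) (L.flip-sec i))
        (trans (f̂-π (neg (L.sec i)) (next j)) (sym (cover-φ (L.sec i) j)))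

      f̂-ι : ∀ x → f̂ (L.ι x) ≡ ι (f̂ x)
      f̂-ι (i , j) = trans (cong (λ z → f̂ (z , j)) (trans (cong (L.shift (neg (w j))) (L.flip-sec i)) (L.shift-π (neg (w j)) _)))
        (trans (f̂-π _ j) (trans
          (cong (λ z → cover z j) (cong₂ _,_ (lemma (proj₁ (L.sec i)) (proj₁ (w j))) (lemma (proj₂ (L.sec i)) (proj₂ (w j)))))
          (sym (cover-ι (L.sec i) j))))
        where
        lemma : ∀ s t → ℤ.- s ℤ.+ ℤ.- t ≡ ℤ.- (t ℤ.+ s)
        lemma = ℤ.solve-∀

      f̂-ρ : ∀ x → f̂ (L.ρ x) ≡ ρ (f̂ x)
      f̂-ρ x = trans (cong (f̂ ∘ L.ρ) (sym (L.ι-ι x))) (trans (cong f̂ (L.ρ-ι (L.ι x)))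
        (trans (f̂-φ (L.ι x)) (trans (cong φ (f̂-ι x)) (φ-ι (f̂ x)))))

      f̂-injective : ∀ x y → f̂ x ≡ f̂ y → x ≡ y
      f̂-injective (i , j) (k , l) eq =
        let j≡l , fixes = cover-injective (L.sec i) (L.sec k) j l eq in
        cong₂ _,_ (trans (sym (L.π-sec i)) (trans (L.π-≡ (∈-⇒ _ fixes)) (L.π-sec k))) j≡l

      f : Fin (L.N * 3) → Fin darts
      f x = f̂ (L.dec x)

      f⁻¹ : Fin darts → Fin (L.N * 3)
      f⁻¹ y = let z , j , _ = cover-surjective y in L.enc (L.π z , j)

      f∘f⁻¹ : ∀ y → f (f⁻¹ y) ≡ y
      f∘f⁻¹ y = let z , j , eq = cover-surjective y in trans (cong f̂ (L.dec-enc (L.π z , j))) (trans (f̂-π z j) eq)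

      f-injective : ∀ {x y} → f x ≡ f y → x ≡ y
      f-injective {x} {y} eq =
        trans (sym (L.enc-dec x)) (trans (cong L.enc (f̂-injective (L.dec x) (L.dec y) eq)) (L.enc-dec y))

      f-lift : ∀ (h : L.Dart → L.Dart) (g : Fin darts → Fin darts) → (∀ x → f̂ (h x) ≡ g (f̂ x)) → ∀ x → f (L.lift h x) ≡ g (f x)
      f-lift h g eq x = trans (cong f̂ (L.dec-enc (h (L.dec x)))) (eq (L.dec x))

      size : (A + A) * (C + C) ≡ v
      -- Both graphs have three darts at each vertex, so the bijection of darts fixes the number of
      -- vertices.
      size = ℕₚ.*-cancelʳ-≡ L.N v 3 (trans (ℕₚ.≤-antisym (Finₚ.injective⇒≤ {f = f} f-injective)
        (Finₚ.injective⇒≤ {f = f⁻¹} λ {x} {y} eq → trans (sym (f∘f⁻¹ x)) (trans (cong f eq) (f∘f⁻¹ y)))) darts≡)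

    -- Since the stabiliser of `x₀` is exactly 2 Λ, the covering map factors through the darts of
    -- the lattice model and becomes injective there.
    equivalent-lattice : Σ (L.N ≡ v) λ eq → Equivalent (subst Trihex eq L.trihex) T
    equivalent-lattice = size , rotationPreserving⇒equivalent size {L.trihex} {T} f f⁻¹ f∘f⁻¹
      (λ x → f-injective (f∘f⁻¹ (f x))) (f-lift L.ι ι f̂-ι) (f-lift L.ρ ρ f̂-ρ)

  private
    open HermiteForm fixes-hermite

    -- Deck translations are even, so the Hermite entries of the stabiliser are even, and halving
    -- them gives Λ.
    x-even : ∃ λ k → A ≡ k + k
    x-even = let u , eq = fixes-even (+ A , + 0) (∈-⇐ (+ A , + 0) (x-generator A B C)) in halve A (proj₁ u) (cong proj₁ eq)

    y-even : (∃ λ k → B ≡ k + k) × (∃ λ k → C ≡ k + k)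
    y-even = let u , eq = fixes-even (+ B , + C) (∈-⇐ (+ B , + C) (y-generator A B C)) in
      halve B (proj₁ u) (cong proj₁ eq) , halve C (proj₂ u) (cong proj₂ eq)

    halved-positive : ∀ {m k} → m ≡ k + k → 0 < m → 0 < k
    halved-positive {k = zero}  refl ()
    halved-positive {k = suc k} _    _ = z<s

    halved-< : ∀ {m n k l} → m ≡ k + k → n ≡ l + l → m < n → k < l
    halved-< {k = k} {l} refl refl m<n = ℕₚ.≰⇒> λ l≤k → ℕₚ.<⇒≱ m<n (ℕₚ.+-mono-≤ l≤k l≤k)

    finish : ∀ a b c → A ≡ a + a → B ≡ b + b → C ≡ c + c → ∃ λ (d : LatticeData v) → Equivalent (toTrihex d) T
    finish a b c A≡ B≡ C≡ =
      let size , equivalent = equivalent-lattice a b c a>0 c>0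
            (λ z l → subst₂ (λ A B → InLattice A B (c + c) z) A≡ B≡ (subst (λ C → InLattice A B C z) C≡ (∈-⇒ z l)))
            (λ z l → ∈-⇐ z (subst (λ C → InLattice A B C z) (sym C≡)
              (subst₂ (λ A B → InLattice A B (c + c) z) (sym A≡) (sym B≡) l)))
      in record { A = a ; B = b ; C = c ; A>0 = a>0 ; B<A = halved-< B≡ A≡ B<A ; C>0 = c>0 ; size = size } , equivalent
      where
      a>0 = halved-positive A≡ A>0
      c>0 = halved-positive C≡ C>0

  classified : ∃ λ (d : LatticeData v) → Equivalent (toTrihex d) T
  classified = finish (proj₁ x-even) (proj₁ (proj₁ y-even)) (proj₁ (proj₂ y-even)) (proj₂ x-even) (proj₂ (proj₁ y-even)) (proj₂ (proj₂ y-even))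

classification : ∀ {v} (T : Trihex v) → ∃ λ (d : LatticeData v) → Equivalent (toTrihex d) T
classification T = let x₀ , tri = TrihexAction.triangle T in Classify.classified T x₀ tri

-- Graph isomorphisms and orientation

-- Complex conjugation: the conjugate of ω is 1 - ω.
conj : E → E
conj (x , y) = x ℤ.+ y , ℤ.- y

conj-additive : Additive conj
conj-additive = record
  { f-0 = refl
  ; f-⊕ = λ (x , y) (x′ , y′) → cong₂ _,_ (lemma x y x′ y′) (ℤₚ.neg-distrib-+ y y′)
  }
  where
  lemma : ∀ x y x′ y′ → (x ℤ.+ x′) ℤ.+ (y ℤ.+ y′) ≡ (x ℤ.+ y) ℤ.+ (x′ ℤ.+ y′)
  lemma = ℤ.solve-∀

module HexMap {X Y : Set}
  (φ ι : X → X) (φ⁶ : ∀ x → φ (φ (φ (φ (φ (φ x))))) ≡ x) (ι² : ∀ x → ι (ι x) ≡ x)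
  (φι³ : ∀ x → φ (ι (φ (ι (φ (ι x))))) ≡ x)
  (φ′ ι′ : Y → Y) (φ′⁶ : ∀ x → φ′ (φ′ (φ′ (φ′ (φ′ (φ′ x))))) ≡ x) (ι′² : ∀ x → ι′ (ι′ x) ≡ x)
  (φι′³ : ∀ x → φ′ (ι′ (φ′ (ι′ (φ′ (ι′ x))))) ≡ x)
  (h : X → Y) (hι : ∀ x → h (ι x) ≡ ι′ (h x)) where
  private
    module X = HexAction φ ι φ⁶ ι² φι³
    module Y = HexAction φ′ ι′ φ′⁶ ι′² φι′³

  equivariant : (∀ x → h (φ x) ≡ φ′ (h x)) → ∀ t x → h (X.act t x) ≡ Y.act t (h x)
  equivariant hφ = intertwines X.action Y.action h
    (λ x → trans (hφ³ (ι x)) (cong Y.φ³ (hι x)))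
    (λ x → trans (hφ _) (cong φ′ (trans (hφ _) (cong φ′ (trans (hι _) (cong ι′ (hφ x)))))))
    where
    hφ³ : ∀ x → h (X.φ³ x) ≡ Y.φ³ (h x)
    hφ³ x = trans (hφ _) (cong φ′ (trans (hφ _) (cong φ′ (hφ x))))

  -- A map reversing the direction of φ acts on translations as the reflection of the plane in the line through 1.
  reversing : (∀ x → φ′ (h (φ x)) ≡ h x) → ∀ t x → h (X.act t x) ≡ Y.act (conj t) (h x)
  reversing hφ = intertwines X.action (pullback conj-additive Y.action) h
    (λ x → begin
      h (φ (φ (φ (ι x))))                     ≡⟨ back _ ⟩
      Y.φ⁵ (h (φ (φ (ι x))))                  ≡⟨ cong Y.φ⁵ (back² (ι x)) ⟩
      Y.φ⁵ (Y.φ⁴ (h (ι x)))                   ≡⟨ φ′⁶ _ ⟩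
      Y.φ³ (h (ι x))                          ≡⟨ cong Y.φ³ (hι x) ⟩
      Y.φ³ (ι′ (h x))                         ∎)
    (λ x → begin
      h (φ (φ (ι (φ x))))                     ≡⟨ back² (ι (φ x)) ⟩
      Y.φ⁴ (h (ι (φ x)))                      ≡⟨ cong Y.φ⁴ (trans (hι _) (cong ι′ (back x))) ⟩
      Y.φ⁴ (ι′ (Y.φ⁵ (h x)))                  ≡⟨ cong Y.φ³ (Y.ιφ⁵ι (Y.φ⁴ (h x))) ⟨
      Y.φ³ (ι′ (Y.φ⁵ (ι′ (Y.φ⁴ (h x)))))      ∎)
    where
    open ≡-Reasoning
    back : ∀ x → h (φ x) ≡ Y.φ⁵ (h x)
    back x = trans (sym (φ′⁶ _)) (cong Y.φ⁵ (hφ x))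
    back² : ∀ x → h (φ (φ x)) ≡ Y.φ⁴ (h x)
    back² x = trans (back _) (trans (cong Y.φ⁵ (back x)) (φ′⁶ _))

fromSum : ∀ {P Q : Set} → P ⊎ Q → Bool
fromSum (inj₁ _) = true
fromSum (inj₂ _) = false

module _ {P Q : Set} where
  fromSum-true : (s : P ⊎ Q) → fromSum s ≡ true → P
  fromSum-true (inj₁ p) _ = p

  fromSum-false : (s : P ⊎ Q) → fromSum s ≡ false → Q
  fromSum-false (inj₂ q) _ = q

  fromSum-≡ : ∀ {P′ Q′ : Set} → (P → P′) → (Q → Q′) → ¬ (P′ × Q′) →
              (s : P ⊎ Q) (s′ : P′ ⊎ Q′) → fromSum s ≡ fromSum s′
  fromSum-≡ g h ex (inj₁ p) (inj₁ _) = refl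
  fromSum-≡ g h ex (inj₁ p) (inj₂ q) = contradiction (g p , q) ex
  fromSum-≡ g h ex (inj₂ q) (inj₁ p) = contradiction (p , h q) ex
  fromSum-≡ g h ex (inj₂ q) (inj₂ _) = refl

-- Closed walks pulled back along a graph isomorphism

module Walk {X : Set} (ρ ι : X → X) where
  step : Bool → X → X
  step true  x = ρ (ι x)
  step false x = ρ (ρ (ι x))

  run : ∀ {n} → Vec Bool n → X → X
  run []       x = x
  run (s ∷ ss) x = run ss (step s x)

-- At each vertex a graph isomorphism f either preserves or reverses the cyclic order of the three darts.  The boundary
-- of a face of the target pulls back to a closed walk that turns left where f preserves the order and right where it
-- reverses it.
module Signs {X Y : Set} (ρ ι : X → X) (ρ′ ι′ : Y → Y)
  (ρ³ : ∀ x → ρ (ρ (ρ x)) ≡ x) (ρ-noFixpoint : ∀ x → ρ x ≢ x)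
  (ρ′³ : ∀ x → ρ′ (ρ′ (ρ′ x)) ≡ x) (ρ′-noFixpoint : ∀ x → ρ′ x ≢ x)
  (φ′⁶ : ∀ x → ρ′ (ι′ (ρ′ (ι′ (ρ′ (ι′ (ρ′ (ι′ (ρ′ (ι′ (ρ′ (ι′ x))))))))))) ≡ x)
  (f : X → Y) (f⁻¹ : Y → X) (f∘f⁻¹ : ∀ y → f (f⁻¹ y) ≡ y) (f⁻¹∘f : ∀ x → f⁻¹ (f x) ≡ x)
  (f-ι : ∀ x → f (ι x) ≡ ι′ (f x))
  (sign : ∀ x → f (ρ x) ≡ ρ′ (f x) ⊎ f (ρ x) ≡ ρ′ (ρ′ (f x))) where

  private
    Pos Neg : X → Set
    Pos x = f (ρ x) ≡ ρ′ (f x)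
    Neg x = f (ρ x) ≡ ρ′ (ρ′ (f x))

    f-injective : ∀ {x y} → f x ≡ f y → x ≡ y
    f-injective eq = trans (sym (f⁻¹∘f _)) (trans (cong f⁻¹ eq) (f⁻¹∘f _))

    exclusive : ∀ x → ¬ (Pos x × Neg x)
    exclusive x (p , q) = ρ′-noFixpoint (ρ′ (f x)) (trans (sym q) p)

    no-return : ∀ x → f (ρ (ρ x)) ≢ f x
    no-return x eq = ρ-noFixpoint x (trans (cong ρ (sym (f-injective eq))) (ρ³ x))

    pos-ρ : ∀ x → Pos x → Pos (ρ x)
    pos-ρ x p = [ (λ p′ → p′) , (λ q → contradiction (trans q (trans (cong (ρ′ ∘ ρ′) p) (ρ′³ (f x)))) (no-return x)) ]′ (sign (ρ x))

    neg-ρ : ∀ x → Neg x → Neg (ρ x)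
    neg-ρ x q = [ (λ p → contradiction (trans p (trans (cong ρ′ q) (ρ′³ (f x)))) (no-return x)) , (λ q′ → q′) ]′ (sign (ρ x))

  sgn : X → Bool
  sgn x = fromSum (sign x)

  -- Opposite signs at x and ρ x would give f (ρ (ρ x)) = f x, as three rotations at f x return to
  -- the start. So the sign belongs to the vertex.
  sgn-ρ : ∀ x → sgn (ρ x) ≡ sgn x
  sgn-ρ x = sym (fromSum-≡ (pos-ρ x) (neg-ρ x) (exclusive (ρ x)) (sign x) (sign (ρ x)))

  open Walk ρ ι public

  ψ : X → X
  ψ x = f⁻¹ (ρ′ (ι′ (f x)))

  private
    f-step : ∀ s x → sgn (ι x) ≡ s → f (step s x) ≡ ρ′ (f (ι x))
    f-step true  x eq = fromSum-true (sign (ι x)) eq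
    f-step false x eq = trans (neg-ρ (ι x) n) (trans (cong (ρ′ ∘ ρ′) n) (cong ρ′ (ρ′³ _)))
      where n = fromSum-false (sign (ι x)) eq

  ψ-step : ∀ x → ψ x ≡ step (sgn (ι x)) x
  ψ-step x = trans (cong (f⁻¹ ∘ ρ′) (sym (f-ι x))) (trans (cong f⁻¹ (sym (f-step (sgn (ι x)) x refl))) (f⁻¹∘f _))

  ψ⁶ : ∀ x → ψ (ψ (ψ (ψ (ψ (ψ x))))) ≡ x
  ψ⁶ x = begin
    ψ (ψ (ψ (ψ (ψ (ψ x)))))                      ≡⟨ f⁻¹∘f _ ⟨
    f⁻¹ (f (ψ (ψ (ψ (ψ (ψ (ψ x)))))))            ≡⟨ cong f⁻¹ (trans (f-ψ _) (cong φ′ (trans (f-ψ _) (cong φ′ (trans (f-ψ _)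
                                                    (cong φ′ (trans (f-ψ _) (cong φ′ (trans (f-ψ _) (cong φ′ (f-ψ x)))))))))) ) ⟩
    f⁻¹ (φ′ (φ′ (φ′ (φ′ (φ′ (φ′ (f x)))))))      ≡⟨ cong f⁻¹ (φ′⁶ (f x)) ⟩
    f⁻¹ (f x)                                    ≡⟨ f⁻¹∘f x ⟩
    x                                            ∎
    where
    open ≡-Reasoning
    φ′ : Y → Y
    φ′ y = ρ′ (ι′ y)
    f-ψ : ∀ x → f (ψ x) ≡ φ′ (f x)
    f-ψ x = f∘f⁻¹ _

  signs : ∀ n → X → Vec Bool n
  signs zero    x = []
  signs (suc n) x = sgn (ι x) ∷ signs n (ψ x)

  run-signs : ∀ n x → run (signs n x) x ≡ iterate ψ x n
  run-signs zero    x = refl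
  run-signs (suc n) x = trans (cong (run (signs n (ψ x))) (sym (ψ-step x))) (run-signs n (ψ x))

  -- The hypothesis compares consecutive turns of the pulled-back walk, made at the two ends of the
  -- dart `ψ x`. Every dart y has this form, so both ends of y have the same sign.
  sgn-ι : (∀ x → sgn (ι x) ≡ sgn (ι (ψ x))) → ∀ y → sgn (ι y) ≡ sgn y
  sgn-ι agree y = begin
    sgn (ι y)                   ≡⟨ cong (sgn ∘ ι) (ψ⁶ y) ⟨
    sgn (ι (ψ x))               ≡⟨ agree x ⟨
    sgn (ι x)                   ≡⟨ sgn-step (sgn (ι x)) ⟨
    sgn (step (sgn (ι x)) x)    ≡⟨ cong sgn (ψ-step x) ⟨
    sgn (ψ x)                   ≡⟨ cong sgn (ψ⁶ y) ⟩
    sgn y                       ∎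
    where
    open ≡-Reasoning
    -- The predecessor of y along the walk, because ψ⁶ = 1.
    x = ψ (ψ (ψ (ψ (ψ y))))
    sgn-step : ∀ s → sgn (step s x) ≡ sgn (ι x)
    sgn-step true  = sgn-ρ (ι x)
    sgn-step false = trans (sgn-ρ _) (sgn-ρ (ι x))

  sgn-true : ∀ x → sgn x ≡ true → f (ρ x) ≡ ρ′ (f x)
  sgn-true x = fromSum-true (sign x)

  sgn-false : ∀ x → sgn x ≡ false → f (ρ x) ≡ ρ′ (ρ′ (f x))
  sgn-false x = fromSum-false (sign x)

-- The walk from centre z stands after n steps at t + z or t - z according to the parity of n. Only
-- t and the colour are tracked; the sign of z is restored after six steps.
symbolicRun : ∀ {n} → Vec Bool n → E → Fin 3 → E × Fin 3
symbolicRun []           t j = t , j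
symbolicRun (true ∷ ss)  t j = symbolicRun ss (neg t) (next j)
symbolicRun (false ∷ ss) t j = symbolicRun ss (neg t ⊕ w (next j)) (next (next j))

Odd : ℤ → Set
Odd x = x ℤ.%ℕ 2 ≡ 1

odd-≢-double : ∀ u → ¬ Odd (u ℤ.+ u)
odd-≢-double u odd = double-≢1 (u ℤ.- (u ℤ.+ u) ℤ./ℕ 2) (trans (regroup u q)
  (trans (cong (λ x → x ℤ.- (q ℤ.+ q)) (trans (ℤ.a≡a%ℕn+[a/ℕn]*n (u ℤ.+ u) 2) (cong (λ r → + r ℤ.+ q ℤ.* + 2) odd)))
    (cancel q)))
  where
  q = (u ℤ.+ u) ℤ./ℕ 2
  regroup : ∀ u q → (u ℤ.- q) ℤ.+ (u ℤ.- q) ≡ (u ℤ.+ u) ℤ.- (q ℤ.+ q)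
  regroup = ℤ.solve-∀
  cancel : ∀ q → + 1 ℤ.+ q ℤ.* + 2 ℤ.- (q ℤ.+ q) ≡ + 1
  cancel = ℤ.solve-∀

DoubledUnit : E → Fin 3 → Set
DoubledUnit t k = t ≡ w k ⊕ w k ⊎ t ≡ neg (w k ⊕ w k)

-- A walk of length 6 that turns both ways closes up neither in the plane nor modulo a group of even translations
-- and half-turns, unless it runs LLLRRR and hence translates by twice a unit.
Balanced : Vec Bool 6 → Fin 3 → Set
Balanced ss j = let t , i = symbolicRun ss 0ᴱ j in
  Vec.lookup ss 0F ≡ Vec.lookup ss 1F ⊎ i ≢ j ⊎ Odd (proj₁ t) ⊎ Odd (proj₂ t) ⊎ ∃ (DoubledUnit t)

allVec? : ∀ {n} {P : Vec Bool n → Set} → (∀ ss → Dec (P ss)) → Dec (∀ ss → P ss)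
allVec? {zero}  P? = map′ (λ { p [] → p }) (λ p → p []) (P? [])
allVec? {suc n} P? = map′ (λ { (p , q) (true ∷ ss) → p ss ; (p , q) (false ∷ ss) → q ss })
  (λ p → (λ ss → p (true ∷ ss)) , (λ ss → p (false ∷ ss)))
  (allVec? (λ ss → P? (true ∷ ss)) ×-dec allVec? (λ ss → P? (false ∷ ss)))

balanced? : ∀ ss j → Dec (Balanced ss j)
balanced? ss j = let t , i = symbolicRun ss 0ᴱ j in
  (Vec.lookup ss 0F Bool.≟ Vec.lookup ss 1F) ⊎-dec ¬? (i Fin.≟ j) ⊎-dec (_ ℕₚ.≟ _) ⊎-dec (_ ℕₚ.≟ _) ⊎-dec
  Finₚ.any? (λ k → ≡-dec ℤₚ._≟_ ℤₚ._≟_ t (w k ⊕ w k) ⊎-dec ≡-dec ℤₚ._≟_ ℤₚ._≟_ t (neg (w k ⊕ w k)))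

-- Evaluation of 64 turn sequences for three initial colours. Comparing only the first two turns
-- suffices, since a closed walk may be started at any of its darts.
balanced : ∀ ss j → Balanced ss j
balanced = toWitness {a? = allVec? λ ss → Finₚ.all? (balanced? ss)} _

-- Recovering the sublattice from the trihex

-- Multiplication by w j.
turn : Fin 3 → E → E
turn 0F t = t
turn 1F t = neg (ω t)
turn 2F t = ω (ω t)

turn-additive : ∀ j → Additive (turn j)
turn-additive 0F = record { f-0 = refl ; f-⊕ = λ _ _ → refl }
turn-additive 1F = record
  { f-0 = refl
  ; f-⊕ = λ s t → trans (cong neg (Additive.f-⊕ ω-additive s t))
      (cong₂ _,_ (ℤₚ.neg-distrib-+ (proj₁ (ω s)) (proj₁ (ω t))) (ℤₚ.neg-distrib-+ (proj₂ (ω s)) (proj₂ (ω t))))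
  }
turn-additive 2F = record
  { f-0 = refl
  ; f-⊕ = λ s t → trans (cong ω (Additive.f-⊕ ω-additive s t)) (Additive.f-⊕ ω-additive (ω s) (ω t))
  }

module Equivariant (A B C : ℕ) .{{A≢0 : NonZero A}} .{{C≢0 : NonZero C}} {X : Set}
  (φ ι : X → X) (φ⁶ : ∀ x → φ (φ (φ (φ (φ (φ x))))) ≡ x) (ι² : ∀ x → ι (ι x) ≡ x)
  (φι³ : ∀ x → φ (ι (φ (ι (φ (ι x))))) ≡ x)
  (enc : LatticeTrihex.Dart A B C → X)
  (φ-enc : ∀ x → φ (enc x) ≡ enc (LatticeTrihex.φ A B C x))
  (ι-enc : ∀ x → ι (enc x) ≡ enc (LatticeTrihex.ι A B C x)) where
  open LatticeTrihex A B C using (N; shift; flip; shift-0; shift-shift; flip-flip; flip-shift)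
  private module L = LatticeTrihex A B C
  open HexAction φ ι φ⁶ ι² φι³ using (act; action)

  shiftAction : ℤ²Action (Fin N)
  shiftAction = record
    { act   = shift
    ; act-0 = shift-0
    ; act-⊕ = λ s t z → trans
        (cong (λ u → shift u z) (cong₂ _,_ (ℤₚ.+-comm (proj₁ s) (proj₁ t)) (ℤₚ.+-comm (proj₂ s) (proj₂ t))))
        (sym (shift-shift s t z))
    }

  -- A dart of colour j points in the direction 4 j, so its frame is turned by w j.
  act-enc : ∀ j t z → act t (enc (z , j)) ≡ enc (shift (turn j t) z , j)
  act-enc j t z = sym (intertwines (pullback (turn-additive j) shiftAction) action (λ z → enc (z , j)) S₀-enc S₁-enc t z)
    where
    unit₀ : ∀ j → turn j (+ 1 , + 0) ≡ w j
    unit₀ 0F = refl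
    unit₀ 1F = refl
    unit₀ 2F = refl
    unit₁ : ∀ j → turn j (+ 0 , + 1) ≡ neg (w (next j))
    unit₁ 0F = refl
    unit₁ 1F = refl
    unit₁ 2F = refl
    S₀-enc : ∀ z → enc (shift (turn j (+ 1 , + 0)) z , j) ≡ φ (φ (φ (ι (enc (z , j)))))
    S₀-enc z = sym (begin
      φ (φ (φ (ι (enc (z , j)))))                  ≡⟨ cong (λ x → φ (φ (φ x))) (ι-enc _) ⟩
      φ (φ (φ (enc (L.ι (z , j)))))                ≡⟨ cong (λ x → φ (φ x)) (φ-enc _) ⟩
      φ (φ (enc (L.φ (L.ι (z , j)))))              ≡⟨ cong φ (φ-enc _) ⟩
      φ (enc (L.φ (L.φ (L.ι (z , j)))))            ≡⟨ φ-enc _ ⟩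
      enc (L.φ (L.φ (L.φ (L.ι (z , j)))))          ≡⟨ cong enc (cong₂ _,_ flips (next³ j)) ⟩
      enc (shift (turn j (+ 1 , + 0)) z , j)       ∎)
      where
      open ≡-Reasoning
      flips : flip (flip (flip (shift (neg (w j)) (flip z)))) ≡ shift (turn j (+ 1 , + 0)) z
      flips = trans (flip-flip _) (trans (flip-shift (neg (w j)) (flip z))
        (cong₂ shift (trans (cong₂ _,_ (ℤₚ.neg-involutive (proj₁ (w j))) (ℤₚ.neg-involutive (proj₂ (w j)))) (sym (unit₀ j)))
          (flip-flip z)))
    S₁-enc : ∀ z → enc (shift (turn j (+ 0 , + 1)) z , j) ≡ φ (φ (ι (φ (enc (z , j)))))
    S₁-enc z = sym (begin
      φ (φ (ι (φ (enc (z , j)))))                  ≡⟨ cong (λ x → φ (φ (ι x))) (φ-enc _) ⟩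
      φ (φ (ι (enc (L.φ (z , j)))))                ≡⟨ cong (λ x → φ (φ x)) (ι-enc _) ⟩
      φ (φ (enc (L.ι (L.φ (z , j)))))              ≡⟨ cong φ (φ-enc _) ⟩
      φ (enc (L.φ (L.ι (L.φ (z , j)))))            ≡⟨ φ-enc _ ⟩
      enc (L.φ (L.φ (L.ι (L.φ (z , j)))))          ≡⟨ cong enc (cong₂ _,_ flips (next³ j)) ⟩
      enc (shift (turn j (+ 0 , + 1)) z , j)       ∎)
      where
      open ≡-Reasoning
      flips : flip (flip (shift (neg (w (next j))) (flip (flip z)))) ≡ shift (turn j (+ 0 , + 1)) z
      flips = trans (flip-flip _) (cong₂ shift (sym (unit₁ j)) (flip-flip z))

module LatticeAction (A B C : ℕ) .{{A≢0 : NonZero A}} .{{C≢0 : NonZero C}} where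
  open LatticeTrihex A B C hiding (φ; ι; ρ)
  module L = LatticeTrihex A B C
  open TrihexAction trihex using (φ; ι; ρ; φ⁶; φι³; act; Fixes)

  φ-enc : ∀ x → φ (enc x) ≡ enc (L.φ x)
  φ-enc x = trans (lift-∘ L.ρ L.ι L.φ ρ-ι (enc x)) (cong (enc ∘ L.φ) (dec-enc x))

  ι-enc : ∀ x → ι (enc x) ≡ enc (L.ι x)
  ι-enc x = cong (enc ∘ L.ι) (dec-enc x)

  ρ-enc : ∀ x → ρ (enc x) ≡ enc (L.ρ x)
  ρ-enc x = cong (enc ∘ L.ρ) (dec-enc x)

  act-enc : ∀ j t z → act t (enc (z , j)) ≡ enc (shift (turn j t) z , j)
  act-enc = Equivariant.act-enc A B C φ ι φ⁶ (Trihex.rev-involutive trihex) φι³ enc φ-enc ι-enc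

  shift-fixed : ∀ t z → shift t z ≡ z → M t
  shift-fixed t z eq = subst M (cong₂ _,_ (lemma (proj₁ (sec z)) (proj₁ t)) (lemma (proj₂ (sec z)) (proj₂ t)))
    (π-≡⁻¹ (trans (sym (shift-sec t z)) (trans eq (sym (π-sec z)))))
    where
    lemma : ∀ s t → s ℤ.+ t ℤ.- s ≡ t
    lemma = ℤ.solve-∀

  shift-fixed⁻¹ : ∀ t z → M t → shift t z ≡ z
  shift-fixed⁻¹ t z m = trans (shift-sec t z) (trans (π-≡ {sec z ⊕ t} {sec z}
    (subst M (sym (cong₂ _,_ (lemma (proj₁ (sec z)) (proj₁ t)) (lemma (proj₂ (sec z)) (proj₂ t)))) m)) (π-sec z))
    where
    lemma : ∀ s t → s ℤ.+ t ℤ.- s ≡ t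
    lemma = ℤ.solve-∀

  colour : Fin (N * 3) → Fin 3
  colour x = proj₂ (dec x)

  fixes⇒∈ : ∀ x t → Fixes x t → M (turn (colour x) t)
  fixes⇒∈ x t eq = shift-fixed (turn (colour x) t) (proj₁ (dec x)) (cong proj₁ (begin
    shift (turn (colour x) t) (proj₁ (dec x)) , colour x               ≡⟨ dec-enc _ ⟨
    dec (enc (shift (turn (colour x) t) (proj₁ (dec x)) , colour x))   ≡⟨ cong dec (act-enc (colour x) t (proj₁ (dec x))) ⟨
    dec (act t (enc (dec x)))                                        ≡⟨ cong (dec ∘ act t) (enc-dec x) ⟩
    dec (act t x)                                                    ≡⟨ cong dec eq ⟩
    dec x                                                            ∎))
    where open ≡-Reasoning

  ∈⇒fixes : ∀ x t → M (turn (colour x) t) → Fixes x t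
  ∈⇒fixes x t m = begin
    act t x                                                   ≡⟨ cong (act t) (enc-dec x) ⟨
    act t (enc (dec x))                                       ≡⟨ act-enc (colour x) t (proj₁ (dec x)) ⟩
    enc (shift (turn (colour x) t) (proj₁ (dec x)) , colour x)  ≡⟨ cong (λ z → enc (z , colour x)) (shift-fixed⁻¹ _ _ m) ⟩
    enc (dec x)                                               ≡⟨ enc-dec x ⟩
    x                                                         ∎
    where open ≡-Reasoning

  -- The stabiliser of a dart is 2 Λ turned into the frame of the dart. Hence Λ is visible in the
  -- action up to one of three turns.
  fixes-double : ∀ x t → Fixes x (t ⊕ t) ⇔ InLattice A B C (turn (colour x) t)
  fixes-double x t = mk⇔
    (λ p → double-∈⁻¹ {A} {B} {C} _ (subst M (Additive.f-⊕ (turn-additive (colour x)) t t) (fixes⇒∈ x (t ⊕ t) p)))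
    (λ l → ∈⇒fixes x (t ⊕ t) (subst M (sym (Additive.f-⊕ (turn-additive (colour x)) t t)) (double-∈ {A} {B} {C} _ l)))

  origin : Fin (N * 3)
  origin = enc (π 0ᴱ , 0F)

  fixes-origin : ∀ t → Fixes origin (t ⊕ t) ⇔ InLattice A B C t
  fixes-origin t = subst (λ j → Fixes origin (t ⊕ t) ⇔ InLattice A B C (turn j t)) (cong proj₂ (dec-enc (π 0ᴱ , 0F))) (fixes-double origin t)

  ∈? : ∀ t → Dec (InLattice A B C t)
  ∈? t = map′ (Equivalence.to (fixes-origin t)) (Equivalence.from (fixes-origin t)) (act (t ⊕ t) origin Fin.≟ origin)

Similar : (E → E) → (E → Set) → (E → Set) → Set
Similar g Λ Λ′ = ∀ t → Λ t ⇔ Λ′ (g t)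

-- An injective equivariant map carries the stabiliser of a point exactly to the stabiliser of its
-- image.
injective⇒similar : ∀ {X Y} (α : ℤ²Action X) (β : ℤ²Action Y) → let open ℤ²Action in (h : X → Y) → (∀ {x y} → h x ≡ h y → x ≡ y) →
  ∀ {g} → Additive g → (∀ t x → h (act α t x) ≡ act β (g t) (h x)) →
  ∀ x {Λ Λ′ : E → Set} → (∀ t → Fixes α x (t ⊕ t) ⇔ Λ t) → (∀ t → Fixes β (h x) (t ⊕ t) ⇔ Λ′ t) → Similar g Λ Λ′
injective⇒similar α β h h-injective {g} g-additive h-act x Λ⇔ Λ′⇔ t = mk⇔
  (λ l → Equivalence.to (Λ′⇔ (g t)) (subst (Fixes β (h x)) (f-⊕ t t)
    (trans (sym (h-act (t ⊕ t) x)) (cong h (Equivalence.from (Λ⇔ t) l)))))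
  (λ l → Equivalence.to (Λ⇔ t) (h-injective (trans (h-act (t ⊕ t) x)
    (subst (Fixes β (h x)) (sym (f-⊕ t t)) (Equivalence.from (Λ′⇔ (g t)) l)))))
  where
  open ℤ²Action
  open Additive g-additive

module SignedIsomorphism {v v′} {S : Trihex v} {T : Trihex v′} (i : DartIsomorphism S T) where
  private
    module S = TrihexAction S
    module T = TrihexAction T
  open DartIsomorphism i

  preserving⇒similar : (∀ x → f (S.ρ x) ≡ T.ρ (f x)) →
    ∀ x {Λ Λ′ : E → Set} → (∀ t → S.Fixes x (t ⊕ t) ⇔ Λ t) → (∀ t → T.Fixes (f x) (t ⊕ t) ⇔ Λ′ t) →
    Similar (λ t → t) Λ Λ′
  preserving⇒similar f-ρ =
    injective⇒similar S.action T.action f f-injective (record { f-0 = refl ; f-⊕ = λ _ _ → refl })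
      (HexMap.equivariant S.φ S.ι S.φ⁶ (Trihex.rev-involutive S) S.φι³ T.φ T.ι T.φ⁶ (Trihex.rev-involutive T) T.φι³
        f f-rev (λ x → trans (f-ρ (S.ι x)) (cong T.ρ (f-rev x))))

  -- A reflection carries the face of a dart to the other side of the image dart. Following `f` by
  -- the reversal repairs this: face walks then go to face walks run backwards, as
  -- `HexMap.reversing` requires.
  reversing⇒similar : (∀ x → f (S.ρ x) ≡ T.ρ (T.ρ (f x))) →
    ∀ x {Λ Λ′ : E → Set} → (∀ t → S.Fixes x (t ⊕ t) ⇔ Λ t) → (∀ t → T.Fixes (T.ι (f x)) (t ⊕ t) ⇔ Λ′ t) →
    Similar conj Λ Λ′
  reversing⇒similar f-ρ =
    injective⇒similar S.action T.action h (λ eq → f-injective (trans (sym (Trihex.rev-involutive T _))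
        (trans (cong T.ι eq) (Trihex.rev-involutive T _)))) conj-additive
      (HexMap.reversing S.φ S.ι S.φ⁶ (Trihex.rev-involutive S) S.φι³ T.φ T.ι T.φ⁶ (Trihex.rev-involutive T) T.φι³
        h (λ x → cong T.ι (f-rev x))
        (λ x → trans (cong T.ρ (trans (Trihex.rev-involutive T _) (f-ρ (S.ι x)))) (trans (T.ρ³ _) (f-rev x))))
    where
    h : Fin (Trihex.darts S) → Fin (Trihex.darts T)
    h x = T.ι (f x)

  open Graph (Trihex.graph S) using (Adjacent)

  private
    abstract
      sign : ∀ x → f (S.ρ x) ≡ T.ρ (f x) ⊎ f (S.ρ x) ≡ T.ρ (T.ρ (f x))
      sign x = bySize (Fibre.complete F (f (S.ρ x)) (f-src _ _ (sym (Equivalence.from (Trihex.rotation-cycles S x (S.ρ x)) (1 , refl)))))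
        where
        F : Fibre (Trihex.src T) (Trihex.src T (f x)) 3
        F = cycle-fibre {f = Trihex.src T} {π = T.ρ} T.ρ-injective (Trihex.rotation-cycles T) (T.ρ-period (f x))
        bySize : (∃ λ (i : Fin 3) → iterate T.ρ (f x) (toℕ i) ≡ f (S.ρ x)) →
                 f (S.ρ x) ≡ T.ρ (f x) ⊎ f (S.ρ x) ≡ T.ρ (T.ρ (f x))
        bySize (0F , eq) = contradiction (f-injective (sym eq)) (S.ρ-noFixpoint x)
        bySize (1F , eq) = inj₁ (sym eq)
        bySize (2F , eq) = inj₂ (sym eq)

  open Signs S.ρ S.ι T.ρ T.ι S.ρ³ S.ρ-noFixpoint T.ρ³ T.ρ-noFixpoint T.φ⁶ f f⁻¹ f∘f⁻¹ f⁻¹∘f f-rev sign public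

  sgn-constant : (∀ x → sgn (S.ι x) ≡ sgn (S.ι (ψ x))) → ∀ x y → sgn x ≡ sgn y
  sgn-constant agree x y = sym (along (Trihex.connected S (Trihex.src S x) (Trihex.src S y)) (λ z eq → around x z (sym eq)) y refl)
    where
    iterates : ∀ n x → sgn (iterate S.ρ x n) ≡ sgn x
    iterates zero    x = refl
    iterates (suc n) x = trans (iterates n (S.ρ x)) (sgn-ρ x)
    around : ∀ y z → Trihex.src S y ≡ Trihex.src S z → sgn z ≡ sgn y
    around y z eq = let n , p = Equivalence.to (Trihex.rotation-cycles S y z) eq in trans (cong sgn (sym p)) (iterates n y)
    along : ∀ {u u′} → Star Adjacent u u′ → (∀ z → Trihex.src S z ≡ u → sgn z ≡ sgn x) → ∀ z → Trihex.src S z ≡ u′ → sgn z ≡ sgn x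
    along ε                         c = c
    along ((y , y≡ , y′≡) ◅ path) c = along path λ z z≡ →
      trans (around (S.ι y) z (trans y′≡ (sym z≡))) (trans (sgn-ι agree y) (c y y≡))

  -- In both cases f extends to a homeomorphism of the sphere; in the second one it reverses the orientation.
  uniform : (∀ x → sgn (S.ι x) ≡ sgn (S.ι (ψ x))) → Fin (Trihex.darts S) →
            (∀ x → f (S.ρ x) ≡ T.ρ (f x)) ⊎ (∀ x → f (S.ρ x) ≡ T.ρ (T.ρ (f x)))
  uniform agree o = bySign (sgn o) refl
    where
    bySign : ∀ s → sgn o ≡ s →
             (∀ x → f (S.ρ x) ≡ T.ρ (f x)) ⊎ (∀ x → f (S.ρ x) ≡ T.ρ (T.ρ (f x)))
    bySign true  eq = inj₁ λ x → sgn-true x (trans (sgn-constant agree x o) eq)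
    bySign false eq = inj₂ λ x → sgn-false x (trans (sgn-constant agree x o) eq)

-- Isomorphic trihexes have similar sublattices

-- The symmetries of the hexagonal lattice, a dihedral group of order 12, modulo - 1, which
-- preserves every sublattice. This is the origin of the six.
Symmetry : Set
Symmetry = Fin 3 × Bool

apply : Symmetry → E → E
apply (j , false) t = turn j t
apply (j , true)  t = turn j (conj t)

inverse : Symmetry → Symmetry
inverse (j  , true)  = j , true
inverse (0F , false) = 0F , false
inverse (1F , false) = 2F , false
inverse (2F , false) = 1F , false

apply-inverse : ∀ s t → apply s (apply (inverse s) t) ≡ t
apply-inverse s (x , y) = go s
  where
  x1 : ∀ x y → ℤ.- (ℤ.- ((ℤ.- y) ℤ.+ (x ℤ.+ y))) ≡ x
  x1 = ℤ.solve-∀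
  y1 : ∀ x y → ℤ.- ((ℤ.- (x ℤ.+ y)) ℤ.+ ((ℤ.- y) ℤ.+ (x ℤ.+ y))) ≡ y
  y1 = ℤ.solve-∀
  x2 : ∀ x y → ℤ.- ((ℤ.- (ℤ.- y)) ℤ.+ (ℤ.- (x ℤ.+ y))) ≡ x
  x2 = ℤ.solve-∀
  y2 : ∀ x y → (ℤ.- (ℤ.- (x ℤ.+ y))) ℤ.+ ((ℤ.- (ℤ.- y)) ℤ.+ (ℤ.- (x ℤ.+ y))) ≡ y
  y2 = ℤ.solve-∀
  x0c : ∀ x y → (x ℤ.+ y) ℤ.+ (ℤ.- y) ≡ x
  x0c = ℤ.solve-∀
  y0c : ∀ x y → ℤ.- (ℤ.- y) ≡ y
  y0c = ℤ.solve-∀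
  x1c : ∀ x y → ℤ.- (ℤ.- (ℤ.- (ℤ.- ((x ℤ.+ y) ℤ.+ (ℤ.- y))))) ≡ x
  x1c = ℤ.solve-∀
  y1c : ∀ x y →
    ℤ.- (((ℤ.- (ℤ.- (ℤ.- y))) ℤ.+ (ℤ.- ((x ℤ.+ y) ℤ.+ (ℤ.- y)))) ℤ.+
    (ℤ.- (ℤ.- ((x ℤ.+ y) ℤ.+ (ℤ.- y))))) ≡ y
  y1c = ℤ.solve-∀
  x2c : ∀ x y →
    ℤ.- (((ℤ.- ((x ℤ.+ y) ℤ.+ (ℤ.- y))) ℤ.+ ((ℤ.- (ℤ.- y)) ℤ.+
    ((x ℤ.+ y) ℤ.+ (ℤ.- y)))) ℤ.+ (ℤ.- ((ℤ.- (ℤ.- y)) ℤ.+ ((x ℤ.+ y) ℤ.+ (ℤ.- y))))) ≡ x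
  x2c = ℤ.solve-∀
  y2c : ∀ x y →
    (ℤ.- (ℤ.- ((ℤ.- (ℤ.- y)) ℤ.+ ((x ℤ.+ y) ℤ.+ (ℤ.- y))))) ℤ.+
    (((ℤ.- ((x ℤ.+ y) ℤ.+ (ℤ.- y))) ℤ.+ ((ℤ.- (ℤ.- y)) ℤ.+ ((x ℤ.+ y) ℤ.+ (ℤ.- y)))) ℤ.+ (ℤ.- ((ℤ.- (ℤ.- y)) ℤ.+ ((x ℤ.+ y) ℤ.+ (ℤ.- y))))) ≡ y
  y2c = ℤ.solve-∀
  go : ∀ s → apply s (apply (inverse s) (x , y)) ≡ (x , y)
  go (0F , false) = refl
  go (1F , false) = cong₂ _,_ (x1 x y) (y1 x y)
  go (2F , false) = cong₂ _,_ (x2 x y) (y2 x y)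
  go (0F , true) = cong₂ _,_ (x0c x y) (y0c x y)
  go (1F , true) = cong₂ _,_ (x1c x y) (y1c x y)
  go (2F , true) = cong₂ _,_ (x2c x y) (y2c x y)

similar-inverse : ∀ s {Λ Λ′ : E → Set} → Similar (apply s) Λ′ Λ → Similar (apply (inverse s)) Λ Λ′
similar-inverse s {Λ} similar t = mk⇔
  (λ l → Equivalence.from (similar (apply (inverse s) t)) (subst Λ (sym (apply-inverse s t)) l))
  (λ l → subst Λ (apply-inverse s t) (Equivalence.to (similar (apply (inverse s) t)) l))

similar-functional : ∀ s {Λ Λ₁ Λ₂ : E → Set} → Similar (apply s) Λ Λ₁ → Similar (apply s) Λ Λ₂ → ∀ t → Λ₁ t → Λ₂ t
similar-functional s p q t l =
  Equivalence.from (similar-inverse s q t) (Equivalence.to (similar-inverse s p t) l)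

HasUnit : (E → Set) → Set
HasUnit Λ = ∃ λ k → Λ (w k)

module LatticeWalk (A B C : ℕ) .{{A≢0 : NonZero A}} .{{C≢0 : NonZero C}} {X : Set} (ρ ι : X → X)
  (enc : LatticeTrihex.Dart A B C → X) (enc-injective : ∀ {x y} → enc x ≡ enc y → x ≡ y)
  (ρ-enc : ∀ x → ρ (enc x) ≡ enc (LatticeTrihex.ρ A B C x))
  (ι-enc : ∀ x → ι (enc x) ≡ enc (LatticeTrihex.ι A B C x)) where
  private module L = LatticeTrihex A B C
  open L using (shift; flip; flip-flip; flip-shift; shift-shift; shift-0; M; M-even; neg-∈)
  open Walk ρ ι

  private
    ρι-enc : ∀ x → ρ (ι (enc x)) ≡ enc (L.φ x)
    ρι-enc x = trans (cong ρ (ι-enc x)) (trans (ρ-enc _) (cong enc (L.ρ-ι x)))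

    run-enc : ∀ {n} (ss : Vec Bool n) t j z → let t′ , j′ = symbolicRun ss t j in
              run ss (enc (shift t z , j)) ≡ enc (shift t′ (iterate flip z n) , j′)
    run-enc []           t j z = refl
    run-enc (true ∷ ss)  t j z = trans
      (cong (run ss) (trans (ρι-enc _) (cong (λ z → enc (z , next j)) (flip-shift t z))))
      (run-enc ss (neg t) (next j) (flip z))
    run-enc (false ∷ ss) t j z = trans
      (cong (run ss) (trans (cong ρ (trans (ρι-enc _) (cong (λ z → enc (z , next j)) (flip-shift t z))))
        (trans (ρ-enc _) (cong (λ z → enc (z , next (next j))) (shift-shift (w (next j)) (neg t) (flip z))))))
      (run-enc ss (neg t ⊕ w (next j)) (next (next j)) (flip z))

  -- Closing up forces the colour to return and t to lie in 2 Λ, hence to be even. The only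
  -- remaining exception would put twice a unit into 2 Λ, and so a unit into Λ.
  closed-walk : ¬ HasUnit (InLattice A B C) → ∀ (ss : Vec Bool 6) z j → run ss (enc (z , j)) ≡ enc (z , j) →
                Vec.lookup ss 0F ≡ Vec.lookup ss 1F
  closed-walk noUnit ss z j closed = decide (balanced ss j)
    where
    t = proj₁ (symbolicRun ss 0ᴱ j)
    i = proj₂ (symbolicRun ss 0ᴱ j)
    flip⁶ : iterate flip z 6 ≡ z
    flip⁶ = trans (flip-flip _) (trans (flip-flip _) (flip-flip z))
    end : (shift t z , i) ≡ (z , j)
    end = enc-injective (trans (cong (λ z → enc (shift t z , i)) (sym flip⁶))
      (trans (sym (run-enc ss 0ᴱ j z)) (trans (cong (λ z → run ss (enc (z , j))) (shift-0 z)) closed)))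
    t∈M : M t
    t∈M = LatticeAction.shift-fixed A B C t z (cong proj₁ end)
    unit : ∀ k → DoubledUnit t k → InLattice A B C (w k)
    unit k (inj₁ eq) = double-∈⁻¹ {A} {B} {C} (w k) (subst M eq t∈M)
    unit k (inj₂ eq) = double-∈⁻¹ {A} {B} {C} (w k) (subst M
      (trans (cong neg eq) (cong₂ _,_ (ℤₚ.neg-involutive (proj₁ (w k ⊕ w k))) (ℤₚ.neg-involutive (proj₂ (w k ⊕ w k))))) (neg-∈ t∈M))
    decide : Balanced ss j → Vec.lookup ss 0F ≡ Vec.lookup ss 1F
    decide (inj₁ eq) = eq
    decide (inj₂ (inj₁ i≢j)) = contradiction (cong proj₂ end) i≢j
    decide (inj₂ (inj₂ (inj₁ odd))) = let u , eq = M-even t∈M in ⊥-elim (odd-≢-double (proj₁ u) (subst Odd (cong proj₁ eq) odd))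
    decide (inj₂ (inj₂ (inj₂ (inj₁ odd)))) = let u , eq = M-even t∈M in ⊥-elim (odd-≢-double (proj₂ u) (subst Odd (cong proj₂ eq) odd))
    decide (inj₂ (inj₂ (inj₂ (inj₂ (k , d))))) = contradiction (k , unit k d) noUnit

-- The kernel of ℓ k contains w k, so a sublattice of index n containing w k is the preimage of n ℤ.
ℓ : Fin 3 → E → ℤ
ℓ 0F (x , y) = y
ℓ 1F (x , y) = x
ℓ 2F (x , y) = x ℤ.+ y

Multiple : ℕ → ℤ → Set
Multiple n x = ∃ λ q → x ≡ q ℤ.* + n

-- In Hermite form, (1 , 0) in Λ forces A = 1. Containing (0 , - 1) forces C = 1 and `A` to divide
-- `B`; containing (- 1 , 1) forces C = 1 and B = - 1 modulo `A`.
unit-lattice : ∀ A B C → 0 < C → ∀ k → InLattice A B C (w k) → ∀ t → InLattice A B C t ⇔ Multiple (A * C) (ℓ k t)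
unit-lattice A B C C>0 0F (a , b , x-eq , y-eq) (x , y) = go (∣1⇒≡1 A∣1)
  where
  b≡0 : b ≡ + 0
  b≡0 = [ (λ p → p) , (λ p → contradiction (sym (ℤₚ.+-injective p)) (ℕₚ.<⇒≢ C>0)) ]′ (ℤₚ.i*j≡0⇒i≡0∨j≡0 b (sym y-eq))
  A∣1 : A ∣ 1
  A∣1 = multiple⇒∣ a (trans x-eq (trans (cong (λ b → a ℤ.* + A ℤ.+ b ℤ.* + B) b≡0) (ℤₚ.+-identityʳ (a ℤ.* + A))))
  go : A ≡ 1 → InLattice A B C (x , y) ⇔ Multiple (A * C) y
  go refl = mk⇔ (λ (_ , b , _ , eq) → b , trans eq (cong (λ n → b ℤ.* + n) (sym (ℕₚ.*-identityˡ C))))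
    (λ (q , eq) → x ℤ.- q ℤ.* + B , q , lemma x (q ℤ.* + B) , trans eq (cong (λ n → q ℤ.* + n) (ℕₚ.*-identityˡ C)))
    where
    lemma : ∀ x t → x ≡ (x ℤ.- t) ℤ.* + 1 ℤ.+ t
    lemma = ℤ.solve-∀
unit-lattice A B C C>0 1F (a , b , x-eq , y-eq) (x , y) = go (∣1⇒≡1 (multiple⇒∣ (ℤ.- b) (trans (cong ℤ.-_ y-eq) (ℤₚ.neg-distribˡ-* b (+ C)))))
  where
  go : C ≡ 1 → InLattice A B C (x , y) ⇔ Multiple (A * C) x
  go refl = mk⇔
    (λ (a′ , b′ , eq , _) → a′ ℤ.+ b′ ℤ.* a , trans eq (trans (cong (λ B → a′ ℤ.* + A ℤ.+ b′ ℤ.* B) B≡)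
      (trans (collect a a′ b′ (+ A)) (cong (λ n → (a′ ℤ.+ b′ ℤ.* a) ℤ.* + n) (sym (ℕₚ.*-identityʳ A))))))
    (λ (q , eq) → q ℤ.- y ℤ.* a , y , trans eq (trans (cong (λ n → q ℤ.* + n) (ℕₚ.*-identityʳ A))
      (trans (spread q y a (+ A)) (cong (λ B → (q ℤ.- y ℤ.* a) ℤ.* + A ℤ.+ y ℤ.* B) (sym B≡)))) , sym (ℤₚ.*-identityʳ y))
    where
    b≡ : b ≡ -[1+ 0 ]
    b≡ = trans (sym (ℤₚ.*-identityʳ b)) (sym y-eq)
    B≡ : + B ≡ a ℤ.* + A
    B≡ = trans (trans (isolate a b (+ A) (+ B)) (cong (λ z → a ℤ.* + A ℤ.- z ℤ.- (b ℤ.+ + 1) ℤ.* (ℤ.- (+ B))) (sym x-eq)))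
      (trans (cong (λ b → a ℤ.* + A ℤ.- + 0 ℤ.- (b ℤ.+ + 1) ℤ.* (ℤ.- (+ B))) b≡) (finish (a ℤ.* + A) (+ B)))
      where
      isolate : ∀ a b A B → B ≡ a ℤ.* A ℤ.- (a ℤ.* A ℤ.+ b ℤ.* B) ℤ.- (b ℤ.+ + 1) ℤ.* (ℤ.- B)
      isolate = ℤ.solve-∀
      finish : ∀ s B → s ℤ.- + 0 ℤ.- (ℤ.- (+ 1) ℤ.+ + 1) ℤ.* (ℤ.- B) ≡ s
      finish = ℤ.solve-∀
    collect : ∀ a a′ b′ A → a′ ℤ.* A ℤ.+ b′ ℤ.* (a ℤ.* A) ≡ (a′ ℤ.+ b′ ℤ.* a) ℤ.* A
    collect = ℤ.solve-∀
    spread : ∀ q y a A → q ℤ.* A ≡ (q ℤ.- y ℤ.* a) ℤ.* A ℤ.+ y ℤ.* (a ℤ.* A)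
    spread = ℤ.solve-∀
unit-lattice A B C C>0 2F (a , b , x-eq , y-eq) (x , y) = go (∣1⇒≡1 (multiple⇒∣ b y-eq))
  where
  go : C ≡ 1 → InLattice A B C (x , y) ⇔ Multiple (A * C) (x ℤ.+ y)
  go refl = mk⇔
    (λ (a′ , b′ , eq , eq′) → a′ ℤ.- b′ ℤ.* a , trans (cong₂ ℤ._+_ eq (trans eq′ (ℤₚ.*-identityʳ b′)))
      (trans (cong (λ B → a′ ℤ.* + A ℤ.+ b′ ℤ.* B ℤ.+ b′) B≡)
      (trans (collect a a′ b′ (+ A)) (cong (λ n → (a′ ℤ.- b′ ℤ.* a) ℤ.* + n) (sym (ℕₚ.*-identityʳ A))))))
    (λ (q , eq) → q ℤ.+ y ℤ.* a , y , trans (split x y) (trans (cong (ℤ._- y) (trans eq (cong (λ n → q ℤ.* + n) (ℕₚ.*-identityʳ A))))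
      (trans (spread q y a (+ A)) (cong (λ B → (q ℤ.+ y ℤ.* a) ℤ.* + A ℤ.+ y ℤ.* B) (sym B≡)))) , sym (ℤₚ.*-identityʳ y))
    where
    b≡ : b ≡ + 1
    b≡ = trans (sym (ℤₚ.*-identityʳ b)) (sym y-eq)
    B≡ : + B ≡ ℤ.- (+ 1) ℤ.- a ℤ.* + A
    B≡ = trans (isolate (a ℤ.* + A) (+ B)) (cong (ℤ._- a ℤ.* + A)
      (trans (cong (λ b → a ℤ.* + A ℤ.+ b ℤ.* + B) (sym b≡)) (sym x-eq)))
      where
      isolate : ∀ s B → B ≡ (s ℤ.+ + 1 ℤ.* B) ℤ.- s
      isolate = ℤ.solve-∀
    split : ∀ x y → x ≡ x ℤ.+ y ℤ.- y
    split = ℤ.solve-∀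
    collect : ∀ a a′ b′ A → a′ ℤ.* A ℤ.+ b′ ℤ.* (ℤ.- (+ 1) ℤ.- a ℤ.* A) ℤ.+ b′ ≡ (a′ ℤ.- b′ ℤ.* a) ℤ.* A
    collect = ℤ.solve-∀
    spread : ∀ q y a A → q ℤ.* A ℤ.- y ≡ (q ℤ.+ y ℤ.* a) ℤ.* A ℤ.+ y ℤ.* (ℤ.- (+ 1) ℤ.- a ℤ.* A)
    spread = ℤ.solve-∀

multiple-neg : ∀ {n x y} → y ≡ ℤ.- x → Multiple n x → Multiple n y
multiple-neg {n} refl (q , refl) = ℤ.- q , ℤₚ.neg-distribˡ-* q (+ n)

-- Multiplication by powers of ω permutes the three lines spanned by units, hence the three
-- functionals up to sign, and a sign does not affect divisibility.
turn-ℓ : ∀ n k k′ → ∃ λ j → ∀ t → Multiple n (ℓ k t) ⇔ Multiple n (ℓ k′ (turn j t))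
turn-ℓ n = go
  where
  same : ∀ {n x y} → y ≡ x → Multiple n x ⇔ Multiple n y
  same refl = mk⇔ (λ m → m) (λ m → m)
  opposite : ∀ {n x y} → y ≡ ℤ.- x → Multiple n x ⇔ Multiple n y
  opposite {x = x} refl = mk⇔ (multiple-neg refl) (multiple-neg (sym (ℤₚ.neg-involutive x)))
  eq01 : ∀ x y → ℤ.- (ℤ.- y) ≡ y
  eq01 = ℤ.solve-∀
  eq02 : ∀ x y → (ℤ.- (x ℤ.+ y)) ℤ.+ ((ℤ.- y) ℤ.+ (x ℤ.+ y)) ≡ ℤ.- y
  eq02 = ℤ.solve-∀
  eq10 : ∀ x y → (ℤ.- y) ℤ.+ (x ℤ.+ y) ≡ x
  eq10 = ℤ.solve-∀
  eq12 : ∀ x y → (ℤ.- (ℤ.- y)) ℤ.+ (ℤ.- (x ℤ.+ y)) ≡ ℤ.- x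
  eq12 = ℤ.solve-∀
  eq20 : ∀ x y → ℤ.- (x ℤ.+ y) ≡ ℤ.- (x ℤ.+ y)
  eq20 = ℤ.solve-∀
  eq21 : ∀ x y → ℤ.- (x ℤ.+ y) ≡ ℤ.- (x ℤ.+ y)
  eq21 = ℤ.solve-∀
  go : ∀ k k′ → ∃ λ j → ∀ t → Multiple n (ℓ k t) ⇔ Multiple n (ℓ k′ (turn j t))
  go 0F 0F = 0F , λ _ → same refl
  go 0F 1F = 1F , λ (x , y) → same (eq01 x y)
  go 0F 2F = 2F , λ (x , y) → opposite (eq02 x y)
  go 1F 0F = 2F , λ (x , y) → same (eq10 x y)
  go 1F 1F = 0F , λ _ → same refl
  go 1F 2F = 1F , λ (x , y) → opposite (eq12 x y)
  go 2F 0F = 1F , λ (x , y) → opposite (eq20 x y)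
  go 2F 1F = 2F , λ (x , y) → opposite (eq21 x y)
  go 2F 2F = 0F , λ _ → same refl

module _ (A B C : ℕ) .{{A≢0 : NonZero A}} .{{C≢0 : NonZero C}} {v} {T : Trihex v}
         (i : DartIsomorphism (LatticeTrihex.trihex A B C) T) where
  private
    module L = LatticeAction A B C
    module T = TrihexAction T
    open LatticeTrihex A B C using (trihex; enc; dec; dec-enc; enc-dec)
    module S = TrihexAction trihex
    open DartIsomorphism i using (f)
    open SignedIsomorphism i

    enc-injective : ∀ {x y} → enc x ≡ enc y → x ≡ y
    enc-injective eq = trans (sym (dec-enc _)) (trans (cong dec eq) (dec-enc _))

    closed : ∀ x → run (signs 6 x) (enc (dec x)) ≡ enc (dec x)
    closed x = trans (cong (run (signs 6 x)) (enc-dec x)) (trans (run-signs 6 x) (trans (ψ⁶ x) (sym (enc-dec x))))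

    agree : ¬ HasUnit (InLattice A B C) → ∀ x → sgn (S.ι x) ≡ sgn (S.ι (ψ x))
    agree noUnit x = LatticeWalk.closed-walk A B C S.ρ S.ι enc enc-injective L.ρ-enc L.ι-enc noUnit
      (signs 6 x) (proj₁ (dec x)) (proj₂ (dec x)) (closed x)

  -- The image of the origin dart may have any colour, so the lattice read off there is one of three
  -- candidates; the power of ω in the final symmetry comes from this choice.
  noUnit⇒similar : ∀ {Λ : Fin 3 → E → Set} → ¬ HasUnit (InLattice A B C) → (colour : Fin (Trihex.darts T) → Fin 3) →
    (∀ y t → T.Fixes y (t ⊕ t) ⇔ Λ (colour y) t) →
    ∃ λ j → Similar (λ t → t) (InLattice A B C) (Λ j) ⊎ Similar conj (InLattice A B C) (Λ j)
  noUnit⇒similar noUnit colour Λ⇔ =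
    [ (λ p → colour (f L.origin) , inj₁ (preserving⇒similar p L.origin L.fixes-origin (Λ⇔ (f L.origin))))
    , (λ p → colour (T.ι (f L.origin)) , inj₂ (reversing⇒similar p L.origin L.fixes-origin (Λ⇔ (T.ι (f L.origin)))))
    ]′ (uniform (agree noUnit) L.origin)

  preserving⇒similar-colour : ∀ {Λ : Fin 3 → E → Set} → DartIsomorphism.RotationPreserving i →
    (colour : Fin (Trihex.darts T) → Fin 3) → (∀ y t → T.Fixes y (t ⊕ t) ⇔ Λ (colour y) t) →
    ∃ λ j → Similar (λ t → t) (InLattice A B C) (Λ j)
  preserving⇒similar-colour p colour Λ⇔ =
    colour (f L.origin) , preserving⇒similar p L.origin L.fixes-origin (Λ⇔ (f L.origin))

module _ (A B C A′ B′ C′ : ℕ) .{{A≢0 : NonZero A}} .{{C≢0 : NonZero C}} .{{A′≢0 : NonZero A′}} .{{C′≢0 : NonZero C′}}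
         {v : ℕ} (p : (A + A) * (C + C) ≡ v) (q : (A′ + A′) * (C′ + C′) ≡ v) where
  private
    module L′ = LatticeAction A′ B′ C′

    Λ′ : Fin 3 → E → Set
    Λ′ j t = InLattice A′ B′ C′ (turn j t)

  equivalent-lattices : Equivalent (subst Trihex p (LatticeTrihex.trihex A B C))
                        (subst Trihex q (LatticeTrihex.trihex A′ B′ C′)) →
                        ∃ λ j → Similar (turn j) (InLattice A B C) (InLattice A′ B′ C′)
  equivalent-lattices e = preserving⇒similar-colour A B C {T = LatticeTrihex.trihex A′ B′ C′} (proj₁ i) {Λ′} (proj₂ i) L′.colour L′.fixes-double
    where
    i : Σ (DartIsomorphism (LatticeTrihex.trihex A B C) (LatticeTrihex.trihex A′ B′ C′)) DartIsomorphism.RotationPreserving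
    i = equivalent⇒rotationPreserving p q {LatticeTrihex.trihex A B C} {LatticeTrihex.trihex A′ B′ C′} e

  isomorphic-lattices : ¬ HasUnit (InLattice A B C) → Isomorphic (subst Trihex p (LatticeTrihex.trihex A B C))
                        (subst Trihex q (LatticeTrihex.trihex A′ B′ C′)) →
                        ∃ λ s → Similar (apply s) (InLattice A B C) (InLattice A′ B′ C′)
  isomorphic-lattices noUnit i = symmetry (noUnit⇒similar A B C {T = LatticeTrihex.trihex A′ B′ C′}
    (isomorphic⇒dartIsomorphism p q {LatticeTrihex.trihex A B C} {LatticeTrihex.trihex A′ B′ C′} i) {Λ′} noUnit L′.colour L′.fixes-double)
    where
    symmetry : (∃ λ j → Similar (λ t → t) (InLattice A B C) (Λ′ j) ⊎ Similar conj (InLattice A B C) (Λ′ j)) →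
               ∃ λ s → Similar (apply s) (InLattice A B C) (InLattice A′ B′ C′)
    symmetry (j , inj₁ p) = (j , false) , p
    symmetry (j , inj₂ p) = (j , true) , p

module _ {v : ℕ} where
  open LatticeData

  equivalent⇒similar : ∀ (d d′ : LatticeData v) → Equivalent (toTrihex d) (toTrihex d′) → ∃ λ j → Similar (turn j) (Λ d) (Λ d′)
  equivalent⇒similar d d′ = equivalent-lattices (A d) (B d) (C d) (A d′) (B d′) (C d′)
    {{>-nonZero (A>0 d)}} {{>-nonZero (C>0 d)}} {{>-nonZero (A>0 d′)}} {{>-nonZero (C>0 d′)}} (size d) (size d′)

  index-unique : ∀ (d d′ : LatticeData v) → A d * C d ≡ A d′ * C d′
  index-unique d d′ = ℕₚ.*-cancelˡ-≡ (A d * C d) (A d′ * C d′) 4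
    (trans (four (A d) (C d)) (trans (trans (size d) (sym (size d′))) (sym (four (A d′) (C d′)))))
    where
    four : ∀ a c → 4 * (a * c) ≡ (a + a) * (c + c)
    four = ℕ.solve-∀

  private
    hasUnit? : ∀ (d : LatticeData v) → Dec (HasUnit (Λ d))
    hasUnit? d = Finₚ.any? λ k →
      LatticeAction.∈? (A d) (B d) (C d) {{>-nonZero (A>0 d)}} {{>-nonZero (C>0 d)}} (w k)

    noUnit⇒ : ∀ (d d′ : LatticeData v) → ¬ HasUnit (Λ d) → Isomorphic (toTrihex d) (toTrihex d′) → ∃ λ s → Similar (apply s) (Λ d) (Λ d′)
    noUnit⇒ d d′ = isomorphic-lattices (A d) (B d) (C d) (A d′) (B d′) (C d′)
      {{>-nonZero (A>0 d)}} {{>-nonZero (C>0 d)}} {{>-nonZero (A>0 d′)}} {{>-nonZero (C>0 d′)}} (size d) (size d′)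

    unit⇒ : ∀ (d d′ : LatticeData v) → HasUnit (Λ d) → HasUnit (Λ d′) → ∃ λ s → Similar (apply s) (Λ d) (Λ d′)
    unit⇒ d d′ (k , u) (k′ , u′) = let j , p = turn-ℓ (A d * C d) k k′ in (j , false) , λ t → mk⇔
      (λ l → Equivalence.from (unit-lattice (A d′) (B d′) (C d′) (C>0 d′) k′ u′ (turn j t))
        (subst (λ n → Multiple n (ℓ k′ (turn j t))) (index-unique d d′)
          (Equivalence.to (p t) (Equivalence.to (unit-lattice (A d) (B d) (C d) (C>0 d) k u t) l))))
      (λ l → Equivalence.from (unit-lattice (A d) (B d) (C d) (C>0 d) k u t)
        (Equivalence.from (p t) (subst (λ n → Multiple n (ℓ k′ (turn j t))) (sym (index-unique d d′))
          (Equivalence.to (unit-lattice (A d′) (B d′) (C d′) (C>0 d′) k′ u′ (turn j t)) l))))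

  isomorphic⇒similar : ∀ (d d′ : LatticeData v) → Isomorphic (toTrihex d) (toTrihex d′) → ∃ λ s → Similar (apply s) (Λ d) (Λ d′)
  isomorphic⇒similar d d′ i = byUnits (hasUnit? d) (hasUnit? d′)
    where
    byUnits : Dec (HasUnit (Λ d)) → Dec (HasUnit (Λ d′)) → ∃ λ s → Similar (apply s) (Λ d) (Λ d′)
    byUnits (no ¬u) _        = noUnit⇒ d d′ ¬u i
    byUnits (yes u) (yes u′) = unit⇒ d d′ u u′
    -- The walk argument applies to a source lattice without units, so the isomorphism is inverted.
    byUnits (yes _) (no ¬u′) = let s , p = noUnit⇒ d′ d ¬u′ (Setoid.sym (trihexesUpToIsomorphism v) {toTrihex d} {toTrihex d′} i) in
      inverse s , similar-inverse s {Λ d} {Λ d′} p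

-- The sum of divisors

-- An index below the sum encodes a pair (a , b) with a in `ds` and b < a. If `ds` lists the
-- divisors of n, these are the Hermite forms of index n, the third entry being n / a.
decode : ∀ ds → Fin (sum ds) → ℕ × ℕ
decode (d ∷ ds) i = [ (λ b → d , toℕ b) , decode ds ]′ (Fin.splitAt d i)

decode-sound : ∀ ds i → proj₁ (decode ds i) ∈ ds × proj₂ (decode ds i) < proj₁ (decode ds i)
decode-sound (d ∷ ds) i with Fin.splitAt d i
... | inj₁ b = here refl , Finₚ.toℕ<n b
... | inj₂ j = let d∈ , b< = decode-sound ds j in there d∈ , b<

decode-complete : ∀ ds {a b} → a ∈ ds → b < a → ∃ λ i → decode ds i ≡ (a , b)
decode-complete (d ∷ ds) {b = b} (here refl) b<a = fromℕ< b<a Fin.↑ˡ sum ds ,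
  trans (cong [ (λ b → d , toℕ b) , decode ds ]′ (Finₚ.splitAt-↑ˡ d (fromℕ< b<a) (sum ds)))
    (cong (d ,_) (Finₚ.toℕ-fromℕ< b<a))
decode-complete (d ∷ ds) (there a∈) b<a = let i , eq = decode-complete ds a∈ b<a in
  d Fin.↑ʳ i , trans (cong [ (λ b → d , toℕ b) , decode ds ]′ (Finₚ.splitAt-↑ʳ d (sum ds) i)) eq

decode-injective : ∀ {ds} → Unique ds → ∀ i j → decode ds i ≡ decode ds j → i ≡ j
decode-injective {d ∷ ds} (d∉ ∷ unique) i j eq = trans (sym (Finₚ.join-splitAt d (sum ds) i))
  (trans (cong (Fin.join d (sum ds)) (split (Fin.splitAt d i) (Fin.splitAt d j) eq)) (Finₚ.join-splitAt d (sum ds) j))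
  where
  pair : Fin d ⊎ Fin (sum ds) → ℕ × ℕ
  pair = [ (λ b → d , toℕ b) , decode ds ]′
  split : ∀ x y → pair x ≡ pair y → x ≡ y
  split (inj₁ a) (inj₁ b) eq = cong inj₁ (Finₚ.toℕ-injective (cong proj₂ eq))
  split (inj₁ a) (inj₂ b) eq = contradiction (cong proj₁ eq) (All.lookup d∉ (proj₁ (decode-sound ds b)))
  split (inj₂ a) (inj₁ b) eq = contradiction (sym (cong proj₁ eq)) (All.lookup d∉ (proj₁ (decode-sound ds a)))
  split (inj₂ a) (inj₂ b) eq = cong inj₂ (decode-injective unique a b eq)

sum-map-* : ∀ c ds → sum (map (c *_) ds) ≡ c * sum ds
sum-map-* c []       = sym (ℕₚ.*-zeroʳ c)
sum-map-* c (d ∷ ds) = trans (cong (λ s → c * d + s) (sum-map-* c ds)) (sym (ℕₚ.*-distribˡ-+ c d (sum ds)))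

-- 1 + p + ⋯ + pᵐ in Horner form, which postpones the division by p - 1.
geometric : ℕ → ℕ → ℕ
geometric p zero    = 1
geometric p (suc m) = 1 + p * geometric p m

geometric-closed : ∀ q m → suc q ^ (m + 1) ∸ 1 ≡ geometric (suc q) m * q
geometric-closed q m = cong (_∸ 1) (power m)
  where
  power : ∀ m → suc q ^ (m + 1) ≡ suc (geometric (suc q) m * q)
  power zero    = trans (ℕₚ.*-identityʳ (suc q)) (cong suc (sym (ℕₚ.+-identityʳ q)))
  power (suc m) = trans (cong (suc q *_) (power m)) (lemma q (geometric (suc q) m))
    where
    lemma : ∀ q g → suc q * suc (g * q) ≡ suc ((1 + suc q * g) * q)
    lemma = ℕ.solve-∀

record DivisorList (n : ℕ) (ds : List ℕ) : Set where
  field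
    unique   : Unique ds
    sound    : ∀ {d} → d ∈ ds → d ∣ n
    complete : ∀ {d} → d ∣ n → d ∈ ds

-- If `ds` lists the divisors of r and the prime p does not divide r, the divisors of pᵐ r are those
-- prime to p, which are in `ds`, followed by p times the divisors of pᵐ⁻¹ r.
divisors : ℕ → ℕ → List ℕ → List ℕ
divisors p zero    ds = ds
divisors p (suc m) ds = ds ++ map (p *_) (divisors p m ds)

sum-divisors : ∀ p m ds → sum (divisors p m ds) ≡ geometric p m * sum ds
sum-divisors p zero    ds = sym (ℕₚ.*-identityˡ (sum ds))
sum-divisors p (suc m) ds = begin
  sum (ds ++ map (p *_) (divisors p m ds))          ≡⟨ sum-++ ds _ ⟩
  sum ds + sum (map (p *_) (divisors p m ds))       ≡⟨ cong (λ s → sum ds + s) (sum-map-* p (divisors p m ds)) ⟩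
  sum ds + p * sum (divisors p m ds)                ≡⟨ cong (λ s → sum ds + p * s) (sum-divisors p m ds) ⟩
  sum ds + p * (geometric p m * sum ds)             ≡⟨ cong (λ s → sum ds + s) (ℕₚ.*-assoc p (geometric p m) (sum ds)) ⟨
  (1 + p * geometric p m) * sum ds                  ∎
  where open ≡-Reasoning

prime∤⇒coprime : ∀ {p d} → Prime p → ¬ p ∣ d → Coprime d p
prime∤⇒coprime pr p∤d (c∣d , c∣p) with prime⇒irreducible pr c∣p
... | inj₁ c≡1  = c≡1
... | inj₂ refl = contradiction c∣d p∤d

-- A number not divisible by the prime p is coprime to p, so the factors p can be cancelled one at a
-- time.
prime∤-divisor : ∀ {p d} m {r} → Prime p → ¬ p ∣ d → d ∣ p ^ m * r → d ∣ r
prime∤-divisor zero        pr p∤d d∣ = subst (_ ∣_) (ℕₚ.*-identityˡ _) d∣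
prime∤-divisor {p} {d} (suc m) pr p∤d d∣ = prime∤-divisor m pr p∤d
  (coprime-divisor (prime∤⇒coprime pr p∤d) (subst (d ∣_) (ℕₚ.*-assoc p (p ^ m) _) d∣))

divisorList : ∀ {p r ds} m → Prime p → ¬ p ∣ r → DivisorList r ds → DivisorList (p ^ m * r) (divisors p m ds)
divisorList {r = r} {ds} zero pr p∤r D = subst (λ n → DivisorList n ds) (sym (ℕₚ.*-identityˡ r)) D
divisorList {p} {r} {ds} (suc m) pr p∤r D = record
  { unique   = Unique.++⁺ D.unique (Unique.map⁺ (ℕₚ.*-cancelˡ-≡ _ _ p) D′.unique) disjoint
  ; sound    = λ d∈ → [ (λ d∈ds → ∣n⇒∣m*n (p ^ suc m) (D.sound d∈ds)) , multiple ]′ (∈-++⁻ ds d∈)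
  ; complete = complete
  }
  where
  module D = DivisorList D
  module D′ = DivisorList (divisorList m pr p∤r D)
  instance _ = prime⇒nonZero pr
  assoc : p ^ suc m * r ≡ p * (p ^ m * r)
  assoc = ℕₚ.*-assoc p (p ^ m) r
  disjoint : ∀ {x} → ¬ (x ∈ ds × x ∈ map (p *_) (divisors p m ds))
  disjoint (x∈ , x∈′) = let y , _ , x≡ = ∈-map⁻ (p *_) x∈′ in
    p∤r (∣-trans (subst (p ∣_) (sym x≡) (m∣m*n y)) (D.sound x∈))
  multiple : ∀ {d} → d ∈ map (p *_) (divisors p m ds) → d ∣ p ^ suc m * r
  multiple d∈ = let y , y∈ , d≡ = ∈-map⁻ (p *_) d∈ in
    subst₂ _∣_ (sym d≡) (sym assoc) (*-monoʳ-∣ p (D′.sound y∈))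
  complete : ∀ {d} → d ∣ p ^ suc m * r → d ∈ divisors p (suc m) ds
  complete {d} d∣ with p ∣? d
  ... | no p∤d = ∈-++⁺ˡ (D.complete (prime∤-divisor (suc m) pr p∤d d∣))
  ... | yes (divides q d≡) = ∈-++⁺ʳ ds (subst (_∈ map (p *_) (divisors p m ds)) (sym d≡′)
      (∈-map⁺ (p *_) (D′.complete (*-cancelˡ-∣ p (subst₂ _∣_ d≡′ assoc d∣)))))
    where
    d≡′ : d ≡ p * q
    d≡′ = trans d≡ (ℕₚ.*-comm q p)

prime∣power : ∀ {p q} m → Prime p → Prime q → p ∣ q ^ m → p ≡ q
prime∣power {p} zero prime-p prime-q p∣1 =
  contradiction (∣1⇒≡1 p∣1) (λ { refl → case prime⇒nonTrivial prime-p of λ () })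
prime∣power {p} {q} (suc m) prime-p prime-q p∣ with euclidsLemma q (q ^ m) prime-p p∣
... | inj₂ p∣qᵐ = prime∣power m prime-p prime-q p∣qᵐ
... | inj₁ p∣q with prime⇒irreducible prime-q p∣q
...   | inj₁ refl = case prime⇒nonTrivial prime-p of λ ()
...   | inj₂ p≡q  = p≡q

prime∣product : ∀ {q} k (p m : Fin k → ℕ) → Prime q → (∀ i → Prime (p i)) →
                q ∣ foldr _*_ 1 (λ i → p i ^ m i) → ∃ λ i → q ≡ p i
prime∣product zero p m prime-q prime-p q∣1 with refl ← ∣1⇒≡1 q∣1 = case prime⇒nonTrivial prime-q of λ ()
prime∣product (suc k) p m prime-q prime-p q∣ with euclidsLemma (p zero ^ m zero) _ prime-q q∣
... | inj₁ q∣p₀ = zero , prime∣power (m zero) prime-q (prime-p zero) q∣p₀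
... | inj₂ q∣ps = let i , eq = prime∣product k (p ∘ suc) (m ∘ suc) prime-q (prime-p ∘ suc) q∣ps in suc i , eq

divisorsOf : ∀ k (p m : Fin k → ℕ) → List ℕ
divisorsOf zero    p m = 1 ∷ []
divisorsOf (suc k) p m = divisors (p zero) (m zero) (divisorsOf k (p ∘ suc) (m ∘ suc))

divisorsOf-list : ∀ k (p m : Fin k → ℕ) → (∀ i → Prime (p i)) → (∀ {i j} → p i ≡ p j → i ≡ j) →
                  DivisorList (foldr _*_ 1 (λ i → p i ^ m i)) (divisorsOf k p m)
divisorsOf-list zero p m pr distinct = record
  { unique = All.[] ∷ [] ; sound = λ { (here refl) → ∣-refl } ; complete = λ d∣1 → here (∣1⇒≡1 d∣1) }
divisorsOf-list (suc k) p m pr distinct = divisorList (m zero) (pr zero)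
  (λ p₀∣ → let i , eq = prime∣product k (p ∘ suc) (m ∘ suc) (pr zero) (pr ∘ suc) p₀∣ in case distinct eq of λ ())
  (divisorsOf-list k (p ∘ suc) (m ∘ suc) (pr ∘ suc) λ eq → Finₚ.suc-injective (distinct eq))

sum-divisorsOf : ∀ k (p m : Fin k → ℕ) → sum (divisorsOf k p m) ≡ foldr _*_ 1 (λ i → geometric (p i) (m i))
sum-divisorsOf zero    p m = refl
sum-divisorsOf (suc k) p m = trans (sum-divisors (p zero) (m zero) _)
  (cong (geometric (p zero) (m zero) *_) (sum-divisorsOf k (p ∘ suc) (m ∘ suc)))

-- The divisor product as a rational number

fromℕ-* : ∀ m n → fromℕ (m * n) ≡ fromℕ m ℚ.* fromℕ n
fromℕ-* m n = ℚₚ.toℚᵘ-injective (begin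
  ℚ.toℚᵘ (fromℕ (m * n))                      ≈⟨ ℚₚ.toℚᵘ-fromℚᵘ (mkℚᵘ (+ (m * n)) 0) ⟩
  mkℚᵘ (+ (m * n)) 0                          ≈⟨ *≡* (cong (ℤ._* + 1) (ℤₚ.pos-* m n)) ⟩
  mkℚᵘ (+ m) 0 ℚᵘ.* mkℚᵘ (+ n) 0              ≈⟨ ℚᵘₚ.*-cong (ℚₚ.toℚᵘ-fromℚᵘ (mkℚᵘ (+ m) 0)) (ℚₚ.toℚᵘ-fromℚᵘ (mkℚᵘ (+ n) 0)) ⟨
  ℚ.toℚᵘ (fromℕ m) ℚᵘ.* ℚ.toℚᵘ (fromℕ n)      ≈⟨ ℚₚ.toℚᵘ-homo-* (fromℕ m) (fromℕ n) ⟨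
  ℚ.toℚᵘ (fromℕ m ℚ.* fromℕ n)                ∎)
  where open ℚᵘₚ.≃-Reasoning

fromℕ-mono-≤ : ∀ {m n} → m ≤ n → fromℕ m ℚ.≤ fromℕ n
fromℕ-mono-≤ {m} {n} m≤n = ℚₚ.toℚᵘ-cancel-≤ (begin
  ℚ.toℚᵘ (fromℕ m)   ≃⟨ ℚₚ.toℚᵘ-fromℚᵘ (mkℚᵘ (+ m) 0) ⟩
  mkℚᵘ (+ m) 0       ≤⟨ ℚᵘ.*≤* (ℤₚ.*-monoʳ-≤-nonNeg (+ 1) (ℤ.+≤+ m≤n)) ⟩
  mkℚᵘ (+ n) 0       ≃⟨ ℚₚ.toℚᵘ-fromℚᵘ (mkℚᵘ (+ n) 0) ⟨
  ℚ.toℚᵘ (fromℕ n)   ∎)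
  where open ℚᵘₚ.≤-Reasoning

exact-quotient : ∀ a q .{{_ : NonZero q}} g → a ≡ g * q → (+ a) ℚ./ q ≡ fromℕ g
exact-quotient a (suc q) g a≡ = ℚₚ.fromℚᵘ-cong {mkℚᵘ (+ a) q} {mkℚᵘ (+ g) 0}
  (*≡* (trans (ℤₚ.*-identityʳ (+ a)) (trans (cong +_ a≡) (ℤₚ.pos-* g (suc q)))))

foldr-fromℕ : ∀ k (f : Fin k → ℚ) (g : Fin k → ℕ) → (∀ i → f i ≡ fromℕ (g i)) →
              foldr ℚ._*_ ℚ.1ℚ f ≡ fromℕ (foldr _*_ 1 g)
foldr-fromℕ zero    f g eq = refl
foldr-fromℕ (suc k) f g eq = trans (cong₂ ℚ._*_ (eq zero) (foldr-fromℕ k (f ∘ suc) (g ∘ suc) (eq ∘ suc)))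
  (sym (fromℕ-* (g zero) _))

module _ {n} (F : PrimePowerFactorisation n) where
  open PrimePowerFactorisation F

  divisorsF : List ℕ
  divisorsF = divisorsOf k p m

  divisorsF-list : DivisorList n divisorsF
  divisorsF-list = subst (λ n → DivisorList n divisorsF) product (divisorsOf-list k p m p-prime p-distinct)

  divisorProduct-sum : divisorProduct F ≡ fromℕ (sum divisorsF)
  divisorProduct-sum = trans (foldr-fromℕ k _ (λ i → geometric (p i) (m i)) λ i → factor (p i) (m i) {{pred-nonZero (p-prime i)}})
    (cong fromℕ (sym (sum-divisorsOf k p m)))
    where
    factor : ∀ p m .{{_ : NonZero (p ∸ 1)}} → (+ (p ^ (m + 1) ∸ 1)) ℚ./ (p ∸ 1) ≡ fromℕ (geometric p m)
    factor (suc q) m = exact-quotient (suc q ^ (m + 1) ∸ 1) q (geometric (suc q) m) (geometric-closed q m)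

-- Counting

latticeData-≡ : ∀ {v} (d d′ : LatticeData v) → let open LatticeData in A d ≡ A d′ → B d ≡ B d′ → C d ≡ C d′ → d ≡ d′
latticeData-≡ record { A>0 = a ; B<A = b ; C>0 = c ; size = s } record { A>0 = a′ ; B<A = b′ ; C>0 = c′ ; size = s′ } refl refl refl
  with refl ← ℕₚ.<-irrelevant a a′ | refl ← ℕₚ.<-irrelevant b b′ | refl ← ℕₚ.<-irrelevant c c′ | refl ← ℕₚ.≡-irrelevant s s′ = refl

similar⇒≡ : ∀ {v} (d₁ d₂ : LatticeData v) → let open LatticeData in
            (∀ t → Λ d₁ t → Λ d₂ t) → (∀ t → Λ d₂ t → Λ d₁ t) → A d₁ ≡ A d₂ × B d₁ ≡ B d₂ × C d₁ ≡ C d₂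
similar⇒≡ d₁ d₂ to from = hermiteForm-unique {LatticeData.Λ d₁}
  (record { A = A d₁ ; B = B d₁ ; C = C d₁ ; A>0 = A>0 d₁ ; B<A = B<A d₁ ; C>0 = C>0 d₁ ; ∈-⇒ = λ _ l → l ; ∈-⇐ = λ _ l → l })
  (record { A = A d₂ ; B = B d₂ ; C = C d₂ ; A>0 = A>0 d₂ ; B<A = B<A d₂ ; C>0 = C>0 d₂ ; ∈-⇒ = to ; ∈-⇐ = from })
  where open LatticeData

module Enumeration (n : ℕ) (n>0 : 0 < n) (ds : List ℕ) (D : DivisorList n ds) (v : ℕ) (v≡ : 4 * n ≡ v) where
  private
    module D = DivisorList D

    four : ∀ a c → (a + a) * (c + c) ≡ 4 * (c * a)
    four = ℕ.solve-∀

    positive : ∀ c a → 0 < c * a → 0 < a × 0 < c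
    positive zero    a       ()
    positive (suc c) zero    0<0 = contradiction (subst (0 <_) (ℕₚ.*-zeroʳ c) 0<0) λ ()
    positive (suc c) (suc a) _   = z<s , z<s

    fromPair : ∀ a b → a ∣ n → b < a → LatticeData v
    fromPair a b (divides c n≡) b<a = let a>0 , c>0 = positive c a (subst (0 <_) n≡ n>0) in record
      { A = a ; B = b ; C = c ; A>0 = a>0 ; B<A = b<a ; C>0 = c>0
      ; size = trans (four a c) (trans (cong (4 *_) (sym n≡)) v≡) }

  data-at : Fin (sum ds) → LatticeData v
  data-at i = fromPair (proj₁ (decode ds i)) (proj₂ (decode ds i))
    (D.sound (proj₁ (decode-sound ds i))) (proj₂ (decode-sound ds i))

  data-at-injective : ∀ i j → let open LatticeData in A (data-at i) ≡ A (data-at j) → B (data-at i) ≡ B (data-at j) → i ≡ j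
  data-at-injective i j a≡ b≡ = decode-injective D.unique i j (cong₂ _,_ a≡ b≡)

  data-at-surjective : ∀ d → ∃ λ i → data-at i ≡ d
  data-at-surjective d = let i , eq = decode-complete ds (D.complete (divides (C d) n≡)) (B<A d) in
    i , latticeData-≡ _ d (cong proj₁ eq) (cong proj₂ eq) (C≡ i (cong proj₁ eq))
    where
    open LatticeData
    n≡ : n ≡ C d * A d
    n≡ = ℕₚ.*-cancelˡ-≡ n (C d * A d) 4 (trans v≡ (trans (sym (size d)) (four (A d) (C d))))
    C≡ : ∀ i → A (data-at i) ≡ A d → C (data-at i) ≡ C d
    C≡ i A≡ = ℕₚ.*-cancelˡ-≡ _ _ (A d) {{>-nonZero (A>0 d)}}
      (trans (cong (_* C (data-at i)) (sym A≡)) (index-unique (data-at i) d))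

  covers : ∀ T → ∃ λ i → Equivalent (toTrihex (data-at i)) T
  covers T = let d , e = classification T ; i , eq = data-at-surjective d in
    i , subst (λ d → Equivalent (toTrihex d) T) (sym eq) e

  private
    Rel : Symmetry → Fin (sum ds) → Fin (sum ds) → Set
    Rel s i j = Similar (apply s) (LatticeData.Λ (data-at i)) (LatticeData.Λ (data-at j))

    functional : ∀ s {i j j′} → Rel s i j → Rel s i j′ → j ≡ j′
    functional s {i} {j} {j′} p q =
      let a≡ , b≡ , _ = similar⇒≡ (data-at j) (data-at j′) (similar-functional s p q) (similar-functional s q p) in
      data-at-injective j j′ a≡ b≡

    symmetry : Fin 6 → Symmetry
    symmetry i = proj₁ (remQuot {3} 2 i) , toBool (proj₂ (remQuot {3} 2 i))
      where
      toBool : Fin 2 → Bool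
      toBool 0F = false
      toBool 1F = true

    symmetry-surjective : ∀ s → ∃ λ i → symmetry i ≡ s
    symmetry-surjective (0F , false) = 0F , refl
    symmetry-surjective (0F , true)  = 1F , refl
    symmetry-surjective (1F , false) = 2F , refl
    symmetry-surjective (1F , true)  = 3F , refl
    symmetry-surjective (2F , false) = 4F , refl
    symmetry-surjective (2F , true)  = 5F , refl

  equivalenceClasses : ∃ λ α → HasClasses (trihexesUpToEquivalence v) α × α ≤ sum ds × sum ds ≤ α * 3
  equivalenceClasses = hasClasses (trihexesUpToEquivalence v) (toTrihex ∘ data-at)
    (λ i j → equivalent? (toTrihex (data-at i)) (toTrihex (data-at j))) covers
    (λ s → Rel (s , false)) (λ i j → equivalent⇒similar (data-at i) (data-at j)) (λ {s} → functional (s , false))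

  isomorphismClasses : ∃ λ β → HasClasses (trihexesUpToIsomorphism v) β × β ≤ sum ds × sum ds ≤ β * 6
  isomorphismClasses = hasClasses (trihexesUpToIsomorphism v) (toTrihex ∘ data-at)
    (λ i j → isomorphic? (toTrihex (data-at i)) (toTrihex (data-at j)))
    (λ T → let i , e = covers T in i , proj₁ e)
    (λ s → Rel (symmetry s)) related (λ {s} → functional (symmetry s))
    where
    related : ∀ i j → Isomorphic (toTrihex (data-at i)) (toTrihex (data-at j)) → ∃ λ s → Rel (symmetry s) i j
    related i j iso = let s , p = isomorphic⇒similar (data-at i) (data-at j) iso ; c , eq = symmetry-surjective s in
      c , subst (λ s → Rel s i j) (sym eq) p

fraction-≤ : ∀ k .{{_ : NonZero k}} σ γ → σ ≤ γ * k → (+ 1) ℚ./ k ℚ.* fromℕ σ ℚ.≤ fromℕ γ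
fraction-≤ (suc k) σ γ σ≤ = ℚₚ.toℚᵘ-cancel-≤ (begin
  ℚ.toℚᵘ ((+ 1) ℚ./ suc k ℚ.* fromℕ σ)                    ≃⟨ ℚₚ.toℚᵘ-homo-* ((+ 1) ℚ./ suc k) (fromℕ σ) ⟩
  ℚ.toℚᵘ ((+ 1) ℚ./ suc k) ℚᵘ.* ℚ.toℚᵘ (fromℕ σ)          ≃⟨ ℚᵘₚ.*-cong (ℚₚ.toℚᵘ-fromℚᵘ (mkℚᵘ (+ 1) k)) (ℚₚ.toℚᵘ-fromℚᵘ (mkℚᵘ (+ σ) 0)) ⟩
  mkℚᵘ (+ 1) k ℚᵘ.* mkℚᵘ (+ σ) 0                          ≤⟨ ℚᵘ.*≤* cross ⟩
  mkℚᵘ (+ γ) 0                                            ≃⟨ ℚₚ.toℚᵘ-fromℚᵘ (mkℚᵘ (+ γ) 0) ⟨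
  ℚ.toℚᵘ (fromℕ γ)                                        ∎)
  where
  open ℚᵘₚ.≤-Reasoning
  cross : (+ 1 ℤ.* + σ) ℤ.* + 1 ℤ.≤ + γ ℤ.* + suc (k * 1)
  cross = subst₂ ℤ._≤_ (sym (trans (ℤₚ.*-identityʳ (+ 1 ℤ.* + σ)) (ℤₚ.*-identityˡ (+ σ))))
    (trans (ℤₚ.pos-* γ (suc k)) (cong (λ l → + γ ℤ.* + suc l) (sym (ℕₚ.*-identityʳ k)))) (ℤ.+≤+ σ≤)

proposition7p3 :
    ∀ (v : ℕ) → v > 0 → 4 ∣ v → (F : PrimePowerFactorisation (v / 4)) →
    ∃₂ λ (α β : ℕ) →
      HasClasses (trihexesUpToEquivalence v) α ×
      HasClasses (trihexesUpToIsomorphism v) β ×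
      ((+ 1 ℚ./ 3) ℚ.* divisorProduct F ℚ.≤ fromℕ α) × (fromℕ α ℚ.≤ divisorProduct F) ×
      ((+ 1 ℚ./ 6) ℚ.* divisorProduct F ℚ.≤ fromℕ β) × (fromℕ β ℚ.≤ divisorProduct F)
proposition7p3 v v>0 4∣v F =
  let α , α-classes , α≤ , ≤3α = equivalenceClasses
      β , β-classes , β≤ , ≤6β = isomorphismClasses
  in α , β , α-classes , β-classes , below 3 α ≤3α , above α α≤ , below 6 β ≤6β , above β β≤
  where
  σ = sum (divisorsF F)
  v≡ : 4 * (v / 4) ≡ v
  v≡ = trans (ℕₚ.*-comm 4 (v / 4)) (m/n*n≡m 4∣v)
  quotient>0 : 0 < v / 4
  quotient>0 = ℕₚ.n≢0⇒n>0 λ eq → ℕₚ.<⇒≢ v>0 (trans (sym (cong (4 *_) eq)) v≡)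
  open Enumeration (v / 4) quotient>0 (divisorsF F) (divisorsF-list F) v v≡
  below : ∀ k .{{_ : NonZero k}} γ → σ ≤ γ * k → (+ 1 ℚ./ k) ℚ.* divisorProduct F ℚ.≤ fromℕ γ
  below k γ σ≤ = subst (λ q → (+ 1 ℚ./ k) ℚ.* q ℚ.≤ fromℕ γ) (sym (divisorProduct-sum F)) (fraction-≤ k σ γ σ≤)
  above : ∀ γ → γ ≤ σ → fromℕ γ ℚ.≤ divisorProduct F
  above γ γ≤ = subst (fromℕ γ ℚ.≤_) (sym (divisorProduct-sum F)) (fromℕ-mono-≤ γ≤)
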